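{- Let $\Delta_n$ be a uniform flag triangulation of the boundary $\partial P_n$ of the root polytope belonging to the revlex class. For $1\le k\le n-1$, the number of facets consisting of $k$ forward arrows and $n-k$ backward arrows is $$f(\Delta_n,k,n-k)=\sum_{i=1}^{k}\sum_{j=1}^{n-k}\binom{k-1}{i-1}\binom{n-k-1}{j-1}\left[\binom{n-k+i-j}{i}\binom{k-i+j}{j}+\binom{n-k+i-j}{i-1}\binom{k-i+j}{j-1}\right].$$ The number of facets with $n$ forward arrows and no backward arrows, and the number of facets with no forward arrows and $n$ backward arrows, are both equal to $2^{n-1}$.
   Context: $P_n$ is the convex hull of $e_j-e_i$ ($i\ne j$) in $\mathbb{R}^{n+1}$. An arrow $(i,j)$, $i\ne j\in\{1,\dots,n+1\}$, with tail $i$ and head $j$, is identified with $e_j-e_i$; forward if $i<j$, backward if $i>j$; $V_n$ is the set of arrows. A uniform flag triangulation of $\partial P_n$ is a flag simplicial complex on $V_n$ representing a triangulation of $\partial P_n$ (no new vertices) in which whether a pair $\{(i_1,j_1),(i_2,j_2)\}$ is an edge depends only on the equalities and inequalities among $i_1,i_2,j_1,j_2$. For two arrows with four distinct endpoints $p_1<\dots<p_4$ the type is the $T/H$ word of tails/heads at $p_1,\dots,p_4$; the pair nests if it joins $\{p_1,p_4\},\{p_2,p_3\}$, crosses if it joins $\{p_1,p_3\},\{p_2,p_4\}$. The revlex class: nesting pairs of types $THTH$ and $HTHT$ are edges, and crossing pairs of types $THHT$ and $HTTH$ are edges. $f(\Delta_n,i,j)$ is the number of faces with $i$ forward and $j$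 backward arrows. -}

module Defs where

open import Data.Bool using (Bool; true; false; _∧_; if_then_else_)
open import Data.Nat using (ℕ; zero; suc; _+_; _∸_; _≡ᵇ_; _<ᵇ_)
  renaming (_<_ to _<ℕ_)
open import Data.Nat.Combinatorics using (_C_)
open import Data.Fin using (Fin; toℕ; zero; suc)
open import Data.Fin.Properties using (_≟_)
open import Data.List using (List; []; _∷_; map; _++_; filter; length; concatMap; allFin)
open import Data.List.Membership.Propositional using (_∈_)
open import Data.List.Membership.DecPropositional as DM using ()
open import Data.Product using (Σ; _×_; _,_; proj₁; proj₂)
open import Data.Product.Properties using (≡-dec)
open import Data.Rational using (ℚ; 0ℚ; 1ℚ; _-_; ∣_∣) renaming (_+_ to _+ℚ_; _*_ to _*ℚ_; _≤_ to _≤ℚ_; _<_ to _<ℚ_; -_ to -ℚ_)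
open import Relation.Binary.PropositionalEquality using (_≡_; _≢_)
open import Relation.Nullary using (¬_; does)
open import Relation.Unary using (∁)
open import Function using (_⇔_; _∘_)

-- Combinatorics of arrows.  Coordinates/endpoints {1,…,n+1} are
-- represented by Fin (suc n) (endpoint p ↔ toℕ p + 1).
-- A pair (i , j) is the arrow with tail i and head j, i.e. e_j - e_i.

Pt : ℕ → Set
Pt n = Fin (suc n) × Fin (suc n)

tail head : ∀ {n} → Pt n → Fin (suc n)
tail = proj₁
head = proj₂

arrows : (n : ℕ) → List (Pt n)
arrows n = concatMap (λ i → map (λ j → (i , j))
             (filter (λ j → ¬? (i ≟ j)) (allFin (suc n)))) (allFin (suc n))
  where open import Relation.Nullary.Decidable using (¬?)

IsArrow : ∀ {n} → Pt n → Set
IsArrow a = tail a ≢ head a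

forward? backward? : ∀ {n} → Pt n → Bool
forward? a = toℕ (tail a) <ᵇ toℕ (head a)
backward? a = toℕ (head a) <ᵇ toℕ (tail a)

-- A flag simplicial complex on V_n is determined by its graph (edge
-- relation) E; a set of arrows is a face iff its elements are pairwise
-- joined by edges.
Graph : ℕ → Set
Graph n = Pt n → Pt n → Bool

Symmetric : ∀ {n} → Graph n → Set
Symmetric E = ∀ a b → E a b ≡ E b a

allAdj : ∀ {n} → Graph n → Pt n → List (Pt n) → Bool
allAdj E a [] = true
allAdj E a (b ∷ bs) = E a b ∧ allAdj E a bs

isFace : ∀ {n} → Graph n → List (Pt n) → Bool
isFace E [] = true
isFace E (a ∷ as) = allAdj E a as ∧ isFace E as

sublists : ∀ {A : Set} → List A → List (List A)
sublists [] = [] ∷ []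
sublists (x ∷ xs) = map (x ∷_) (sublists xs) ++ sublists xs

Face : ∀ {n} → Graph n → List (Pt n) → Set
Face {n} E S = S ∈ sublists (arrows n) × isFace E S ≡ true

countB : ∀ {A : Set} → (A → Bool) → List A → ℕ
countB p [] = 0
countB p (x ∷ xs) = (if p x then 1 else 0) + countB p xs

fvec : ∀ {n} → Graph n → ℕ → ℕ → ℕ
fvec {n} E i j =
  countB (λ S → isFace E S ∧ (countB forward? S ≡ᵇ i) ∧ (countB backward? S ≡ᵇ j))
         (sublists (arrows n))

quad : ∀ {n} → Pt n → Pt n → Fin 4 → Fin (suc n)
quad a b zero = tail a
quad a b (suc zero) = tail b
quad a b (suc (suc zero)) = head a
quad a b (suc (suc (suc zero))) = head b

SameOrderType : ∀ {n} → (Fin 4 → Fin (suc n)) → (Fin 4 → Fin (suc n)) → Set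
SameOrderType x y = ∀ p q → (toℕ (x p) <ℕ toℕ (x q)) ⇔ (toℕ (y p) <ℕ toℕ (y q))

Uniform : ∀ {n} → Graph n → Set
Uniform E = ∀ a b a′ b′ → IsArrow a → IsArrow b → IsArrow a′ → IsArrow b′ →
  SameOrderType (quad a b) (quad a′ b′) → E a b ≡ E a′ b′

-- The revlex class: for endpoints p1<p2<p3<p4,
--  THTH nesting pair {p1→p4, p3→p2}, HTHT nesting pair {p4→p1, p2→p3},
--  THHT crossing pair {p1→p3, p4→p2}, HTTH crossing pair {p3→p1, p2→p4}
-- are edges.
RevlexClass : ∀ {n} → Graph n → Set
RevlexClass {n} E = ∀ (p₁ p₂ p₃ p₄ : Fin (suc n)) →
  toℕ p₁ <ℕ toℕ p₂ → toℕ p₂ <ℕ toℕ p₃ → toℕ p₃ <ℕ toℕ p₄ →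
    (E (p₁ , p₄) (p₃ , p₂) ≡ true)
  × (E (p₄ , p₁) (p₂ , p₃) ≡ true)
  × (E (p₁ , p₃) (p₄ , p₂) ≡ true)
  × (E (p₃ , p₁) (p₂ , p₄) ≡ true)

-- Geometry over ℚ (all polytopes involved are rational).

Vec′ : ℕ → Set
Vec′ n = Fin (suc n) → ℚ

vecOf : ∀ {n} → Pt n → Vec′ n
vecOf (i , j) k =
  if does (k ≟ j) then 1ℚ else (if does (k ≟ i) then -ℚ 1ℚ else 0ℚ)

zeroV : ∀ {n} → Vec′ n
zeroV k = 0ℚ

lincomb : ∀ {n} → (vs : List (Vec′ n)) → (Fin (length vs) → ℚ) → Vec′ n
lincomb [] c = zeroV
lincomb (v ∷ vs) c k = c zero *ℚ v k +ℚ lincomb vs (c ∘ suc) k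

sumC : (m : ℕ) → (Fin m → ℚ) → ℚ
sumC zero c = 0ℚ
sumC (suc m) c = c zero +ℚ sumC m (c ∘ suc)

InConv : ∀ {n} → List (Vec′ n) → Vec′ n → Set
InConv vs x = Σ (Fin (length vs) → ℚ) λ c →
  (∀ t → 0ℚ ≤ℚ c t) × sumC (length vs) c ≡ 1ℚ × (∀ k → lincomb vs c k ≡ x k)

InAff : ∀ {n} → List (Vec′ n) → Vec′ n → Set
InAff vs x = Σ (Fin (length vs) → ℚ) λ c →
  sumC (length vs) c ≡ 1ℚ × (∀ k → lincomb vs c k ≡ x k)

AffinelyIndependent : ∀ {n} → List (Vec′ n) → Set
AffinelyIndependent vs = ∀ (c : Fin (length vs) → ℚ) →
  sumC (length vs) c ≡ 0ℚ → (∀ k → lincomb vs c k ≡ 0ℚ) → ∀ t → c t ≡ 0ℚ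

InP : (n : ℕ) → Vec′ n → Set
InP n = InConv (map vecOf (arrows n))

InBd : (n : ℕ) → Vec′ n → Set
InBd n x = InP n x × (∀ ε → 0ℚ <ℚ ε → Σ (Vec′ n) λ y →
  InAff (map vecOf (arrows n)) y × (∀ k → ∣ y k - x k ∣ <ℚ ε) × ¬ InP n y)

_∩L_ : ∀ {n} → List (Pt n) → List (Pt n) → List (Pt n)
_∩L_ {n} S T = filter (λ a → DM._∈?_ (≡-dec _≟_ _≟_) a T) S

Triangulates : ∀ {n} → Graph n → Set
Triangulates {n} E =
    (∀ S → Face E S → AffinelyIndependent (map vecOf S))
  × (∀ S → Face E S → ∀ x → InConv (map vecOf S) x → InBd n x)
  × (∀ x → InBd n x → Σ (List (Pt n)) λ S → Face E S × InConv (map vecOf S) x)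
  × (∀ S T → Face E S → Face E T → ∀ x →
       InConv (map vecOf S) x → InConv (map vecOf T) x →
       InConv (map vecOf (S ∩L T)) x)

RevlexUFT : ∀ {n} → Graph n → Set
RevlexUFT E = Symmetric E × Uniform E × Triangulates E × RevlexClass E

sum1 : ℕ → (ℕ → ℕ) → ℕ
sum1 zero g = 0
sum1 (suc k) g = sum1 k g + g (suc k)

formula : ℕ → ℕ → ℕ
formula n k = sum1 k λ i → sum1 (n ∸ k) λ j →
  ((k ∸ 1) C (i ∸ 1)) Data.Nat.* ((n ∸ k ∸ 1) C (j ∸ 1)) Data.Nat.*
  ( ((n ∸ k + i ∸ j) C i) Data.Nat.* ((k ∸ i + j) C j)
  + ((n ∸ k + i ∸ j) C (i ∸ 1)) Data.Nat.* ((k ∸ i + j) C (j ∸ 1)))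

{-# OPTIONS --safe #-}
-- Two arrows i → j and j → k are never adjacent, since their midpoint is interior; arrows sharing
-- a tail or a head are adjacent; and of the two matchings between {t , t′} and {h , h′}
-- exactly one is an edge, since both have the same midpoint on the face spanned by these arrows.
-- With the revlex rule this fixes the graph up to whether the TTHH pairs (α) and the HHTT pairs
-- (β) nest or cross.  Compatibility of forward with backward arrows does not depend on α and β,
-- and only involves the sets of endpoints.
--
-- Write an arrow as a pair of lower and upper end.  A facet labels all n + 1 endpoints as tails
-- or heads and has a pivot π such that its forward part is a maximal staircase in
-- (tails ≤ π) × (heads ≥ π) and its backward part one in (heads ≤ π) × (tails ≥ π).  A staircase
-- in a p × q grid has at most p + q - 1 cells, and n arrows are reached only if both staircases
-- are maximal.  With i heads ≥ π and j heads ≤ π, the two staircases contribute the first two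
-- binomials of the formula, and the labels left and right of π the bracket, whose two terms
-- correspond to a tail or a head at π.
module Submission where

open import Defs
open import Data.Bool using (Bool; true; false; _∧_; _∨_; not; if_then_else_)
open import Data.Bool.Properties using (T-≡; ∨-zeroʳ) renaming (_≟_ to _≟ᵇ_)
open import Data.Empty using (⊥; ⊥-elim)
open import Data.Fin using (Fin; toℕ; fromℕ<; zero; suc)
import Data.Fin.Properties as Fin
import Data.Integer as ℤ
open import Data.List using (List; []; _∷_; map; _++_; filter; length; concatMap; allFin; reverse; cartesianProduct; replicate)
open import Data.List.Membership.DecPropositional as DM using ()
open import Data.List.Membership.Propositional using (_∈_; find; lose)
open import Data.List.Membership.Propositional.Properties
open import Data.List.Properties using (length-map; filter-accept; filter-reject; length-++; ∷-injective; ∷-injectiveʳ; unfold-reverse; length-reverse; length-replicate; ++-assoc)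
open import Data.List.Relation.Unary.All as All using (All; []; _∷_)
import Data.List.Relation.Unary.All.Properties as All
open import Data.List.Relation.Unary.AllPairs as AllPairs using (AllPairs; []; _∷_)
import Data.List.Relation.Unary.AllPairs.Properties as AllPairs
open import Data.List.Relation.Unary.Any using (here; there; any?)
open import Data.List.Relation.Unary.Any.Properties using (reverse⁺; reverse⁻)
open import Data.List.Relation.Unary.Unique.Propositional using (Unique)
import Data.List.Relation.Unary.Unique.Propositional.Properties as Unique
open import Data.Nat using (ℕ; zero; suc; _+_; _*_; _∸_; _≤_; _<_; z≤n; s≤s; _^_; _≡ᵇ_)
open import Data.Nat.Combinatorics using (_C_; nCn≡1; nCk+nC[k+1]≡[n+1]C[k+1]; nCk≡nC[n∸k])
open import Data.Nat.Properties
open import Data.Nat.Solver using (module +-*-Solver)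
open import Data.Product using (Σ; ∃; ∃₂; _×_; _,_; proj₁; proj₂; swap)
open import Data.Product.Properties using (≡-dec)
open import Data.Rational using (ℚ; 0ℚ; 1ℚ; ½; _-_; ∣_∣) renaming (_+_ to _+ℚ_; _*_ to _*ℚ_; _≤_ to _≤ℚ_; _<_ to _<ℚ_; -_ to -ℚ_)
import Data.Rational as ℚ
import Data.Rational.Properties as ℚ
import Data.Rational.Solver as ℚ
open import Data.Sum using (_⊎_; inj₁; inj₂)
open import Data.Unit using (⊤; tt)
open import Function using (_∘_; mk⇔; Equivalence)
open import Relation.Binary.Definitions using (tri<; tri≈; tri>)
open import Relation.Binary.PropositionalEquality
open import Relation.Nullary using (¬_; yes; no; Dec)
open import Relation.Nullary.Decidable using (¬?; True; toWitness)

-- Lists and sublists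

-- The geometry is used only through midpoints of two arrows. If a linear form is at most `M > 0` on
-- all arrows and equals `M` at a midpoint, then the midpoint is on the boundary, so some face
-- covers it, and only arrows on which the form equals `M` carry weight there; this forces edges.
-- Non-edges come from a midpoint that is interior, or from two edges that could only meet in the
-- empty set.
--
-- The pivot of a facet is its largest lower end, which compatibility keeps weakly below every upper
-- end. As the pivot lies on both sides, the four label sets have `n + 2` elements together, so two
-- maximal staircases have exactly `n` cells together. The value of α (or β) only decides whether
-- upper ends are read downwards or upwards along the staircase, so it does not affect the number of
-- staircases.
--
-- If one direction is absent, the labels are all forced by the cut behind the largest lower end,
-- and the staircase word determines this cut. Every word of `n - 1` steps then gives one facet,
-- whence the power of two.

private variable
  A B : Set

∈-delete : {x : A} {ys : List A} → x ∈ ys →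
  ∃ λ ys′ → length ys ≡ suc (length ys′) × (∀ {z} → z ∈ ys → z ≢ x → z ∈ ys′)
∈-delete {ys = y ∷ ys} (here refl) =
  ys , refl , λ { (here e) ne → ⊥-elim (ne e) ; (there m) _ → m }
∈-delete {ys = y ∷ ys} (there m) with ∈-delete m
... | ys′ , e , f =
  y ∷ ys′ , cong suc e , λ { (here e′) _ → here e′ ; (there q) ne → there (f q ne) }

unique-⊆⇒length≤ : {xs ys : List A} → Unique xs → (∀ {x} → x ∈ xs → x ∈ ys) → length xs ≤ length ys
unique-⊆⇒length≤ [] _ = z≤n
unique-⊆⇒length≤ (x∉ ∷ u) sub with ∈-delete (sub (here refl))
... | ys′ , e , f = subst (suc _ ≤_) (sym e)
  (s≤s (unique-⊆⇒length≤ u λ m → f (sub (there m)) λ { refl → All.lookup x∉ m refl }))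

countB≡length-filter : (p : A → Bool) (xs : List A) → countB p xs ≡ length (filter (λ x → p x ≟ᵇ true) xs)
countB≡length-filter p [] = refl
countB≡length-filter p (x ∷ xs) with p x
... | true = cong suc (countB≡length-filter p xs)
... | false = countB≡length-filter p xs

unique-map : {xs : List A} (f : A → B) → Unique xs →
  (∀ {x y} → x ∈ xs → y ∈ xs → f x ≡ f y → x ≡ y) → Unique (map f xs)
unique-map f [] inj = []
unique-map f (x∉ ∷ u) inj =
  All.map⁺ (All.tabulate λ m e → All.lookup x∉ m (inj (here refl) (there m) e))
  ∷ unique-map f u λ a b → inj (there a) (there b)

-- Two instances of the pigeonhole bound. Injectivity is asked only on `ys`, since codes are
-- compared only within the list that enumerates them.
countB-bijection : {p : A → Bool} {xs : List A} {ys : List B} (f : B → A) →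
  Unique xs → Unique ys →
  (∀ {y y′} → y ∈ ys → y′ ∈ ys → f y ≡ f y′ → y ≡ y′) →
  (∀ {y} → y ∈ ys → f y ∈ xs × p (f y) ≡ true) →
  (∀ {x} → x ∈ xs → p x ≡ true → ∃ λ y → y ∈ ys × x ≡ f y) →
  countB p xs ≡ length ys
countB-bijection {p = p} {xs} {ys} f uxs uys inj into onto = begin
  countB p xs                                ≡⟨ countB≡length-filter p xs ⟩
  length (filter (λ x → p x ≟ᵇ true) xs)     ≡⟨ ≤-antisym le ge ⟩
  length (map f ys)                          ≡⟨ length-map f ys ⟩
  length ys                                  ∎
  where
  open ≡-Reasoning
  le = unique-⊆⇒length≤ (Unique.filter⁺ (λ x → p x ≟ᵇ true) uxs) λ m →
    let (x∈ , px) = ∈-filter⁻ (λ x → p x ≟ᵇ true) m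
        (y , y∈ , e) = onto x∈ px
    in subst (_∈ map f ys) (sym e) (∈-map⁺ f y∈)
  ge = unique-⊆⇒length≤ (unique-map f uys inj) λ m →
    let (y , y∈ , e) = ∈-map⁻ f m
        (a , b) = into y∈
    in subst (_∈ filter (λ x → p x ≟ᵇ true) xs) (sym e) (∈-filter⁺ (λ x → p x ≟ᵇ true) a b)

∈-sublists⇒⊆ : {xs S : List A} → S ∈ sublists xs → ∀ {a} → a ∈ S → a ∈ xs
∈-sublists⇒⊆ {xs = []} (here refl) ()
∈-sublists⇒⊆ {xs = x ∷ xs} m with ∈-++⁻ (map (x ∷_) (sublists xs)) m
... | inj₂ q = there ∘ ∈-sublists⇒⊆ q
... | inj₁ q with ∈-map⁻ (x ∷_) q
...   | S′ , r , refl = λ { (here e) → here e ; (there a) → there (∈-sublists⇒⊆ r a) }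

sublists-unique : {xs : List A} → Unique xs → Unique (sublists xs)
sublists-unique [] = [] ∷ []
sublists-unique {xs = x ∷ xs} (x∉ ∷ u) =
  Unique.++⁺ (Unique.map⁺ ∷-injectiveʳ (sublists-unique u)) (sublists-unique u) disj
  where
  disj : ∀ {S} → S ∈ map (x ∷_) (sublists xs) × S ∈ sublists xs → ⊥
  disj (m , q) with ∈-map⁻ (x ∷_) m
  ... | _ , _ , refl = All.lookup x∉ (∈-sublists⇒⊆ q (here refl)) refl

∈-sublists⇒unique : {xs S : List A} → Unique xs → S ∈ sublists xs → Unique S
∈-sublists⇒unique {xs = []} u (here refl) = []
∈-sublists⇒unique {xs = x ∷ xs} (x∉ ∷ u) m with ∈-++⁻ (map (x ∷_) (sublists xs)) m
... | inj₂ q = ∈-sublists⇒unique u q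
... | inj₁ q with ∈-map⁻ (x ∷_) q
...   | S′ , r , refl = All.tabulate (λ a → All.lookup x∉ (∈-sublists⇒⊆ r a)) ∷ ∈-sublists⇒unique u r

select : (A → Bool) → List A → List A
select p = filter (λ x → p x ≟ᵇ true)

select∈sublists : (p : A → Bool) (xs : List A) → select p xs ∈ sublists xs
select∈sublists p [] = here refl
select∈sublists p (x ∷ xs) with p x
... | true = ∈-++⁺ˡ (∈-map⁺ (x ∷_) (select∈sublists p xs))
... | false = ∈-++⁺ʳ (map (x ∷_) (sublists xs)) (select∈sublists p xs)

-- `sublists` keeps the order of `xs`, and `xs` has no repetitions, so a sublist is determined by
-- its members. Faces can thus be compared as sets.
sublist≡select : {xs S : List A} (p : A → Bool) → Unique xs → S ∈ sublists xs →
  (∀ {a} → a ∈ S → p a ≡ true) → (∀ {a} → a ∈ xs → p a ≡ true → a ∈ S) → S ≡ select p xs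
sublist≡select {xs = []} p u (here refl) _ _ = refl
sublist≡select {xs = x ∷ xs} p (x∉ ∷ u) m to from with ∈-++⁻ (map (x ∷_) (sublists xs)) m
... | inj₂ q = trans
  (sublist≡select p u q to (from ∘ there))
  (sym (filter-reject (λ x → p x ≟ᵇ true) λ px → All.lookup x∉ (∈-sublists⇒⊆ q (from (here refl) px)) refl))
... | inj₁ q with ∈-map⁻ (x ∷_) q
...   | S′ , r , refl = trans
  (cong (x ∷_) (sublist≡select p u r (to ∘ there) λ a∈ pa → tail∈ a∈ (from (there a∈) pa)))
  (sym (filter-accept (λ x → p x ≟ᵇ true) (to (here refl))))
  where
  tail∈ : ∀ {a} → a ∈ xs → a ∈ x ∷ S′ → a ∈ S′
  tail∈ a∈ (here refl) = ⊥-elim (All.lookup x∉ a∈ refl)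
  tail∈ a∈ (there z) = z

∧-true : ∀ {a b} → a ∧ b ≡ true → a ≡ true × b ≡ true
∧-true {true} {true} refl = refl , refl

-- Faces as cliques, and the list of arrows

module _ {n : ℕ} {E : Graph n} where

  allAdj⇒ : ∀ {a as} → allAdj E a as ≡ true → ∀ {b} → b ∈ as → E a b ≡ true
  allAdj⇒ h (here refl) = proj₁ (∧-true h)
  allAdj⇒ {a} {c ∷ as} h (there m) = allAdj⇒ (proj₂ (∧-true {E a c} h)) m

  allAdj⇐ : ∀ {a as} → (∀ {b} → b ∈ as → E a b ≡ true) → allAdj E a as ≡ true
  allAdj⇐ {as = []} h = refl
  allAdj⇐ {as = b ∷ as} h = cong₂ _∧_ (h (here refl)) (allAdj⇐ (h ∘ there))

  -- `isFace` tests each pair only in the order of the list; symmetry supplies the other order.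
  isFace⇒ : Symmetric E → ∀ {S} → isFace E S ≡ true →
    ∀ {a b} → a ∈ S → b ∈ S → a ≢ b → E a b ≡ true
  isFace⇒ sy h (here refl) (here refl) ne = ⊥-elim (ne refl)
  isFace⇒ sy h (here refl) (there m) ne = allAdj⇒ (proj₁ (∧-true h)) m
  isFace⇒ sy h (there m) (here refl) ne = trans (sy _ _) (allAdj⇒ (proj₁ (∧-true h)) m)
  isFace⇒ sy {c ∷ S} h (there m) (there q) ne = isFace⇒ sy (proj₂ (∧-true {allAdj E c S} h)) m q ne

  isFace⇐ : ∀ {S} → Unique S → (∀ {a b} → a ∈ S → b ∈ S → a ≢ b → E a b ≡ true) → isFace E S ≡ true
  isFace⇐ [] h = refl
  isFace⇐ (x∉ ∷ u) h = cong₂ _∧_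
    (allAdj⇐ λ m → h (here refl) (there m) (All.lookup x∉ m))
    (isFace⇐ u λ a b → h (there a) (there b))

module _ (n : ℕ) where

  private
    row : Fin (suc n) → List (Pt n)
    row i = map (λ j → (i , j)) (filter (λ j → ¬? (i Fin.≟ j)) (allFin (suc n)))

    ∈-row⁻ : ∀ {i a} → a ∈ row i → tail a ≡ i × IsArrow a
    ∈-row⁻ {i} m with ∈-map⁻ (λ j → (i , j)) m
    ... | j , q , refl = refl , proj₂ (∈-filter⁻ (λ j → ¬? (i Fin.≟ j)) {xs = allFin (suc n)} q)

    rows-unique : ∀ {is} → Unique is → Unique (concatMap row is)
    rows-unique [] = []
    rows-unique {i ∷ is} (i∉ ∷ u) =
      Unique.++⁺ (Unique.map⁺ (λ { refl → refl }) (Unique.filter⁺ (λ j → ¬? (i Fin.≟ j)) (Unique.allFin⁺ (suc n)))) (rows-unique u)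
        λ (m , q) → let (i′ , i′∈ , z) = later q in
          All.lookup i∉ i′∈ (trans (sym (proj₁ (∈-row⁻ m))) z)
      where
      later : ∀ {a} → a ∈ concatMap row is → ∃ λ i′ → i′ ∈ is × tail a ≡ i′
      later q with ∈-concat⁻′ (map row is) q
      ... | _ , q₁ , q₂ with ∈-map⁻ row q₂
      ...   | i′ , i′∈ , refl = i′ , i′∈ , proj₁ (∈-row⁻ q₁)

  arrows-unique : Unique (arrows n)
  arrows-unique = rows-unique (Unique.allFin⁺ (suc n))

  ∈-arrows⁺ : ∀ {a} → IsArrow a → a ∈ arrows n
  ∈-arrows⁺ {i , j} ne = ∈-concat⁺′
    (∈-map⁺ (λ j → (i , j)) (∈-filter⁺ (λ j → ¬? (i Fin.≟ j)) (∈-allFin j) ne))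
    (∈-map⁺ row (∈-allFin i))

  ∈-arrows⁻ : ∀ {a} → a ∈ arrows n → IsArrow a
  ∈-arrows⁻ q with ∈-concat⁻′ (map row (allFin (suc n))) q
  ... | _ , q₁ , q₂ with ∈-map⁻ row q₂
  ...   | i′ , i′∈ , refl = proj₂ (∈-row⁻ q₁)

-- Label words and their positions

cnt : Bool → List Bool → ℕ
cnt d [] = 0
cnt d (b ∷ w) with d ≟ᵇ b
... | yes _ = suc (cnt d w)
... | no _ = cnt d w

cnt-++ : ∀ d w w′ → cnt d (w ++ w′) ≡ cnt d w + cnt d w′
cnt-++ d [] w′ = refl
cnt-++ d (b ∷ w) w′ with d ≟ᵇ b
... | yes _ = cong suc (cnt-++ d w w′)
... | no _ = cnt-++ d w w′

cnt-total : ∀ d w → cnt d w + cnt (not d) w ≡ length w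
cnt-total d [] = refl
cnt-total true (true ∷ w) = cong suc (cnt-total true w)
cnt-total true (false ∷ w) = trans (+-suc _ _) (cong suc (cnt-total true w))
cnt-total false (true ∷ w) = trans (+-suc _ _) (cong suc (cnt-total false w))
cnt-total false (false ∷ w) = cong suc (cnt-total false w)

cnt-replicate : ∀ d m → cnt d (replicate m d) ≡ m
cnt-replicate d zero = refl
cnt-replicate true (suc m) = cong suc (cnt-replicate true m)
cnt-replicate false (suc m) = cong suc (cnt-replicate false m)

words : ℕ → ℕ → List (List Bool)
words zero zero = [] ∷ []
words zero (suc b) = map (false ∷_) (words zero b)
words (suc a) zero = map (true ∷_) (words a zero)
words (suc a) (suc b) = map (true ∷_) (words a (suc b)) ++ map (false ∷_) (words (suc a) b)

length-words : ∀ a b → length (words a b) ≡ (a + b) C b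
length-words zero zero = refl
length-words zero (suc b) = trans (length-map _ (words zero b))
  (trans (length-words zero b) (trans (nCn≡1 b) (sym (nCn≡1 (suc b)))))
length-words (suc a) zero = trans (length-map _ (words a zero)) (length-words a zero)
length-words (suc a) (suc b) = begin
  length (words (suc a) (suc b))
    ≡⟨ length-++ (map (true ∷_) (words a (suc b))) ⟩
  length (map (true ∷_) (words a (suc b))) + length (map (false ∷_) (words (suc a) b))
    ≡⟨ cong₂ _+_ (length-map _ (words a (suc b))) (length-map _ (words (suc a) b)) ⟩
  length (words a (suc b)) + length (words (suc a) b)
    ≡⟨ cong₂ _+_ (length-words a (suc b)) (length-words (suc a) b) ⟩
  (a + suc b) C suc b + suc (a + b) C b
    ≡⟨ +-comm ((a + suc b) C suc b) _ ⟩
  suc (a + b) C b + (a + suc b) C suc b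
    ≡⟨ cong (λ z → suc (a + b) C b + z C suc b) (+-suc a b) ⟩
  suc (a + b) C b + suc (a + b) C suc b
    ≡⟨ nCk+nC[k+1]≡[n+1]C[k+1] (suc (a + b)) b ⟩
  suc (suc (a + b)) C suc b
    ≡⟨ cong (λ z → suc z C suc b) (sym (+-suc a b)) ⟩
  (suc a + suc b) C suc b ∎
  where open ≡-Reasoning

∈-words⁺ : ∀ w {a b} → cnt true w ≡ a → cnt false w ≡ b → w ∈ words a b
∈-words⁺ [] refl refl = here refl
∈-words⁺ (true ∷ w) {suc a} {zero} e f = ∈-map⁺ (true ∷_) (∈-words⁺ w (suc-injective e) f)
∈-words⁺ (true ∷ w) {suc a} {suc b} e f = ∈-++⁺ˡ (∈-map⁺ (true ∷_) (∈-words⁺ w (suc-injective e) f))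
∈-words⁺ (false ∷ w) {zero} {suc b} e f = ∈-map⁺ (false ∷_) (∈-words⁺ w e (suc-injective f))
∈-words⁺ (false ∷ w) {suc a} {suc b} e f =
  ∈-++⁺ʳ (map (true ∷_) (words a (suc b))) (∈-map⁺ (false ∷_) (∈-words⁺ w e (suc-injective f)))

∈-words⁻ : ∀ a b {w} → w ∈ words a b → cnt true w ≡ a × cnt false w ≡ b
∈-words⁻ zero zero (here refl) = refl , refl
∈-words⁻ zero (suc b) m with ∈-map⁻ (false ∷_) m
... | w , q , refl = let (e , f) = ∈-words⁻ zero b q in e , cong suc f
∈-words⁻ (suc a) zero m with ∈-map⁻ (true ∷_) m
... | w , q , refl = let (e , f) = ∈-words⁻ a zero q in cong suc e , f
∈-words⁻ (suc a) (suc b) m with ∈-++⁻ (map (true ∷_) (words a (suc b))) m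
... | inj₁ m′ with ∈-map⁻ (true ∷_) m′
...   | w , q , refl = let (e , f) = ∈-words⁻ a (suc b) q in cong suc e , f
∈-words⁻ (suc a) (suc b) m | inj₂ m′ with ∈-map⁻ (false ∷_) m′
...   | w , q , refl = let (e , f) = ∈-words⁻ (suc a) b q in e , cong suc f

words-unique : ∀ a b → Unique (words a b)
words-unique zero zero = [] ∷ []
words-unique zero (suc b) = Unique.map⁺ ∷-injectiveʳ (words-unique zero b)
words-unique (suc a) zero = Unique.map⁺ ∷-injectiveʳ (words-unique a zero)
words-unique (suc a) (suc b) =
  Unique.++⁺ (Unique.map⁺ ∷-injectiveʳ (words-unique a (suc b)))
             (Unique.map⁺ ∷-injectiveʳ (words-unique (suc a) b)) disj
  where
  disj : ∀ {w} → w ∈ map (true ∷_) (words a (suc b)) × w ∈ map (false ∷_) (words (suc a) b) → ⊥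
  disj (m , q) with ∈-map⁻ (true ∷_) m | ∈-map⁻ (false ∷_) q
  ... | _ , _ , refl | _ , _ , ()

pos : Bool → ℕ → List Bool → List ℕ
pos d o [] = []
pos d o (b ∷ w) with d ≟ᵇ b
... | yes _ = o ∷ pos d (suc o) w
... | no _ = pos d (suc o) w

length-pos : ∀ d o w → length (pos d o w) ≡ cnt d w
length-pos d o [] = refl
length-pos d o (b ∷ w) with d ≟ᵇ b
... | yes _ = cong suc (length-pos d (suc o) w)
... | no _ = length-pos d (suc o) w

pos-≥ : ∀ d o w {v} → v ∈ pos d o w → o ≤ v
pos-≥ d o (b ∷ w) m with d ≟ᵇ b | m
... | yes _ | here refl = ≤-refl
... | yes _ | there q = <⇒≤ (pos-≥ d (suc o) w q)
... | no _ | q = <⇒≤ (pos-≥ d (suc o) w q)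

pos-< : ∀ d o w {v} → v ∈ pos d o w → v < o + length w
pos-< d o (b ∷ w) {v} m with d ≟ᵇ b | m
... | yes _ | here refl = m<m+n o (s≤s z≤n)
... | yes _ | there q = subst (v <_) (sym (+-suc o (length w))) (pos-< d (suc o) w q)
... | no _ | q = subst (v <_) (sym (+-suc o (length w))) (pos-< d (suc o) w q)

pos-sorted : ∀ d o w → AllPairs _<_ (pos d o w)
pos-sorted d o [] = []
pos-sorted d o (b ∷ w) with d ≟ᵇ b
... | yes _ = All.tabulate (pos-≥ d (suc o) w) ∷ pos-sorted d (suc o) w
... | no _ = pos-sorted d (suc o) w

pos-deterministic : ∀ {d d′} o w {v} → v ∈ pos d o w → v ∈ pos d′ o w → d ≡ d′
pos-deterministic {d} {d′} o (b ∷ w) m q with d ≟ᵇ b | d′ ≟ᵇ b | m | q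
... | yes refl | yes refl | _ | _ = refl
... | yes _ | no _ | here refl | q′ = ⊥-elim (<-irrefl refl (pos-≥ d′ (suc o) w q′))
... | yes _ | no _ | there m′ | q′ = pos-deterministic (suc o) w m′ q′
... | no _ | yes _ | m′ | here refl = ⊥-elim (<-irrefl refl (pos-≥ d (suc o) w m′))
... | no _ | yes _ | m′ | there q′ = pos-deterministic (suc o) w m′ q′
... | no _ | no _ | m′ | q′ = pos-deterministic (suc o) w m′ q′

pos-++ : ∀ d o w w′ → pos d o (w ++ w′) ≡ pos d o w ++ pos d (o + length w) w′
pos-++ d o [] w′ = cong (λ z → pos d z w′) (sym (+-identityʳ o))
pos-++ d o (b ∷ w) w′ rewrite +-suc o (length w) with d ≟ᵇ b
... | yes _ = cong (o ∷_) (pos-++ d (suc o) w w′)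
... | no _ = pos-++ d (suc o) w w′

-- One inclusion per label is enough: every position carries exactly one label, so the included
-- positions already exhaust a word of the same length.
pos-injective : ∀ o w w′ → length w ≡ length w′ →
  (∀ d {v} → v ∈ pos d o w → v ∈ pos d o w′) → w ≡ w′
pos-injective o [] [] _ _ = refl
pos-injective o (b ∷ w) (b′ ∷ w′) e sub =
  cong₂ _∷_ (b≡b′ b b′ sub) (pos-injective (suc o) w w′ (suc-injective e) sub′)
  where
  b≡b′ : ∀ b b′ → (∀ d {v} → v ∈ pos d o (b ∷ w) → v ∈ pos d o (b′ ∷ w′)) → b ≡ b′
  b≡b′ true true sub = refl
  b≡b′ false false sub = refl
  b≡b′ true false sub = ⊥-elim (<-irrefl refl (pos-≥ true (suc o) w′ (sub true (here refl))))
  b≡b′ false true sub = ⊥-elim (<-irrefl refl (pos-≥ false (suc o) w′ (sub false (here refl))))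
  weaken : ∀ d {v} → v ∈ pos d (suc o) w → v ∈ pos d o (b ∷ w)
  weaken d m with d ≟ᵇ b
  ... | yes _ = there m
  ... | no _ = m
  sub′ : ∀ d {v} → v ∈ pos d (suc o) w → v ∈ pos d (suc o) w′
  sub′ d {v} m with d ≟ᵇ b′ | sub d (weaken d m)
  ... | yes _ | here refl = ⊥-elim (<-irrefl refl (pos-≥ d (suc o) w m))
  ... | yes _ | there q = q
  ... | no _ | q = q

tab : (ℕ → Bool) → ℕ → ℕ → List Bool
tab f o zero = []
tab f o (suc m) = f o ∷ tab f (suc o) m

length-tab : ∀ f o m → length (tab f o m) ≡ m
length-tab f o zero = refl
length-tab f o (suc m) = cong suc (length-tab f (suc o) m)

-- The form with alternatives makes the induction go through for every `v`: the list to look in is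
-- named by `f v`, and the only failure is that `v` is outside the tabulated interval.
pos-tab : ∀ f o m {v} → v ∈ pos (f v) o (tab f o m) ⊎ (v < o ⊎ o + m ≤ v)
pos-tab f o zero {v} with v <? o
... | yes v<o = inj₂ (inj₁ v<o)
... | no v≮o = inj₂ (inj₂ (subst (_≤ v) (sym (+-identityʳ o)) (≮⇒≥ v≮o)))
pos-tab f o (suc m) {v} with pos-tab f (suc o) m {v}
... | inj₂ (inj₂ q) = inj₂ (inj₂ (subst (_≤ v) (sym (+-suc o m)) q))
... | inj₁ q with f v ≟ᵇ f o
...   | yes _ = inj₁ (there q)
...   | no _ = inj₁ q
pos-tab f o (suc m) {v} | inj₂ (inj₁ v≤o) with m≤n⇒m<n∨m≡n (≤-pred v≤o)
... | inj₁ v<o = inj₂ (inj₁ v<o)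
... | inj₂ refl with f o ≟ᵇ f o
...   | yes _ = inj₁ (here refl)
...   | no ne = ⊥-elim (ne refl)

∈-pos-tab : ∀ f o m {v d} → f v ≡ d → o ≤ v → v < o + m → v ∈ pos d o (tab f o m)
∈-pos-tab f o m {v} refl o≤v v< with pos-tab f o m {v}
... | inj₁ q = q
... | inj₂ (inj₁ v<o) = ⊥-elim (<-irrefl refl (<-≤-trans v<o o≤v))
... | inj₂ (inj₂ le) = ⊥-elim (<-irrefl refl (<-≤-trans v< le))

-- Staircase walks

Pair : Set
Pair = ℕ × ℕ

lo hi : Pair → ℕ
lo = proj₁
hi = proj₂

_≟ᵖ_ : (a b : Pair) → Dec (a ≡ b)
_≟ᵖ_ = ≡-dec _≟_ _≟_

-- The order in which upper ends are met while lower ends increase: downwards for `true`, where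
-- nested pairs are edges, and upwards for `false`, where crossing pairs are.
Before : Bool → ℕ → ℕ → Set
Before true x y = y < x
Before false x y = x < y

before-asym : ∀ α {x y} → Before α x y → ¬ Before α y x
before-asym true p q = <-asym p q
before-asym false p q = <-asym p q

before-irrefl : ∀ α {x} → ¬ Before α x x
before-irrefl true = <-irrefl refl
before-irrefl false = <-irrefl refl

-- Pairs with a common lower end or a common upper end are unconstrained, as arrows with a common
-- tail or head are adjacent.
Chain : Bool → List Pair → Set
Chain α F = ∀ {a b} → a ∈ F → b ∈ F → lo a < lo b → ¬ Before α (hi b) (hi a)

-- A lattice path from the first cell of the grid: `true` advances the lower end, `false` the upper
-- end. A letter emits the cell that is left and the empty word emits the last cell, hence one cell
-- more than letters.
walk : List ℕ → List ℕ → List Bool → List Pair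
walk [] _ _ = []
walk (t ∷ ts) [] _ = []
walk (t ∷ ts) (h ∷ hs) [] = (t , h) ∷ []
walk (t ∷ ts) (h ∷ hs) (true ∷ u) = (t , h) ∷ walk ts (h ∷ hs) u
walk (t ∷ ts) (h ∷ hs) (false ∷ u) = (t , h) ∷ walk (t ∷ ts) hs u

-- The path ends in the opposite corner of the grid; the successors account for the starting cell.
Fits : List ℕ → List ℕ → List Bool → Set
Fits ts hs u = suc (cnt true u) ≡ length ts × suc (cnt false u) ≡ length hs

∈-walk : ∀ ts hs u {a} → a ∈ walk ts hs u → lo a ∈ ts × hi a ∈ hs
∈-walk (t ∷ ts) (h ∷ hs) [] (here refl) = here refl , here refl
∈-walk (t ∷ ts) (h ∷ hs) (true ∷ u) (here refl) = here refl , here refl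
∈-walk (t ∷ ts) (h ∷ hs) (true ∷ u) (there m) =
  let (p , q) = ∈-walk ts (h ∷ hs) u m in there p , q
∈-walk (t ∷ ts) (h ∷ hs) (false ∷ u) (here refl) = here refl , here refl
∈-walk (t ∷ ts) (h ∷ hs) (false ∷ u) (there m) =
  let (p , q) = ∈-walk (t ∷ ts) hs u m in p , there q

length-walk : ∀ ts hs u → Fits ts hs u → length (walk ts hs u) ≡ suc (cnt true u + cnt false u)
length-walk (t ∷ ts) (h ∷ hs) [] _ = refl
length-walk (t ∷ ts) (h ∷ hs) (true ∷ u) (e , f) = cong suc (length-walk ts (h ∷ hs) u (suc-injective e , f))
length-walk (t ∷ ts) (h ∷ hs) (false ∷ u) (e , f) =
  cong suc (trans (length-walk (t ∷ ts) hs u (e , suc-injective f)) (sym (+-suc _ _)))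

walk-unique : ∀ {ts hs} u → Unique ts → Unique hs → Unique (walk ts hs u)
walk-unique {[]} u ut uh = []
walk-unique {t ∷ ts} {[]} u ut uh = []
walk-unique {t ∷ ts} {h ∷ hs} [] ut uh = [] ∷ []
walk-unique {t ∷ ts} {h ∷ hs} (true ∷ u) (t∉ ∷ ut) uh =
  All.tabulate (λ m e → All.lookup t∉ (proj₁ (∈-walk ts (h ∷ hs) u m)) (cong lo e)) ∷ walk-unique u ut uh
walk-unique {t ∷ ts} {h ∷ hs} (false ∷ u) ut (h∉ ∷ uh) =
  All.tabulate (λ m e → All.lookup h∉ (proj₂ (∈-walk (t ∷ ts) hs u m)) (cong hi e)) ∷ walk-unique u ut uh

first≤ : ∀ {t ts v} → AllPairs _<_ (t ∷ ts) → v ∈ t ∷ ts → t ≤ v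
first≤ _ (here refl) = ≤-refl
first≤ (t< ∷ _) (there m) = <⇒≤ (All.lookup t< m)

first-before : ∀ α {h hs v} → AllPairs (Before α) (h ∷ hs) → v ∈ h ∷ hs → ¬ Before α v h
first-before α _ (here refl) = before-irrefl α
first-before α (h< ∷ _) (there m) = before-asym α (All.lookup h< m)

-- The first cell comes first in both orders, which settles every comparison with it; the other
-- cells form a shorter walk.
walk-chain : ∀ α {ts hs} u → AllPairs _<_ ts → AllPairs (Before α) hs → Chain α (walk ts hs u)
walk-chain α {t ∷ ts} {h ∷ hs} u@(true ∷ _) st@(_ ∷ st′) sh (there m) (there q) l = walk-chain α _ st′ sh m q l
walk-chain α {t ∷ ts} {h ∷ hs} u@(false ∷ _) st sh@(_ ∷ sh′) (there m) (there q) l = walk-chain α _ st sh′ m q l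
walk-chain α {t ∷ ts} {h ∷ hs} [] st sh (here refl) (here refl) l = ⊥-elim (<-irrefl refl l)
walk-chain α {t ∷ ts} {h ∷ hs} u@(true ∷ _) st sh (here refl) q l = first-before α sh (proj₂ (∈-walk (t ∷ ts) (h ∷ hs) u q))
walk-chain α {t ∷ ts} {h ∷ hs} u@(false ∷ _) st sh (here refl) q l = first-before α sh (proj₂ (∈-walk (t ∷ ts) (h ∷ hs) u q))
walk-chain α {t ∷ ts} {h ∷ hs} u@(true ∷ _) st sh m@(there _) (here refl) l =
  ⊥-elim (<-irrefl refl (<-≤-trans l (first≤ st (proj₁ (∈-walk (t ∷ ts) (h ∷ hs) u m)))))
walk-chain α {t ∷ ts} {h ∷ hs} u@(false ∷ _) st sh m@(there _) (here refl) l =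
  ⊥-elim (<-irrefl refl (<-≤-trans l (first≤ st (proj₁ (∈-walk (t ∷ ts) (h ∷ hs) u m)))))

walk-first : ∀ t ts h hs u → (t , h) ∈ walk (t ∷ ts) (h ∷ hs) u
walk-first t ts h hs [] = here refl
walk-first t ts h hs (true ∷ u) = here refl
walk-first t ts h hs (false ∷ u) = here refl

walk-onto-lo : ∀ ts hs u → Fits ts hs u → ∀ {v} → v ∈ ts → ∃ λ h → (v , h) ∈ walk ts hs u
walk-onto-lo (t ∷ ts) (h ∷ hs) u _ (here refl) = h , walk-first t ts h hs u
walk-onto-lo (t ∷ t′ ∷ ts) (h ∷ hs) [] (() , _) (there m)
walk-onto-lo (t ∷ ts) (h ∷ hs) (true ∷ u) (e , f) (there m) =
  let (h′ , q) = walk-onto-lo ts (h ∷ hs) u (suc-injective e , f) m in h′ , there q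
walk-onto-lo (t ∷ ts) (h ∷ hs) (false ∷ u) (e , f) (there m) =
  let (h′ , q) = walk-onto-lo (t ∷ ts) hs u (e , suc-injective f) (there m) in h′ , there q

walk-onto-hi : ∀ ts hs u → Fits ts hs u → ∀ {v} → v ∈ hs → ∃ λ t → (t , v) ∈ walk ts hs u
walk-onto-hi (t ∷ ts) (h ∷ hs) u _ (here refl) = t , walk-first t ts h hs u
walk-onto-hi (t ∷ ts) (h ∷ h′ ∷ hs) [] (_ , ()) (there m)
walk-onto-hi (t ∷ ts) (h ∷ hs) (true ∷ u) (e , f) (there m) =
  let (t′ , q) = walk-onto-hi ts (h ∷ hs) u (suc-injective e , f) (there m) in t′ , there q
walk-onto-hi (t ∷ ts) (h ∷ hs) (false ∷ u) (e , f) (there m) =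
  let (t′ , q) = walk-onto-hi (t ∷ ts) hs u (e , suc-injective f) m in t′ , there q

-- The second pair of a walk tells which of the two coordinates moved.
walk-injective : ∀ {ts hs} u u′ → Unique ts → Unique hs → Fits ts hs u → Fits ts hs u′ →
  (∀ {a} → a ∈ walk ts hs u → a ∈ walk ts hs u′) → u ≡ u′
walk-injective [] [] _ _ _ _ _ = refl
walk-injective [] (true ∷ u′) _ _ (e , _) (e′ , _) _ with () ← trans e (sym e′)
walk-injective [] (false ∷ u′) _ _ (_ , f) (_ , f′) _ with () ← trans f (sym f′)
walk-injective (true ∷ u) [] _ _ (e , _) (e′ , _) _ with () ← trans e (sym e′)
walk-injective (false ∷ u) [] _ _ (_ , f) (_ , f′) _ with () ← trans f (sym f′)
walk-injective {t ∷ ts} {h ∷ hs} (true ∷ u) (true ∷ u′) (t∉ ∷ ut) uh (e , f) (e′ , f′) sub =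
  cong (true ∷_) (walk-injective u u′ ut uh (suc-injective e , f) (suc-injective e′ , f′)
    λ m → later (proj₁ (∈-walk ts (h ∷ hs) u m)) (sub (there m)))
  where
  later : ∀ {a} → lo a ∈ ts → a ∈ (t , h) ∷ walk ts (h ∷ hs) u′ → a ∈ walk ts (h ∷ hs) u′
  later l (here refl) = ⊥-elim (All.lookup t∉ l refl)
  later l (there q) = q
walk-injective {t ∷ ts} {h ∷ hs} (false ∷ u) (false ∷ u′) ut (h∉ ∷ uh) (e , f) (e′ , f′) sub =
  cong (false ∷_) (walk-injective u u′ ut uh (e , suc-injective f) (e′ , suc-injective f′)
    λ m → later (proj₂ (∈-walk (t ∷ ts) hs u m)) (sub (there m)))
  where
  later : ∀ {a} → hi a ∈ hs → a ∈ (t , h) ∷ walk (t ∷ ts) hs u′ → a ∈ walk (t ∷ ts) hs u′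
  later l (here refl) = ⊥-elim (All.lookup h∉ l refl)
  later l (there q) = q
walk-injective {t ∷ t′ ∷ ts} {h ∷ hs} (true ∷ u) (false ∷ u′) (t∉ ∷ ut) (h∉ ∷ uh) _ _ sub
  with sub (there (walk-first t′ ts h hs u))
... | here refl = ⊥-elim (All.lookup t∉ (here refl) refl)
... | there q = ⊥-elim (All.lookup h∉ (proj₂ (∈-walk (t ∷ t′ ∷ ts) hs u′ q)) refl)
walk-injective {t ∷ ts} {h ∷ h′ ∷ hs} (false ∷ u) (true ∷ u′) (t∉ ∷ ut) (h∉ ∷ uh) _ _ sub
  with sub (there (walk-first t ts h′ hs u))
... | here refl = ⊥-elim (All.lookup h∉ (here refl) refl)
... | there q = ⊥-elim (All.lookup t∉ (proj₁ (∈-walk ts (h ∷ h′ ∷ hs) u′ q)) refl)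

Inside : List ℕ → List ℕ → List Pair → Set
Inside ts hs F = ∀ {a} → a ∈ F → lo a ∈ ts × hi a ∈ hs

Tight : List ℕ → List ℕ → List Pair → Set
Tight ts hs F = ∃ λ u → Fits ts hs u × (∀ {a} → a ∈ F → a ∈ walk ts hs u) × (∀ {a} → a ∈ walk ts hs u → a ∈ F)

module _ (t h : ℕ) (F : List Pair) where

  private
    other? : (a : Pair) → Dec (a ≢ (t , h))
    other? a = ¬? (a ≟ᵖ (t , h))

  others : List Pair
  others = filter other? F

  others⊆ : ∀ {a} → a ∈ others → a ∈ F × a ≢ (t , h)
  others⊆ = ∈-filter⁻ other?

  others-unique : Unique F → Unique others
  others-unique = Unique.filter⁺ other?

  others-chain : ∀ α → Chain α F → Chain α others
  others-chain α chain m q = chain (proj₁ (others⊆ m)) (proj₁ (others⊆ q))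

  ⊆others : ∀ {a} → a ∈ F → a ∈ (t , h) ∷ others
  ⊆others {a} m with a ≟ᵖ (t , h)
  ... | yes e = here e
  ... | no ne = there (∈-filter⁺ other? m ne)

  length≤others : Unique F → length F ≤ suc (length others)
  length≤others uF = unique-⊆⇒length≤ uF ⊆others

  -- If `(t , h)` were missing, all of `F` would survive the filter and have to fit into `m` places.
  pair∈ : Unique F → ∀ {m} → length F ≡ suc m → length others ≤ m → (t , h) ∈ F
  pair∈ uF {m} e le with any? (λ a → (t , h) ≟ᵖ a) F
  ... | yes p = p
  ... | no np = ⊥-elim (<-irrefl refl (≤-trans (s≤s le) (subst (_≤ length others) e
          (unique-⊆⇒length≤ uF λ m → ∈-filter⁺ other? m λ { refl → np m }))))

  -- The step common to both moves in `chain-bound`. Deleting a corner costs at most one pair, so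
  -- extremal length of `F` forces extremal length of `others` and membership of the corner; the
  -- walk of the rest is then prolonged by the letter `b`.
  extend-tight : Unique F → ∀ b m ts hs ts′ hs′ →
    (∀ u → Fits ts′ hs′ u → Fits ts hs (b ∷ u)) →
    (∀ u → walk ts hs (b ∷ u) ≡ (t , h) ∷ walk ts′ hs′ u) →
    length others ≤ m × (length others ≡ m → Tight ts′ hs′ others) →
    length F ≤ suc m × (length F ≡ suc m → Tight ts hs F)
  extend-tight uF b m ts hs ts′ hs′ fits eq (le , tight) =
    ≤-trans (length≤others uF) (s≤s le) , λ e →
      let m≤ = ≤-pred (subst (_≤ suc (length others)) e (length≤others uF))
          (u , fu , to , from) = tight (≤-antisym le m≤)
      in b ∷ u , fits u fu , to′ u to , from′ u from e
    where
    to′ : ∀ u → (∀ {a} → a ∈ others → a ∈ walk ts′ hs′ u) → ∀ {a} → a ∈ F → a ∈ walk ts hs (b ∷ u)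
    to′ u to {a} q rewrite eq u with ⊆others q
    ... | here e = here e
    ... | there q′ = there (to q′)
    from′ : ∀ u → (∀ {a} → a ∈ walk ts′ hs′ u → a ∈ others) → length F ≡ suc m →
      ∀ {a} → a ∈ walk ts hs (b ∷ u) → a ∈ F
    from′ u from e {a} q rewrite eq u with q
    ... | here refl = pair∈ uF e le
    ... | there q′ = proj₁ (others⊆ (from q′))

-- After removing (t , h) from a chain inside (t ∷ ts) × (h ∷ hs), either no remaining
-- lower end is t or no remaining upper end is h.
chain-bound : ∀ α t ts h hs F → AllPairs _<_ (t ∷ ts) → AllPairs (Before α) (h ∷ hs) →
  Unique F → Inside (t ∷ ts) (h ∷ hs) F → Chain α F →
  length F ≤ suc (length ts + length hs)
  × (length F ≡ suc (length ts + length hs) → Tight (t ∷ ts) (h ∷ hs) F)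
chain-bound α t ts h hs F st@(t< ∷ st′) sh@(h< ∷ sh′) uF inside chain
  with any? (λ a → lo a ≟ t) (others t h F)
... | yes p = moveHi hs sh′ h< hi∈
  where
  a = proj₁ (find p)
  a∈ = proj₁ (proj₂ (find p))
  lo-a : lo a ≡ t
  lo-a = proj₂ (proj₂ (find p))
  hi∈hs : ∀ {b} → b ∈ others t h F → hi b ≢ h → hi b ∈ hs
  hi∈hs m ne with proj₂ (inside (proj₁ (others⊆ t h F m)))
  ... | here e = ⊥-elim (ne e)
  ... | there q = q
  hi-a : hi a ∈ hs
  hi-a = hi∈hs a∈ λ e → proj₂ (others⊆ t h F a∈) (cong₂ _,_ lo-a e)
  hi∈ : ∀ {b} → b ∈ others t h F → lo b ∈ t ∷ ts × hi b ∈ hs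
  hi∈ {b} m = proj₁ (inside b∈F) , hi∈hs m ne
    where
    b∈F = proj₁ (others⊆ t h F m)
    ne : hi b ≢ h
    ne e with proj₁ (inside b∈F)
    ... | here e′ = proj₂ (others⊆ t h F m) (cong₂ _,_ e′ e)
    -- A pair with upper end `h` and a later lower end would break the chain condition against `a`,
    -- which has lower end `t` and a later upper end.
    ... | there q = chain (proj₁ (others⊆ t h F a∈)) b∈F (subst (_< lo b) (sym lo-a) (All.lookup t< q))
            (subst (λ z → Before α z (hi a)) (sym e) (All.lookup h< hi-a))
  moveHi : ∀ hs → AllPairs (Before α) hs → All (Before α h) hs →
    Inside (t ∷ ts) hs (others t h F) →
    length F ≤ suc (length ts + length hs)
    × (length F ≡ suc (length ts + length hs) → Tight (t ∷ ts) (h ∷ hs) F)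
  moveHi [] _ _ ins with () ← proj₂ (ins a∈)
  moveHi (h′ ∷ hs′) sh′ _ ins rewrite +-suc (length ts) (length hs′) =
    extend-tight t h F uF false _ _ _ _ _ (λ u (e , f) → e , cong suc f) (λ _ → refl)
      (chain-bound α t ts h′ hs′ (others t h F) st sh′ (others-unique t h F uF) ins (others-chain t h F α chain))
... | no np = moveLo ts st′ lo∈
  where
  lo∈ : ∀ {b} → b ∈ others t h F → lo b ∈ ts × hi b ∈ h ∷ hs
  lo∈ m with inside (proj₁ (others⊆ t h F m))
  ... | here e , _ = ⊥-elim (np (lose m e))
  ... | there q , r = q , r
  moveLo : ∀ ts → AllPairs _<_ ts → Inside ts (h ∷ hs) (others t h F) →
    length F ≤ suc (length ts + length hs)
    × (length F ≡ suc (length ts + length hs) → Tight (t ∷ ts) (h ∷ hs) F)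
  -- No lower end besides `t` is left, so `F` has at most one pair, and attaining the bound forces
  -- `hs` to be empty too.
  moveLo [] _ ins = ≤-trans le (s≤s z≤n) , λ e → [] , (refl , fits-hi hs e) , to , from e
    where
    none : ∀ {b} → b ∈ others t h F → ⊥
    none m with () ← proj₁ (ins m)
    to : ∀ {b} → b ∈ F → b ∈ (t , h) ∷ []
    to m with ⊆others t h F m
    ... | here e = here e
    ... | there q = ⊥-elim (none q)
    le : length F ≤ 1
    le = unique-⊆⇒length≤ uF to
    fits-hi : ∀ hs → length F ≡ suc (length hs) → 1 ≡ suc (length hs)
    fits-hi [] _ = refl
    fits-hi (_ ∷ _) e with s≤s () ← subst (_≤ 1) e le
    from : length F ≡ suc (length hs) → ∀ {b} → b ∈ (t , h) ∷ [] → b ∈ F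
    from e (here refl) = pair∈ t h F uF e (≤-trans
      (unique-⊆⇒length≤ {ys = []} (others-unique t h F uF) (⊥-elim ∘ none)) z≤n)
  moveLo (t′ ∷ ts′) st′ ins =
    extend-tight t h F uF true _ _ _ _ _ (λ u (e , f) → cong suc e , f) (λ _ → refl)
      (chain-bound α t′ ts′ h hs (others t h F) st′ sh (others-unique t h F uF) ins (others-chain t h F α chain))

-- Frames

AllPairs-reverse : {R : A → A → Set} {xs : List A} → AllPairs R xs → AllPairs (λ x y → R y x) (reverse xs)
AllPairs-reverse [] = []
AllPairs-reverse {xs = x ∷ xs} (x< ∷ p) = subst (AllPairs _) (sym (unfold-reverse x xs))
  (AllPairs.++⁺ (AllPairs-reverse p) ([] ∷ []) (All.tabulate λ m → All.lookup x< (reverse⁻ m) ∷ []))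

-- `pos` lists positions upwards, whereas a nested staircase meets its upper ends downwards.
arrange : Bool → List ℕ → List ℕ
arrange true = reverse
arrange false xs = xs

arrange-sorted : ∀ α {xs} → AllPairs _<_ xs → AllPairs (Before α) (arrange α xs)
arrange-sorted true = AllPairs-reverse
arrange-sorted false p = p

∈-arrange⁺ : ∀ α {xs v} → v ∈ xs → v ∈ arrange α xs
∈-arrange⁺ true = reverse⁺
∈-arrange⁺ false m = m

∈-arrange⁻ : ∀ α {xs v} → v ∈ arrange α xs → v ∈ xs
∈-arrange⁻ true = reverse⁻
∈-arrange⁻ false m = m

length-arrange : ∀ α xs → length (arrange α xs) ≡ length xs
length-arrange true = length-reverse
length-arrange false xs = refl

-- A labelling of the endpoints 0, 1, …, n by tail (true) and head (false), cut as l ++ c ∷ r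
-- at a pivot: forward arrows go from tails left of the pivot to heads right of it, backward
-- arrows from tails right of it to heads left of it, the pivot being on both sides.
Frame : Set
Frame = Bool × List Bool × List Bool

word : Frame → List Bool
word (c , l , r) = l ++ c ∷ r

pivot : Frame → ℕ
pivot (c , l , r) = length l

lows highs : Bool → Frame → List ℕ
lows d (c , l , r) = pos d 0 (l ++ c ∷ [])
highs d (c , l , r) = pos d (length l) (c ∷ r)

side : Bool → Bool → Frame → List Bool → List Pair
side α d φ u = walk (lows d φ) (arrange α (highs (not d) φ)) u

-- `Fits` in terms of label counts. No α occurs, because reversing a list keeps its length.
Fit : Bool → Frame → List Bool → Set
Fit d (c , l , r) u = suc (cnt true u) ≡ cnt d (l ++ c ∷ []) × suc (cnt false u) ≡ cnt (not d) (c ∷ r)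

fits : ∀ α d φ u → Fit d φ u → Fits (lows d φ) (arrange α (highs (not d) φ)) u
fits α d (c , l , r) u (e , f) =
  trans e (sym (length-pos d 0 (l ++ c ∷ []))) ,
  trans f (sym (trans (length-arrange α _) (length-pos (not d) (length l) (c ∷ r))))

∈-lows⁻ : ∀ d φ {v} → v ∈ lows d φ → v ∈ pos d 0 (word φ) × v ≤ pivot φ
∈-lows⁻ d (c , l , r) {v} m = inWord , ≤-pred bound
  where
  bound : v < suc (length l)
  bound = subst (v <_) (trans (length-++ l) (+-comm (length l) 1)) (pos-< d 0 (l ++ c ∷ []) m)
  split : (l ++ c ∷ []) ++ r ≡ l ++ c ∷ r
  split = ++-assoc l (c ∷ []) r
  inWord : v ∈ pos d 0 (l ++ c ∷ r)
  inWord = subst (λ z → v ∈ pos d 0 z) split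
    (subst (v ∈_) (sym (pos-++ d 0 (l ++ c ∷ []) r)) (∈-++⁺ˡ m))

∈-highs⁻ : ∀ d φ {v} → v ∈ highs d φ → v ∈ pos d 0 (word φ) × pivot φ ≤ v × v < length (word φ)
∈-highs⁻ d (c , l , r) {v} m = inWord , pos-≥ d (length l) (c ∷ r) m , pos-< d 0 (l ++ c ∷ r) inWord
  where
  inWord : v ∈ pos d 0 (l ++ c ∷ r)
  inWord = subst (v ∈_) (sym (pos-++ d 0 l (c ∷ r))) (∈-++⁺ʳ (pos d 0 l) m)

pos-word : ∀ d φ {v} → v ∈ pos d 0 (word φ) → v ∈ lows d φ ⊎ v ∈ highs d φ
pos-word d (c , l , r) {v} m with ∈-++⁻ (pos d 0 l) (subst (v ∈_) (pos-++ d 0 l (c ∷ r)) m)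
... | inj₁ q = inj₁ (subst (v ∈_) (sym (pos-++ d 0 l (c ∷ []))) (∈-++⁺ˡ q))
... | inj₂ q = inj₂ q

pivot∈lows : ∀ φ → pivot φ ∈ lows (proj₁ φ) φ
pivot∈lows (c , l , r) = subst (length l ∈_) (sym (pos-++ c 0 l (c ∷ []))) (∈-++⁺ʳ (pos c 0 l) (single c))
  where
  single : ∀ c → length l ∈ pos c (length l) (c ∷ [])
  single true = here refl
  single false = here refl

Between : Frame → Bool → Pair → Set
Between φ d a = (lo a ∈ pos d 0 (word φ) × lo a ≤ pivot φ)
  × (hi a ∈ pos (not d) 0 (word φ) × pivot φ ≤ hi a × hi a < length (word φ))

side-between : ∀ α d φ u {a} → a ∈ side α d φ u → Between φ d a
side-between α d φ u m =
  let (p , q) = ∈-walk (lows d φ) _ u m in ∈-lows⁻ d φ p , ∈-highs⁻ (not d) φ (∈-arrange⁻ α q)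

record Compatible (α : Bool) (F : List Pair) : Set where
  field
    lo<hi : ∀ {a b} → a ∈ F → b ∈ F → lo a < hi b
    chain : Chain α F

CrossCompatible : List Pair → List Pair → Set
CrossCompatible P Q = ∀ {a b} → a ∈ P → b ∈ Q →
  lo a ≤ hi b × lo b ≤ hi a × lo a ≢ lo b × hi a ≢ hi b

d≢not-d : ∀ d → d ≢ not d
d≢not-d true ()
d≢not-d false ()

-- The pivot separates the two ends weakly; they differ because a position carries only one label.
between⇒< : ∀ φ d {a b} → Between φ d a → Between φ d b → lo a < hi b
between⇒< φ d {a} ((p , p≤) , _) (_ , (q , ≤q , _)) = ≤∧≢⇒< (≤-trans p≤ ≤q)
  λ e → d≢not-d d (pos-deterministic 0 (word φ) p (subst (λ z → z ∈ pos (not d) 0 (word φ)) (sym e) q))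

<⇒≢-sorted : ∀ {xs} → AllPairs _<_ xs → Unique xs
<⇒≢-sorted = AllPairs.map <⇒≢

lows-sorted : ∀ d φ → AllPairs _<_ (lows d φ)
lows-sorted d (c , l , r) = pos-sorted d 0 (l ++ c ∷ [])

highs-sorted : ∀ α d φ → AllPairs (Before α) (arrange α (highs d φ))
highs-sorted α d (c , l , r) = arrange-sorted α (pos-sorted d (length l) (c ∷ r))

before⇒≢ : ∀ α {x y} → Before α x y → x ≢ y
before⇒≢ α p refl = before-irrefl α p

side-unique : ∀ α d φ u → Unique (side α d φ u)
side-unique α d φ u = walk-unique u (<⇒≢-sorted (lows-sorted d φ)) (AllPairs.map (before⇒≢ α) (highs-sorted α (not d) φ))

side-compatible : ∀ α d φ u → Compatible α (side α d φ u)
side-compatible α d φ u = record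
  { lo<hi = λ m q → between⇒< φ d (side-between α d φ u m) (side-between α d φ u q)
  ; chain = walk-chain α u (lows-sorted d φ) (highs-sorted α (not d) φ) }

-- The pivot is weakly above all lower ends and weakly below all upper ends of both sides; lower
-- ends of different sides have opposite labels, and so have upper ends.
sides-crossCompatible : ∀ α β φ u v → CrossCompatible (side α true φ u) (side β false φ v)
sides-crossCompatible α β φ u v m q with side-between α true φ u m | side-between β false φ v q
... | ((x∈ , x≤) , (y∈ , ≤y , _)) | ((x′∈ , x′≤) , (y′∈ , ≤y′ , _)) =
  ≤-trans x≤ ≤y′ , ≤-trans x′≤ ≤y ,
  (λ { refl → d≢not-d true (pos-deterministic 0 (word φ) x∈ x′∈) }) ,
  (λ { refl → d≢not-d false (pos-deterministic 0 (word φ) y∈ y′∈) })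

side-onto-lo : ∀ α d φ u → Fit d φ u → ∀ {v} → v ∈ lows d φ → ∃ λ h → (v , h) ∈ side α d φ u
side-onto-lo α d φ u f = walk-onto-lo (lows d φ) _ u (fits α d φ u f)

side-onto-hi : ∀ α d φ u → Fit d φ u → ∀ {v} → v ∈ highs (not d) φ → ∃ λ t → (t , v) ∈ side α d φ u
side-onto-hi α d φ u f m = walk-onto-hi (lows d φ) _ u (fits α d φ u f) (∈-arrange⁺ α m)

infix 4 _⊆ₚ_
_⊆ₚ_ : List Pair → List Pair → Set
F ⊆ₚ G = ∀ {a} → a ∈ F → a ∈ G

side-injective : ∀ α d φ u u′ → Fit d φ u → Fit d φ u′ → side α d φ u ⊆ₚ side α d φ u′ → u ≡ u′
side-injective α d φ u u′ f f′ = walk-injective u u′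
  (<⇒≢-sorted (lows-sorted d φ)) (AllPairs.map (before⇒≢ α) (highs-sorted α (not d) φ)) (fits α d φ u f) (fits α d φ u′ f′)

split-injective : ∀ (l l′ : List A) {c c′ r r′} → length l ≡ length l′ → l ++ c ∷ r ≡ l′ ++ c′ ∷ r′ →
  (c , l , r) ≡ (c′ , l′ , r′)
split-injective [] [] _ refl = refl
split-injective (x ∷ l) (x′ ∷ l′) e f with ∷-injective f
... | refl , f′ with split-injective l l′ (suc-injective e) f′
...   | refl = refl

module _ (α β : Bool) where

  -- Each of the four label sets is exhausted by the lower or the upper ends of one side, so the two
  -- sides together display the label of every endpoint.
  word⊆ : ∀ φ φ′ u u′ v v′ → Fit true φ u → Fit false φ v →
    side α true φ u ⊆ₚ side α true φ′ u′ → side β false φ v ⊆ₚ side β false φ′ v′ →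
    ∀ d {x} → x ∈ pos d 0 (word φ) → x ∈ pos d 0 (word φ′)
  word⊆ φ φ′ u u′ v v′ fu fv P⊆ Q⊆ d m with d | pos-word d φ m
  ... | true | inj₁ q = proj₁ (proj₁ (side-between α true φ′ u′ (P⊆ (proj₂ (side-onto-lo α true φ u fu q)))))
  ... | true | inj₂ q = proj₁ (proj₂ (side-between β false φ′ v′ (Q⊆ (proj₂ (side-onto-hi β false φ v fv q)))))
  ... | false | inj₁ q = proj₁ (proj₁ (side-between β false φ′ v′ (Q⊆ (proj₂ (side-onto-lo β false φ v fv q)))))
  ... | false | inj₂ q = proj₁ (proj₂ (side-between α true φ′ u′ (P⊆ (proj₂ (side-onto-hi α true φ u fu q)))))

  -- The pivot is itself a lower end, on the forward side if it is a tail and on the backward side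
  -- if it is a head.
  pivot≤ : ∀ φ φ′ u u′ v v′ → Fit true φ u → Fit false φ v →
    side α true φ u ⊆ₚ side α true φ′ u′ → side β false φ v ⊆ₚ side β false φ′ v′ →
    pivot φ ≤ pivot φ′
  pivot≤ φ@(true , _) φ′ u u′ v v′ fu fv P⊆ Q⊆ =
    proj₂ (proj₁ (side-between α true φ′ u′ (P⊆ (proj₂ (side-onto-lo α true φ u fu (pivot∈lows φ))))))
  pivot≤ φ@(false , _) φ′ u u′ v v′ fu fv P⊆ Q⊆ =
    proj₂ (proj₁ (side-between β false φ′ v′ (Q⊆ (proj₂ (side-onto-lo β false φ v fv (pivot∈lows φ))))))

  sides-injective : ∀ {φ φ′ u u′ v v′} → length (word φ) ≡ length (word φ′) →
    Fit true φ u → Fit false φ v → Fit true φ′ u′ → Fit false φ′ v′ →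
    side α true φ u ⊆ₚ side α true φ′ u′ → side α true φ′ u′ ⊆ₚ side α true φ u →
    side β false φ v ⊆ₚ side β false φ′ v′ → side β false φ′ v′ ⊆ₚ side β false φ v →
    (φ , u , v) ≡ (φ′ , u′ , v′)
  sides-injective {φ@(c , l , r)} {φ′@(c′ , l′ , r′)} {u} {u′} {v} {v′} e fu fv fu′ fv′ P⊆ P⊇ Q⊆ Q⊇
    with split-injective l l′
      (≤-antisym (pivot≤ φ φ′ u u′ v v′ fu fv P⊆ Q⊆) (pivot≤ φ′ φ u′ u v′ v fu′ fv′ P⊇ Q⊇))
      (pos-injective 0 (word φ) (word φ′) e (word⊆ φ φ′ u u′ v v′ fu fv P⊆ Q⊆))
  ... | refl = cong₂ (λ x y → φ , x , y)
    (side-injective α true φ u u′ fu fu′ P⊆) (side-injective β false φ v v′ fv fv′ Q⊆)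

-- `chain-bound` for lists not yet known to be nonempty, which the member `a` guarantees. The
-- successor on the left avoids a truncated subtraction in the bound.
side-onto : ∀ α d φ F → Unique F → Chain α F → Inside (lows d φ) (highs (not d) φ) F → ∀ {a} → a ∈ F →
  suc (length F) ≤ length (lows d φ) + length (highs (not d) φ)
  × (length (lows d φ) + length (highs (not d) φ) ≡ suc (length F) →
     ∃ λ u → Fit d φ u × F ⊆ₚ side α d φ u × side α d φ u ⊆ₚ F)
side-onto α d φ@(c , l , r) F uF ch ins {a} a∈F =
  nonempty (lows d φ) (arrange α (highs (not d) φ)) (length-arrange α _)
    (lows-sorted d φ) (highs-sorted α (not d) φ) (λ m → proj₁ (ins m) , ∈-arrange⁺ α (proj₂ (ins m)))
    (λ u (e , f) → trans e (length-pos d 0 (l ++ c ∷ [])) ,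
      trans f (trans (length-arrange α _) (length-pos (not d) (length l) (c ∷ r))))
  where
  H = length (highs (not d) φ)
  nonempty : ∀ ts hs → length hs ≡ H → AllPairs _<_ ts → AllPairs (Before α) hs → Inside ts hs F →
    (∀ u → Fits ts hs u → Fit d φ u) →
    suc (length F) ≤ length ts + H
    × (length ts + H ≡ suc (length F) → ∃ λ u → Fit d φ u × F ⊆ₚ walk ts hs u × walk ts hs u ⊆ₚ F)
  nonempty [] hs _ _ _ ins′ _ with () ← proj₁ (ins′ a∈F)
  nonempty (t ∷ ts) [] _ _ _ ins′ _ with () ← proj₂ (ins′ a∈F)
  nonempty (t ∷ ts) (h ∷ hs) e st sh ins′ back rewrite sym e | +-suc (length ts) (length hs)
    with chain-bound α t ts h hs F st sh uF ins′ ch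
  ... | le , tight = s≤s le , λ eq →
    let (u , fu , to , from) = tight (sym (suc-injective eq)) in u , back u fu , to , from

-- Codes of facets

cat1 : ℕ → (ℕ → List A) → List A
cat1 zero g = []
cat1 (suc k) g = cat1 k g ++ g (suc k)

length-cat1 : ∀ k (g : ℕ → List A) (h : ℕ → ℕ) → (∀ i → 1 ≤ i → i ≤ k → length (g i) ≡ h i) →
  length (cat1 k g) ≡ sum1 k h
length-cat1 zero g h e = refl
length-cat1 (suc k) g h e = trans (length-++ (cat1 k g))
  (cong₂ _+_ (length-cat1 k g h λ i p q → e i p (m≤n⇒m≤1+n q)) (e (suc k) (s≤s z≤n) ≤-refl))

∈-cat1⁺ : ∀ {k} {g : ℕ → List A} {x} i → 1 ≤ i → i ≤ k → x ∈ g i → x ∈ cat1 k g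
∈-cat1⁺ {k = zero} zero () z≤n m
∈-cat1⁺ {k = suc k} {g} i 1≤i i≤ m with m≤n⇒m<n∨m≡n i≤
... | inj₂ refl = ∈-++⁺ʳ (cat1 k g) m
... | inj₁ i< = ∈-++⁺ˡ (∈-cat1⁺ i 1≤i (≤-pred i<) m)

∈-cat1⁻ : ∀ k {g : ℕ → List A} {x} → x ∈ cat1 k g → ∃ λ i → 1 ≤ i × i ≤ k × x ∈ g i
∈-cat1⁻ (suc k) {g} m with ∈-++⁻ (cat1 k g) m
... | inj₂ q = suc k , s≤s z≤n , ≤-refl , q
... | inj₁ q = let (i , p , i≤ , r) = ∈-cat1⁻ k q in i , p , m≤n⇒m≤1+n i≤ , r

-- `key` recovers from an element the index of its block, which keeps the blocks disjoint.
cat1-unique : ∀ k {g : ℕ → List A} (key : A → ℕ) → (∀ i → Unique (g i)) →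
  (∀ {i x} → 1 ≤ i → i ≤ k → x ∈ g i → key x ≡ i) → Unique (cat1 k g)
cat1-unique zero key u eq = []
cat1-unique (suc k) {g} key u eq =
  Unique.++⁺ (cat1-unique k key u λ p q → eq p (m≤n⇒m≤1+n q)) (u (suc k)) λ (m , q) →
    let (i , p , i≤ , r) = ∈-cat1⁻ k m
    in <-irrefl (trans (sym (eq p (m≤n⇒m≤1+n i≤) r)) (eq (s≤s z≤n) ≤-refl q)) (s≤s i≤)

length-× : ∀ {B : Set} (xs : List A) (ys : List B) → length (cartesianProduct xs ys) ≡ length xs * length ys
length-× [] ys = refl
length-× (x ∷ xs) ys = trans (length-++ (map (x ,_) ys)) (cong₂ _+_ (length-map (x ,_) ys) (length-× xs ys))

-- The parameters are one less than the numbers of tails up to the pivot, heads from it on, heads up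
-- to it, and tails from it on. The pivot supplies one tail to both halves or one head to both
-- halves; the words supply the rest.
frames : ℕ → ℕ → ℕ → ℕ → List Frame
frames a b a′ b′ =
  map (true ,_) (cartesianProduct (words a (suc a′)) (words b′ (suc b))) ++
  map (false ,_) (cartesianProduct (words (suc a) a′) (words (suc b′) b))

frames-unique : ∀ a b a′ b′ → Unique (frames a b a′ b′)
frames-unique a b a′ b′ = Unique.++⁺
  (Unique.map⁺ (λ { refl → refl }) (Unique.cartesianProduct⁺ (words-unique a (suc a′)) (words-unique b′ (suc b))))
  (Unique.map⁺ (λ { refl → refl }) (Unique.cartesianProduct⁺ (words-unique (suc a) a′) (words-unique (suc b′) b)))
  λ { (m , q) → disj m q }
  where
  disj : ∀ {φ xs ys} → φ ∈ map (true ,_) xs → φ ∈ map (false ,_) ys → ⊥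
  disj m q with ∈-map⁻ (true ,_) m | ∈-map⁻ (false ,_) q
  ... | _ , _ , refl | _ , _ , ()

length-frames : ∀ a b a′ b′ → length (frames a b a′ b′) ≡
  ((a + suc a′) C suc a′) * ((b′ + suc b) C suc b) + ((suc a + a′) C a′) * ((suc b′ + b) C b)
length-frames a b a′ b′ = trans (length-++ (map {B = Frame} (true ,_) (cartesianProduct (words a (suc a′)) (words b′ (suc b)))))
  (cong₂ _+_ (block true a (suc a′) b′ (suc b)) (block false (suc a) a′ (suc b′) b))
  where
  block : ∀ c p q p′ q′ → length (map {B = Frame} (c ,_) (cartesianProduct (words p q) (words p′ q′))) ≡
    ((p + q) C q) * ((p′ + q′) C q′)
  block c p q p′ q′ = trans (length-map (c ,_) (cartesianProduct (words p q) (words p′ q′)))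
    (trans (length-× (words p q) (words p′ q′)) (cong₂ _*_ (length-words p q) (length-words p′ q′)))

cnt-∷ʳ : ∀ d l c → cnt d (l ++ c ∷ []) ≡ cnt d (c ∷ l)
cnt-∷ʳ d l c = trans (cnt-++ d l (c ∷ [])) (trans (+-comm (cnt d l) _) (sym (cnt-++ d (c ∷ []) l)))

FrameFits : ℕ → ℕ → ℕ → ℕ → Frame → Set
FrameFits a b a′ b′ (c , l , r) =
  (suc a ≡ cnt true (l ++ c ∷ []) × suc b ≡ cnt false (c ∷ r)) ×
  (suc a′ ≡ cnt false (l ++ c ∷ []) × suc b′ ≡ cnt true (c ∷ r))

∈-frames⁻ : ∀ a b a′ b′ {φ} → φ ∈ frames a b a′ b′ → FrameFits a b a′ b′ φ
∈-frames⁻ a b a′ b′ m with ∈-++⁻ (map (true ,_) (cartesianProduct (words a (suc a′)) (words b′ (suc b)))) m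
... | inj₁ q with ∈-map⁻ (true ,_) q
...   | (l , r) , p , refl with ∈-cartesianProduct⁻ (words a (suc a′)) (words b′ (suc b)) p
...     | p₁ , p₂ with ∈-words⁻ a (suc a′) p₁ | ∈-words⁻ b′ (suc b) p₂
...       | e₁ , e₂ | e₃ , e₄ =
  (trans (cong suc (sym e₁)) (sym (cnt-∷ʳ true l true)) , sym e₄) ,
  (trans (sym e₂) (sym (cnt-∷ʳ false l true)) , cong suc (sym e₃))
∈-frames⁻ a b a′ b′ m | inj₂ q with ∈-map⁻ (false ,_) q
...   | (l , r) , p , refl with ∈-cartesianProduct⁻ (words (suc a) a′) (words (suc b′) b) p
...     | p₁ , p₂ with ∈-words⁻ (suc a) a′ p₁ | ∈-words⁻ (suc b′) b p₂
...       | e₁ , e₂ | e₃ , e₄ =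
  (trans (sym e₁) (sym (cnt-∷ʳ true l false)) , cong suc (sym e₄)) ,
  (trans (cong suc (sym e₂)) (sym (cnt-∷ʳ false l false)) , sym e₃)

∈-frames⁺ : ∀ a b a′ b′ φ → FrameFits a b a′ b′ φ → φ ∈ frames a b a′ b′
∈-frames⁺ a b a′ b′ (true , l , r) ((e₁ , e₂) , (e₃ , e₄)) rewrite cnt-∷ʳ true l true | cnt-∷ʳ false l true =
  ∈-++⁺ˡ (∈-map⁺ (true ,_) (∈-cartesianProduct⁺
    (∈-words⁺ l (sym (suc-injective e₁)) (sym e₃)) (∈-words⁺ r (sym (suc-injective e₄)) (sym e₂))))
∈-frames⁺ a b a′ b′ (false , l , r) ((e₁ , e₂) , (e₃ , e₄)) rewrite cnt-∷ʳ true l false | cnt-∷ʳ false l false =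
  ∈-++⁺ʳ (map (true ,_) (cartesianProduct (words a (suc a′)) (words b′ (suc b))))
    (∈-map⁺ (false ,_) (∈-cartesianProduct⁺
      (∈-words⁺ l (sym e₁) (sym (suc-injective e₃))) (∈-words⁺ r (sym e₄) (sym (suc-injective e₂)))))

Code : Set
Code = Frame × List Bool × List Bool

codesOf : ℕ → ℕ → ℕ → ℕ → List Code
codesOf a b a′ b′ = cartesianProduct (frames a b a′ b′) (cartesianProduct (words a b) (words a′ b′))

-- With `i` heads from the pivot on and `j` heads up to it, staircases of `k` and `m` cells require
-- `k - i + 1` tails up to the pivot and `m - j + 1` tails from it on.
codes : ℕ → ℕ → List Code
codes k m = cat1 k λ i → cat1 m λ j → codesOf (k ∸ i) (i ∸ 1) (j ∸ 1) (m ∸ j)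

-- Membership in `codes` with `i` and `j` eliminated: they are one more than the numbers of steps
-- along heads. Those steps are the letters `false` of the forward word, but the letters `true` of
-- the backward word, whose lower ends are heads.
record Valid (k m : ℕ) (x : Code) : Set where
  field
    fit₁ : Fit true (proj₁ x) (proj₁ (proj₂ x))
    fit₂ : Fit false (proj₁ x) (proj₂ (proj₂ x))
    size₁ : suc (cnt true (proj₁ (proj₂ x)) + cnt false (proj₁ (proj₂ x))) ≡ k
    size₂ : suc (cnt true (proj₂ (proj₂ x)) + cnt false (proj₂ (proj₂ x))) ≡ m

∈-codesOf⁻ : ∀ a b a′ b′ {φ u v} → (φ , u , v) ∈ codesOf a b a′ b′ →
  FrameFits a b a′ b′ φ × (cnt true u ≡ a × cnt false u ≡ b) × (cnt true v ≡ a′ × cnt false v ≡ b′)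
∈-codesOf⁻ a b a′ b′ m with ∈-cartesianProduct⁻ (frames a b a′ b′) _ m
... | p , q with ∈-cartesianProduct⁻ (words a b) (words a′ b′) q
...   | q₁ , q₂ = ∈-frames⁻ a b a′ b′ p , ∈-words⁻ a b q₁ , ∈-words⁻ a′ b′ q₂

suc-pred-+ : ∀ {k i} → 1 ≤ i → i ≤ k → suc ((k ∸ i) + (i ∸ 1)) ≡ k
suc-pred-+ {k} {suc i} _ i≤ = trans (sym (+-suc (k ∸ suc i) i)) (m∸n+n≡m i≤)

∈-codes⁻ : ∀ k m {x} → x ∈ codes k m → Valid k m x
∈-codes⁻ k m {φ , u , v} q with ∈-cat1⁻ k q
... | i , 1≤i , i≤k , q′ with ∈-cat1⁻ m q′
...   | j , 1≤j , j≤m , q″ with ∈-codesOf⁻ (k ∸ i) (i ∸ 1) (j ∸ 1) (m ∸ j) q″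
...     | ((e₁ , e₂) , (e₃ , e₄)) , (f₁ , f₂) , (f₃ , f₄) = record
  { fit₁ = trans (cong suc f₁) e₁ , trans (cong suc f₂) e₂
  ; fit₂ = trans (cong suc f₃) e₃ , trans (cong suc f₄) e₄
  ; size₁ = trans (cong suc (cong₂ _+_ f₁ f₂)) (suc-pred-+ 1≤i i≤k)
  ; size₂ = trans (cong suc (trans (cong₂ _+_ f₃ f₄) (+-comm (j ∸ 1) (m ∸ j)))) (suc-pred-+ 1≤j j≤m) }

∈-codes⁺ : ∀ {k m} x → Valid k m x → x ∈ codes k m
∈-codes⁺ {k} {m} (φ , u , v) record { fit₁ = f₁ ; fit₂ = f₂ ; size₁ = refl ; size₂ = refl } =
  ∈-cat1⁺ (suc (cnt false u)) (s≤s z≤n) (s≤s (m≤n+m _ (cnt true u)))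
    (∈-cat1⁺ (suc (cnt true v)) (s≤s z≤n) (s≤s (m≤m+n (cnt true v) _))
      (subst₂ (λ a b′ → (φ , u , v) ∈ codesOf a (cnt false u) (cnt true v) b′)
        (sym (m+n∸n≡m (cnt true u) (cnt false u))) (sym (m+n∸m≡n (cnt true v) (cnt false v)))
        (∈-cartesianProduct⁺ (∈-frames⁺ _ _ _ _ φ (f₁ , f₂))
          (∈-cartesianProduct⁺ (∈-words⁺ u refl refl) (∈-words⁺ v refl refl)))))

1≤⇒suc-pred : ∀ {i} → 1 ≤ i → suc (i ∸ 1) ≡ i
1≤⇒suc-pred (s≤s _) = refl

codes-unique : ∀ k m → Unique (codes k m)
codes-unique k m = cat1-unique k (λ (φ , u , v) → suc (cnt false u))
  (λ i → cat1-unique m (λ (φ , u , v) → suc (cnt true v))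
    (λ j → Unique.cartesianProduct⁺ (frames-unique (k ∸ i) (i ∸ 1) (j ∸ 1) (m ∸ j))
      (Unique.cartesianProduct⁺ (words-unique (k ∸ i) (i ∸ 1)) (words-unique (j ∸ 1) (m ∸ j))))
    λ {j} 1≤j _ q → let (_ , _ , (f , _)) = ∈-codesOf⁻ (k ∸ i) (i ∸ 1) (j ∸ 1) (m ∸ j) q in
      trans (cong suc f) (1≤⇒suc-pred 1≤j))
  λ {i} 1≤i _ q → let (j , _ , _ , q′) = ∈-cat1⁻ m q
                      (_ , (_ , f) , _) = ∈-codesOf⁻ (k ∸ i) (i ∸ 1) (j ∸ 1) (m ∸ j) q′
                  in trans (cong suc f) (1≤⇒suc-pred 1≤i)

-- The summand of `formula`, with `m` for `n ∸ k`.
term : ℕ → ℕ → ℕ → ℕ → ℕ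
term k m i j = ((k ∸ 1) C (i ∸ 1)) * ((m ∸ 1) C (j ∸ 1)) *
  (((m + i ∸ j) C i) * ((k ∸ i + j) C j) + ((m + i ∸ j) C (i ∸ 1)) * ((k ∸ i + j) C (j ∸ 1)))

-- The ranges of `i` and `j` make the truncated subtractions genuine, so that they can be regrouped
-- as in the formula. `length-words` chooses the places of the letters `false`, which for the
-- backward word are the tail steps; the symmetry of the binomial in `choose-m` turns this into a
-- choice of head steps.
length-codesOf : ∀ {k m i j} → 1 ≤ i → i ≤ k → 1 ≤ j → j ≤ m →
  length (codesOf (k ∸ i) (i ∸ 1) (j ∸ 1) (m ∸ j)) ≡ term k m i j
length-codesOf {k} {m} {suc i} {suc j} _ i≤k _ j≤m = begin
  length (codesOf (k ∸ suc i) i j (m ∸ suc j))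
    ≡⟨ length-× (frames (k ∸ suc i) i j (m ∸ suc j)) _ ⟩
  length (frames (k ∸ suc i) i j (m ∸ suc j)) * length (cartesianProduct (words (k ∸ suc i) i) (words j (m ∸ suc j)))
    ≡⟨ cong₂ _*_ (length-frames (k ∸ suc i) i j (m ∸ suc j))
         (trans (length-× (words (k ∸ suc i) i) _) (cong₂ _*_ (length-words (k ∸ suc i) i) (length-words j (m ∸ suc j)))) ⟩
  (((k ∸ suc i + suc j) C suc j) * ((m ∸ suc j + suc i) C suc i)
    + ((suc (k ∸ suc i) + j) C j) * ((suc (m ∸ suc j) + i) C i))
    * (((k ∸ suc i + i) C i) * ((j + (m ∸ suc j)) C (m ∸ suc j)))
    ≡⟨ cong₂ _*_ (cong₂ _+_
         (cong (λ z → ((k ∸ suc i + suc j) C suc j) * (z C suc i)) shift)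
         (cong₂ (λ z z′ → (z C j) * (z′ C i)) (sym (+-suc (k ∸ suc i) j))
           (trans (sym (+-suc (m ∸ suc j) i)) shift)))
         (cong₂ _*_ (cong (_C i) (cong (_∸ 1) (suc-pred-+ {k} {suc i} (s≤s z≤n) i≤k))) choose-m) ⟩
  (x * y + x′ * y′) * (p * q)
    ≡⟨ solve 6 (λ x y x′ y′ p q → (x :* y :+ x′ :* y′) :* (p :* q) := p :* q :* (y :* x :+ y′ :* x′)) refl x y x′ y′ p q ⟩
  p * q * (y * x + y′ * x′) ∎
  where
  open ≡-Reasoning
  open +-*-Solver
  x = (k ∸ suc i + suc j) C suc j
  y = (m + suc i ∸ suc j) C suc i
  x′ = (k ∸ suc i + suc j) C j
  y′ = (m + suc i ∸ suc j) C i
  p = (k ∸ 1) C i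
  q = (m ∸ 1) C j
  shift : m ∸ suc j + suc i ≡ m + suc i ∸ suc j
  shift = sym (+-∸-comm (suc i) j≤m)
  m-1 : j + (m ∸ suc j) ≡ m ∸ 1
  m-1 = trans (+-comm j _) (cong (_∸ 1) (suc-pred-+ {m} {suc j} (s≤s z≤n) j≤m))
  choose-m : (j + (m ∸ suc j)) C (m ∸ suc j) ≡ (m ∸ 1) C j
  choose-m = trans (nCk≡nC[n∸k] (m≤n+m (m ∸ suc j) j))
    (cong₂ _C_ m-1 (m+n∸n≡m j (m ∸ suc j)))

length-codes : ∀ k m → length (codes k m) ≡ sum1 k λ i → sum1 m λ j → term k m i j
length-codes k m = length-cat1 k _ _ λ i 1≤i i≤k → length-cat1 m _ _ λ j 1≤j j≤m → length-codesOf 1≤i i≤k 1≤j j≤m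

-- From cliques with n arrows to codes

maximal-lo : ∀ {a : Pair} F → a ∈ F → ∃ λ b → b ∈ F × (∀ {c} → c ∈ F → lo c ≤ lo b)
maximal-lo (a ∷ []) _ = a , here refl , λ { (here refl) → ≤-refl }
maximal-lo (a ∷ b ∷ F) _ with maximal-lo (b ∷ F) (here refl)
... | c , c∈ , max with ≤-total (lo a) (lo c)
...   | inj₁ a≤c = c , there c∈ , λ { (here refl) → a≤c ; (there q) → max q }
...   | inj₂ c≤a = a , here refl , λ { (here refl) → ≤-refl ; (there q) → ≤-trans (max q) c≤a }

interchange : ∀ a b c d → (a + b) + (c + d) ≡ (a + c) + (b + d)
interchange = solve 4 (λ a b c d → (a :+ b) :+ (c :+ d) := (a :+ c) :+ (b :+ d)) refl
  where open +-*-Solver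

length-side : ∀ α d φ u → Fit d φ u → length (side α d φ u) ≡ suc (cnt true u + cnt false u)
length-side α d φ u f = length-walk (lows d φ) (arrange α (highs (not d) φ)) u (fits α d φ u f)

length-lows : ∀ d φ → length (lows d φ) ≡ cnt d (proj₁ (proj₂ φ) ++ proj₁ φ ∷ [])
length-lows d (c , l , r) = length-pos d 0 (l ++ c ∷ [])

length-highs : ∀ d φ → length (highs d φ) ≡ cnt d (proj₁ φ ∷ proj₂ (proj₂ φ))
length-highs d (c , l , r) = length-pos d (length l) (c ∷ r)

-- The pivot belongs to both halves, hence the extra one.
frame-size : ∀ φ → (length (lows true φ) + length (highs false φ)) + (length (lows false φ) + length (highs true φ))
  ≡ suc (length (word φ))
frame-size (c , l , r) = begin
  (length (pos true 0 (l ++ c ∷ [])) + length (pos false (length l) (c ∷ r)))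
    + (length (pos false 0 (l ++ c ∷ [])) + length (pos true (length l) (c ∷ r)))
    ≡⟨ cong₂ _+_ (cong₂ _+_ (length-pos true 0 (l ++ c ∷ [])) (length-pos false (length l) (c ∷ r)))
                 (cong₂ _+_ (length-pos false 0 (l ++ c ∷ [])) (length-pos true (length l) (c ∷ r))) ⟩
  (cnt true (l ++ c ∷ []) + cnt false (c ∷ r)) + (cnt false (l ++ c ∷ []) + cnt true (c ∷ r))
    ≡⟨ interchange (cnt true (l ++ c ∷ [])) (cnt false (c ∷ r)) (cnt false (l ++ c ∷ [])) (cnt true (c ∷ r)) ⟩
  (cnt true (l ++ c ∷ []) + cnt false (l ++ c ∷ [])) + (cnt false (c ∷ r) + cnt true (c ∷ r))
    ≡⟨ cong₂ _+_ (cnt-total true (l ++ c ∷ [])) (cnt-total false (c ∷ r)) ⟩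
  length (l ++ c ∷ []) + suc (length r)
    ≡⟨ cong (_+ suc (length r)) (trans (length-++ l) (+-comm (length l) 1)) ⟩
  suc (length l + suc (length r))
    ≡⟨ cong suc (sym (length-++ l)) ⟩
  suc (length (l ++ c ∷ r)) ∎
  where open ≡-Reasoning

fit-size : ∀ d φ u → Fit d φ u →
  length (lows d φ) + length (highs (not d) φ) ≡ suc (suc (cnt true u + cnt false u))
fit-size d (c , l , r) u (e , f) = trans
  (cong₂ _+_ (trans (length-pos d 0 (l ++ c ∷ [])) (sym e)) (trans (length-pos (not d) (length l) (c ∷ r)) (sym f)))
  (cong suc (+-suc _ _))

valid-length : ∀ {k m φ u v} → Valid k m (φ , u , v) → length (word φ) ≡ suc (k + m)
valid-length {k} {m} {φ} {u} {v} x = suc-injective (trans (sym (frame-size φ))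
  (trans (cong₂ _+_ (trans (fit-size true φ u fit₁) (cong suc size₁)) (trans (fit-size false φ v fit₂) (cong suc size₂)))
    (cong suc (+-suc k m))))
  where open Valid x

+-tight : ∀ {a b x y} → a ≤ x → b ≤ y → x + y ≡ a + b → x ≡ a × y ≡ b
+-tight {a} {b} {x} {y} a≤ b≤ e =
  ≤-antisym (+-cancelʳ-≤ b x a (≤-trans (+-monoʳ-≤ x b≤) (≤-reflexive e))) a≤ ,
  ≤-antisym (+-cancelˡ-≤ a y b (≤-trans (+-monoˡ-≤ y a≤) (≤-reflexive e))) b≤

tab-∷ʳ : ∀ f o m → tab f o m ++ f (o + m) ∷ [] ≡ tab f o (suc m)
tab-∷ʳ f o zero = cong (λ z → f z ∷ []) (+-identityʳ o)
tab-∷ʳ f o (suc m) = cong (f o ∷_) (trans (cong (λ z → tab f (suc o) m ++ f z ∷ []) (+-suc o m)) (tab-∷ʳ f (suc o) m))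

frameOf : (ℕ → Bool) → ℕ → ℕ → Frame
frameOf f π m = f π , tab f 0 π , tab f (suc π) m

∈-lows-frameOf : ∀ f π m {v d} → f v ≡ d → v ≤ π → v ∈ lows d (frameOf f π m)
∈-lows-frameOf f π m {v} {d} e v≤π =
  subst (λ w → v ∈ pos d 0 w) (sym (tab-∷ʳ f 0 π)) (∈-pos-tab f 0 (suc π) e z≤n (s≤s v≤π))

∈-highs-frameOf : ∀ f π m {v d} → f v ≡ d → π ≤ v → v ≤ π + m → v ∈ highs d (frameOf f π m)
∈-highs-frameOf f π m {v} {d} e π≤v v≤ = subst (λ z → v ∈ pos d z (tab f π (suc m))) (sym (length-tab f 0 π))
  (∈-pos-tab f π (suc m) e π≤v (subst (v <_) (sym (+-suc π m)) (s≤s v≤)))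

length-frameOf : ∀ f π m → length (word (frameOf f π m)) ≡ suc (π + m)
length-frameOf f π m = trans (length-++ (tab f 0 π))
  (trans (cong₂ (λ a b → a + suc b) (length-tab f 0 π) (length-tab f (suc π) m)) (+-suc π m))

Bounded : ℕ → List Pair → Set
Bounded n F = ∀ {a} → a ∈ F → hi a ≤ n

-- Compatibility within each side and across the sides puts the largest lower end weakly below every
-- upper end, so it can serve as pivot. The two bounds of `side-onto` then add up to exactly the
-- size of the frame, so both are attained.
sides-onto : ∀ {α β n P Q a b} → Unique P → Unique Q → Compatible α P → Compatible β Q → CrossCompatible P Q →
  Bounded n P → Bounded n Q → length P + length Q ≡ n → a ∈ P → b ∈ Q →
  ∃ λ φ → ∃₂ λ u v → Valid (length P) (length Q) (φ , u , v)
    × (P ⊆ₚ side α true φ u × side α true φ u ⊆ₚ P) × (Q ⊆ₚ side β false φ v × side β false φ v ⊆ₚ Q)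
sides-onto {α} {β} {n} {P} {Q} {a} {b} uP uQ cP cQ cr bP bQ size a∈P b∈Q =
  φ , u , v , valid , P~ , Q~
  where
  top = maximal-lo (P ++ Q) (∈-++⁺ˡ a∈P)
  π = lo (proj₁ top)
  ≤π : ∀ {c} → c ∈ P ++ Q → lo c ≤ π
  ≤π = proj₂ (proj₂ top)
  π≤P : ∀ {c} → c ∈ P → π ≤ hi c
  π≤P {c} m with ∈-++⁻ P (proj₁ (proj₂ top))
  ... | inj₁ q = <⇒≤ (Compatible.lo<hi cP q m)
  ... | inj₂ q = proj₁ (proj₂ (cr m q))
  π≤Q : ∀ {c} → c ∈ Q → π ≤ hi c
  π≤Q {c} m with ∈-++⁻ P (proj₁ (proj₂ top))
  ... | inj₁ q = proj₁ (cr q m)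
  ... | inj₂ q = <⇒≤ (Compatible.lo<hi cQ q m)
  tails = map lo P ++ map hi Q
  -- An endpoint that no arrow meets is labelled head by default; since both staircases turn out to
  -- be maximal, there is no such endpoint.
  tail? : ℕ → Bool
  tail? x = Dec.does (DM._∈?_ _≟_ x tails)
  isTail : ∀ {x} → x ∈ tails → tail? x ≡ true
  isTail {x} m with DM._∈?_ _≟_ x tails
  ... | yes _ = refl
  ... | no ne = ⊥-elim (ne m)
  isHead : ∀ {x} → (∀ {c} → c ∈ P → x ≢ lo c) → (∀ {c} → c ∈ Q → x ≢ hi c) → tail? x ≡ false
  isHead {x} f g with DM._∈?_ _≟_ x tails
  ... | no _ = refl
  ... | yes m with ∈-++⁻ (map lo P) m
  ...   | inj₁ q = let (c , c∈ , e) = ∈-map⁻ lo q in ⊥-elim (f c∈ e)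
  ...   | inj₂ q = let (c , c∈ , e) = ∈-map⁻ hi q in ⊥-elim (g c∈ e)
  φ = frameOf tail? π (n ∸ π)
  π+ : π + (n ∸ π) ≡ n
  π+ = m+[n∸m]≡n (≤-trans (π≤P a∈P) (bP a∈P))
  insP : Inside (lows true φ) (highs false φ) P
  insP m =
    ∈-lows-frameOf tail? π (n ∸ π) (isTail (∈-++⁺ˡ (∈-map⁺ lo m))) (≤π (∈-++⁺ˡ m)) ,
    ∈-highs-frameOf tail? π (n ∸ π)
      (isHead (λ q e → <-irrefl (sym e) (Compatible.lo<hi cP q m)) (λ q → proj₂ (proj₂ (proj₂ (cr m q)))))
      (π≤P m) (subst (_ ≤_) (sym π+) (bP m))
  insQ : Inside (lows false φ) (highs true φ) Q
  insQ m =
    ∈-lows-frameOf tail? π (n ∸ π)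
      (isHead (λ q e → proj₁ (proj₂ (proj₂ (cr q m))) (sym e)) (λ q e → <-irrefl e (Compatible.lo<hi cQ m q)))
      (≤π (∈-++⁺ʳ P m)) ,
    ∈-highs-frameOf tail? π (n ∸ π) (isTail (∈-++⁺ʳ (map lo P) (∈-map⁺ hi m)))
      (π≤Q m) (subst (_ ≤_) (sym π+) (bQ m))
  ontoP = side-onto α true φ P uP (Compatible.chain cP) insP a∈P
  ontoQ = side-onto β false φ Q uQ (Compatible.chain cQ) insQ b∈Q
  total : (length (lows true φ) + length (highs false φ)) + (length (lows false φ) + length (highs true φ))
    ≡ suc (length P) + suc (length Q)
  total = trans (frame-size φ) (trans (cong suc (trans (length-frameOf tail? π (n ∸ π))
    (cong suc (trans π+ (sym size))))) (cong suc (sym (+-suc (length P) (length Q)))))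
  tight = +-tight (proj₁ ontoP) (proj₁ ontoQ) total
  resP = proj₂ ontoP (proj₁ tight)
  resQ = proj₂ ontoQ (proj₂ tight)
  u = proj₁ resP
  v = proj₁ resQ
  P~ = proj₂ (proj₂ resP)
  Q~ = proj₂ (proj₂ resQ)
  valid : Valid (length P) (length Q) (φ , u , v)
  valid = record
    { fit₁ = proj₁ (proj₂ resP)
    ; fit₂ = proj₁ (proj₂ resQ)
    ; size₁ = suc-injective (trans (sym (fit-size true φ u (proj₁ (proj₂ resP)))) (proj₁ tight))
    ; size₂ = suc-injective (trans (sym (fit-size false φ v (proj₁ (proj₂ resQ)))) (proj₂ tight)) }

-- Facets with arrows of one direction

allWords : ℕ → List (List Bool)
allWords zero = [] ∷ []
allWords (suc m) = map (true ∷_) (allWords m) ++ map (false ∷_) (allWords m)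

length-allWords : ∀ m → length (allWords m) ≡ 2 ^ m
length-allWords zero = refl
length-allWords (suc m) = trans (length-++ (map (true ∷_) (allWords m))) (cong₂ _+_
  (trans (length-map _ (allWords m)) (length-allWords m))
  (trans (length-map _ (allWords m)) (trans (length-allWords m) (sym (+-identityʳ _)))))

∈-allWords⁺ : ∀ u → u ∈ allWords (length u)
∈-allWords⁺ [] = here refl
∈-allWords⁺ (true ∷ u) = ∈-++⁺ˡ (∈-map⁺ (true ∷_) (∈-allWords⁺ u))
∈-allWords⁺ (false ∷ u) = ∈-++⁺ʳ (map (true ∷_) (allWords (length u))) (∈-map⁺ (false ∷_) (∈-allWords⁺ u))

∈-allWords⁻ : ∀ m {u} → u ∈ allWords m → length u ≡ m
∈-allWords⁻ zero (here refl) = refl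
∈-allWords⁻ (suc m) q with ∈-++⁻ (map (true ∷_) (allWords m)) q
... | inj₁ p with ∈-map⁻ (true ∷_) p
...   | _ , r , refl = cong suc (∈-allWords⁻ m r)
∈-allWords⁻ (suc m) q | inj₂ p with ∈-map⁻ (false ∷_) p
...   | _ , r , refl = cong suc (∈-allWords⁻ m r)

allWords-unique : ∀ m → Unique (allWords m)
allWords-unique zero = [] ∷ []
allWords-unique (suc m) =
  Unique.++⁺ (Unique.map⁺ ∷-injectiveʳ (allWords-unique m)) (Unique.map⁺ ∷-injectiveʳ (allWords-unique m)) disj
  where
  disj : ∀ {w} → w ∈ map (true ∷_) (allWords m) × w ∈ map (false ∷_) (allWords m) → ⊥
  disj (m , q) with ∈-map⁻ (true ∷_) m | ∈-map⁻ (false ∷_) q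
  ... | _ , _ , refl | _ , _ , ()

-- When all arrows have the same direction, all lower ends precede all upper ends.
pureFrame : Bool → ℕ → ℕ → Frame
pureFrame d a b = d , replicate a d , replicate (suc b) (not d)

-- The frame is not a separate datum: the letters of `u` already fix how many lower and upper ends
-- there are.
pureSide : Bool → Bool → List Bool → List Pair
pureSide α d u = side α d (pureFrame d (cnt true u) (cnt false u)) u

pure-fit : ∀ d u → Fit d (pureFrame d (cnt true u) (cnt false u)) u
pure-fit d u = sym (trans (cnt-∷ʳ d (replicate (cnt true u) d) d) (cnt-replicate d (suc (cnt true u)))) ,
  sym (heads d (cnt false u))
  where
  heads : ∀ d b → cnt (not d) (d ∷ replicate (suc b) (not d)) ≡ suc b
  heads true b = cnt-replicate false (suc b)
  heads false b = cnt-replicate true (suc b)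

∈-pos-replicate : ∀ d o m {v} → o ≤ v → v < o + m → v ∈ pos d o (replicate m d)
∈-pos-replicate d o m {v} o≤ v< = subst (λ w → v ∈ pos d o w) (tab-const o m) (∈-pos-tab (λ _ → d) o m refl o≤ v<)
  where
  tab-const : ∀ o m → tab (λ _ → d) o m ≡ replicate m d
  tab-const o zero = refl
  tab-const o (suc m) = cong (d ∷_) (tab-const (suc o) m)

∈-lows-pure : ∀ d a b {v} → v ≤ a → v ∈ lows d (pureFrame d a b)
∈-lows-pure d a b {v} v≤ = subst (λ w → v ∈ pos d 0 w) (snoc a) (∈-pos-replicate d 0 (suc a) z≤n (s≤s v≤))
  where
  snoc : ∀ a → replicate (suc a) d ≡ replicate a d ++ d ∷ []
  snoc zero = refl
  snoc (suc a) = cong (d ∷_) (snoc a)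

∈-highs-pure : ∀ d a b {v} → a < v → v ≤ suc (a + b) → v ∈ highs (not d) (pureFrame d a b)
∈-highs-pure d a b {v} a< v≤ = subst (λ z → v ∈ pos (not d) z (d ∷ replicate (suc b) (not d)))
  (sym (length-replicate a)) (skip d (∈-pos-replicate (not d) (suc a) (suc b) a<
    (subst (v <_) (cong suc (sym (+-suc a b))) (s≤s v≤))))
  where
  skip : ∀ d → v ∈ pos (not d) (suc a) (replicate (suc b) (not d)) → v ∈ pos (not d) a (d ∷ replicate (suc b) (not d))
  skip true m = m
  skip false m = m

cnt-length : ∀ u → cnt true u + cnt false u ≡ length u
cnt-length = cnt-total true

pureSide-length : ∀ α d u → length (pureSide α d u) ≡ suc (length u)
pureSide-length α d u = trans (length-side α d (pureFrame d (cnt true u) (cnt false u)) u (pure-fit d u)) (cong suc (cnt-length u))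

pureFrame-length : ∀ d a b → length (word (pureFrame d a b)) ≡ suc (suc (a + b))
pureFrame-length d a b = trans (length-++ (replicate a d))
  (trans (cong₂ (λ x y → x + suc (suc y)) (length-replicate a) (length-replicate b))
    (trans (+-suc a (suc b)) (cong suc (+-suc a b))))

-- The pivot is a lower end and no lower end exceeds it, so equal sides have equally many letters
-- `true`. Hence the frames agree and the words can be compared on one grid.
pureSide-injective : ∀ α d u u′ → length u ≡ length u′ →
  pureSide α d u ⊆ₚ pureSide α d u′ → pureSide α d u′ ⊆ₚ pureSide α d u → u ≡ u′
pureSide-injective α d u u′ e sub sub′ =
  side-injective α d (φ u) u u′ (pure-fit d u) (subst (λ ψ → Fit d ψ u′) (sym same) (pure-fit d u′))
    (λ {a} m → subst (λ ψ → a ∈ side α d ψ u′) (sym same) (sub m))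
  where
  φ = λ u → pureFrame d (cnt true u) (cnt false u)
  lows≤ : ∀ u u′ → pureSide α d u ⊆ₚ pureSide α d u′ → cnt true u ≤ cnt true u′
  lows≤ u u′ sub = subst₂ _≤_ (length-replicate (cnt true u)) (length-replicate (cnt true u′))
    (proj₂ (proj₁ (side-between α d (φ u′) u′ (sub (proj₂
      (side-onto-lo α d (φ u) u (pure-fit d u) (pivot∈lows (φ u))))))))
  trues : cnt true u ≡ cnt true u′
  trues = ≤-antisym (lows≤ u u′ sub) (lows≤ u′ u sub′)
  falses : cnt false u ≡ cnt false u′
  falses = +-cancelˡ-≡ (cnt true u) _ _ (trans (cnt-length u)
    (trans e (trans (sym (cnt-length u′)) (cong (_+ cnt false u′) (sym trues)))))
  same : φ u ≡ φ u′
  same = cong₂ (pureFrame d) trues falses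

-- Cutting behind the largest lower end `π` puts `F` into a grid of `π + 1` by `n - π` cells, whose
-- maximal staircases have exactly `n` cells.
pureSide-onto : ∀ α d {n F a} → Unique F → Compatible α F → Bounded n F → length F ≡ n → a ∈ F →
  ∃ λ u → suc (length u) ≡ n × F ⊆ₚ pureSide α d u × pureSide α d u ⊆ₚ F
pureSide-onto α d {n} {F} {a} uF cF bF size a∈F =
  u , sizeᵤ , (λ {x} m → subst (λ ψ → x ∈ side α d ψ u) same (to m)) ,
  λ {x} m → from (subst (λ ψ → x ∈ side α d ψ u) (sym same) m)
  where
  top = maximal-lo F a∈F
  π = lo (proj₁ top)
  π< : ∀ {c} → c ∈ F → π < hi c
  π< = Compatible.lo<hi cF (proj₁ (proj₂ top))
  φ = pureFrame d π (n ∸ suc π)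
  π+ : suc (π + (n ∸ suc π)) ≡ n
  π+ = m+[n∸m]≡n (≤-trans (π< a∈F) (bF a∈F))
  onto = side-onto α d φ F uF (Compatible.chain cF) (λ m →
    ∈-lows-pure d π (n ∸ suc π) (proj₂ (proj₂ top) m) ,
    ∈-highs-pure d π (n ∸ suc π) (π< m) (subst (_ ≤_) (sym π+) (bF m))) a∈F
  |lows| : length (lows d φ) ≡ suc π
  |lows| = trans (length-lows d φ) (trans (cnt-∷ʳ d (replicate π d) d) (cnt-replicate d (suc π)))
  |highs| : length (highs (not d) φ) ≡ suc (n ∸ suc π)
  |highs| = trans (length-highs (not d) φ) (heads d (n ∸ suc π))
    where
    heads : ∀ d b → cnt (not d) (d ∷ replicate (suc b) (not d)) ≡ suc b
    heads true b = cnt-replicate false (suc b)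
    heads false b = cnt-replicate true (suc b)
  res = proj₂ onto (trans (cong₂ _+_ |lows| |highs|)
    (cong suc (trans (+-suc π _) (trans π+ (sym size)))))
  u = proj₁ res
  fit = proj₁ (proj₂ res)
  to = proj₁ (proj₂ (proj₂ res))
  from = proj₂ (proj₂ (proj₂ res))
  trues : π ≡ cnt true u
  trues = suc-injective (sym (trans (proj₁ fit) (trans (sym (length-lows d φ)) |lows|)))
  falses : n ∸ suc π ≡ cnt false u
  falses = suc-injective (sym (trans (proj₂ fit) (trans (sym (length-highs (not d) φ)) |highs|)))
  same : φ ≡ pureFrame d (cnt true u) (cnt false u)
  same = cong₂ (pureFrame d) trues falses
  sizeᵤ : suc (length u) ≡ n
  sizeᵤ = trans (cong suc (trans (sym (cnt-length u)) (sym (cong₂ _+_ trues falses)))) π+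

open ℚ.+-*-Solver using (solve; _:+_; _:*_; _:-_; :-_; con; _:=_)

-- Rational arithmetic

-1ℚ : ℚ
-1ℚ = -ℚ 1ℚ

*-nonneg : ∀ {p q} → 0ℚ ≤ℚ p → 0ℚ ≤ℚ q → 0ℚ ≤ℚ p *ℚ q
*-nonneg {p} {q} 0≤p 0≤q = subst (_≤ℚ p *ℚ q) (ℚ.*-zeroʳ p) (ℚ.*-monoˡ-≤-nonNeg p {{ℚ.nonNegative 0≤p}} 0≤q)

*-pos : ∀ {p q} → 0ℚ <ℚ p → 0ℚ <ℚ q → 0ℚ <ℚ p *ℚ q
*-pos {p} {q} 0<p 0<q = subst (_<ℚ p *ℚ q) (ℚ.*-zeroʳ p) (ℚ.*-monoʳ-<-pos p {{ℚ.positive 0<p}} 0<q)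

*-pos⁻ʳ : ∀ {p q} → 0ℚ ≤ℚ p → 0ℚ <ℚ p *ℚ q → 0ℚ <ℚ q
*-pos⁻ʳ {p} {q} 0≤p h = ℚ.≰⇒> λ q≤0 → ℚ.<-irrefl refl (ℚ.<-≤-trans h
  (subst (p *ℚ q ≤ℚ_) (ℚ.*-zeroʳ p) (ℚ.*-monoˡ-≤-nonNeg p {{ℚ.nonNegative 0≤p}} q≤0)))

+-zero : ∀ {p q} → 0ℚ ≤ℚ p → 0ℚ ≤ℚ q → p +ℚ q ≡ 0ℚ → p ≡ 0ℚ × q ≡ 0ℚ
+-zero {p} {q} 0≤p 0≤q e =
  ℚ.≤-antisym (subst₂ _≤ℚ_ (ℚ.+-identityʳ p) e (ℚ.+-monoʳ-≤ p 0≤q)) 0≤p ,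
  ℚ.≤-antisym (subst₂ _≤ℚ_ (ℚ.+-identityˡ q) e (ℚ.+-monoˡ-≤ q 0≤p)) 0≤q

p-q≡0⇒p≡q : ∀ p q → p - q ≡ 0ℚ → p ≡ q
p-q≡0⇒p≡q p q e = trans (solve 2 (λ p q → p := (p :- q) :+ q) refl p q) (trans (cong (_+ℚ q) e) (ℚ.+-identityˡ q))

p≤q⇒0≤q-p : ∀ {p q} → p ≤ℚ q → 0ℚ ≤ℚ q - p
p≤q⇒0≤q-p {p} {q} h = subst (_≤ℚ q - p) (ℚ.+-inverseʳ p) (ℚ.+-monoˡ-≤ (-ℚ p) h)

0≤q-p⇒p≤q : ∀ {p q} → 0ℚ ≤ℚ q - p → p ≤ℚ q
0≤q-p⇒p≤q {p} {q} h = subst₂ _≤ℚ_ (ℚ.+-identityˡ p) (solve 2 (λ p q → (q :- p) :+ p := q) refl p q) (ℚ.+-monoˡ-≤ p h)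

sumC-+ : ∀ m f g → sumC m (λ t → f t +ℚ g t) ≡ sumC m f +ℚ sumC m g
sumC-+ zero f g = refl
sumC-+ (suc m) f g = trans (cong (f zero +ℚ g zero +ℚ_) (sumC-+ m (f ∘ suc) (g ∘ suc)))
  (solve 4 (λ a b c d → (a :+ b) :+ (c :+ d) := (a :+ c) :+ (b :+ d)) refl (f zero) (g zero) (sumC m (f ∘ suc)) (sumC m (g ∘ suc)))

sumC-* : ∀ m q f → sumC m (λ t → q *ℚ f t) ≡ q *ℚ sumC m f
sumC-* zero q f = sym (ℚ.*-zeroʳ q)
sumC-* (suc m) q f = trans (cong (q *ℚ f zero +ℚ_) (sumC-* m q (f ∘ suc))) (sym (ℚ.*-distribˡ-+ q _ _))

sumC-cong : ∀ m {f g} → (∀ t → f t ≡ g t) → sumC m f ≡ sumC m g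
sumC-cong zero e = refl
sumC-cong (suc m) e = cong₂ _+ℚ_ (e zero) (sumC-cong m (e ∘ suc))

sumC-0 : ∀ m → sumC m (λ _ → 0ℚ) ≡ 0ℚ
sumC-0 zero = refl
sumC-0 (suc m) = trans (ℚ.+-identityˡ _) (sumC-0 m)

δ : ∀ {m} → Fin m → Fin m → ℚ
δ zero zero = 1ℚ
δ zero (suc _) = 0ℚ
δ (suc _) zero = 0ℚ
δ (suc i) (suc k) = δ i k

δ-refl : ∀ {m} (i : Fin m) → δ i i ≡ 1ℚ
δ-refl zero = refl
δ-refl (suc i) = δ-refl i

δ-≢ : ∀ {m} {i k : Fin m} → i ≢ k → δ i k ≡ 0ℚ
δ-≢ {i = zero} {zero} ne = ⊥-elim (ne refl)
δ-≢ {i = zero} {suc k} ne = refl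
δ-≢ {i = suc i} {zero} ne = refl
δ-≢ {i = suc i} {suc k} ne = δ-≢ (ne ∘ cong suc)

sumC-δ : ∀ {m} (f : Fin m → ℚ) i → sumC m (λ t → f t *ℚ δ t i) ≡ f i
sumC-δ {suc m} f zero = trans (cong₂ _+ℚ_ (ℚ.*-identityʳ (f zero))
  (trans (sumC-cong m λ t → ℚ.*-zeroʳ (f (suc t))) (sumC-0 m))) (ℚ.+-identityʳ (f zero))
sumC-δ {suc m} f (suc i) = trans (cong₂ _+ℚ_ (ℚ.*-zeroʳ (f zero)) (sumC-δ (f ∘ suc) i)) (ℚ.+-identityˡ _)

sumC-δ-total : ∀ {m} (i : Fin m) → sumC m (δ i) ≡ 1ℚ
sumC-δ-total {suc m} zero = trans (cong (1ℚ +ℚ_) (sumC-0 m)) (ℚ.+-identityʳ 1ℚ)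
sumC-δ-total {suc m} (suc i) = trans (ℚ.+-identityˡ _) (sumC-δ-total i)

-- Replaces nested conditionals by a difference, so that identities between midpoints become ring
-- identities.
vecOf≡δ : ∀ {n} {i j : Fin (suc n)} → i ≢ j → ∀ k → vecOf (i , j) k ≡ δ j k - δ i k
vecOf≡δ {i = i} {j} ne k with k Fin.≟ j
... | yes refl = sym (trans (cong₂ (λ a b → a - b) (δ-refl k) (δ-≢ ne)) refl)
... | no k≢j with k Fin.≟ i
...   | yes refl = sym (trans (cong₂ (λ a b → a - b) (δ-≢ (≢-sym k≢j)) (δ-refl k)) refl)
...   | no k≢i = sym (trans (cong₂ (λ a b → a - b) (δ-≢ (≢-sym k≢j)) (δ-≢ (≢-sym k≢i))) refl)

data VecOfView {n} (i j k : Fin (suc n)) : Set where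
  at-head : k ≡ j → vecOf (i , j) k ≡ 1ℚ → VecOfView i j k
  at-tail : k ≢ j → k ≡ i → vecOf (i , j) k ≡ -1ℚ → VecOfView i j k
  elsewhere : k ≢ j → k ≢ i → vecOf (i , j) k ≡ 0ℚ → VecOfView i j k

vecOf-view : ∀ {n} (i j k : Fin (suc n)) → VecOfView i j k
vecOf-view i j k with k Fin.≟ j in e
... | yes p = at-head p (cong (λ d → if Dec.does d then 1ℚ else (if Dec.does (k Fin.≟ i) then -1ℚ else 0ℚ)) e)
... | no np with k Fin.≟ i in e′
...   | yes q = at-tail np q (cong₂ (λ d d′ → if Dec.does d then 1ℚ else (if Dec.does d′ then -1ℚ else 0ℚ)) e e′)
...   | no nq = elsewhere np nq (cong₂ (λ d d′ → if Dec.does d then 1ℚ else (if Dec.does d′ then -1ℚ else 0ℚ)) e e′)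

0≤1 : 0ℚ ≤ℚ 1ℚ
0≤1 = ℚ.nonNegative⁻¹ 1ℚ

-1≤0 : -1ℚ ≤ℚ 0ℚ
-1≤0 = ℚ.nonPositive⁻¹ -1ℚ

vecOf-head : ∀ {n} {i j : Fin (suc n)} → vecOf (i , j) j ≡ 1ℚ
vecOf-head {i = i} {j} with vecOf-view i j j
... | at-head _ e = e
... | at-tail ne _ _ = ⊥-elim (ne refl)
... | elsewhere ne _ _ = ⊥-elim (ne refl)

vecOf-tail : ∀ {n} {i j : Fin (suc n)} → i ≢ j → vecOf (i , j) i ≡ -1ℚ
vecOf-tail {i = i} {j} i≢j with vecOf-view i j i
... | at-head e _ = ⊥-elim (i≢j e)
... | at-tail _ _ e = e
... | elsewhere _ ne _ = ⊥-elim (ne refl)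

vecOf-elsewhere : ∀ {n} {i j k : Fin (suc n)} → k ≢ i → k ≢ j → vecOf (i , j) k ≡ 0ℚ
vecOf-elsewhere {i = i} {j} {k} k≢i k≢j with vecOf-view i j k
... | at-head e _ = ⊥-elim (k≢j e)
... | at-tail _ e _ = ⊥-elim (k≢i e)
... | elsewhere _ _ e = e

vecOf≤1 : ∀ {n} (i j k : Fin (suc n)) → vecOf (i , j) k ≤ℚ 1ℚ
vecOf≤1 i j k with vecOf-view i j k
... | at-head _ e = ℚ.≤-reflexive e
... | at-tail _ _ e = ℚ.≤-trans (ℚ.≤-reflexive e) (ℚ.≤-trans -1≤0 0≤1)
... | elsewhere _ _ e = ℚ.≤-trans (ℚ.≤-reflexive e) 0≤1

vecOf≥-1 : ∀ {n} (i j k : Fin (suc n)) → -1ℚ ≤ℚ vecOf (i , j) k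
vecOf≥-1 i j k with vecOf-view i j k
... | at-head _ e = ℚ.≤-trans (ℚ.≤-trans -1≤0 0≤1) (ℚ.≤-reflexive (sym e))
... | at-tail _ _ e = ℚ.≤-reflexive (sym e)
... | elsewhere _ _ e = ℚ.≤-trans -1≤0 (ℚ.≤-reflexive (sym e))

vecOf>0 : ∀ {n} {i j k : Fin (suc n)} → 0ℚ <ℚ vecOf (i , j) k → k ≡ j
vecOf>0 {i = i} {j} {k} h with vecOf-view i j k
... | at-head e _ = e
... | at-tail _ _ e = ⊥-elim (ℚ.<-irrefl refl (ℚ.<-≤-trans (subst (0ℚ <ℚ_) e h) -1≤0))
... | elsewhere _ _ e = ⊥-elim (ℚ.<-irrefl refl (subst (0ℚ <ℚ_) e h))

vecOf<0 : ∀ {n} {i j k : Fin (suc n)} → vecOf (i , j) k <ℚ 0ℚ → k ≡ i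
vecOf<0 {i = i} {j} {k} h with vecOf-view i j k
... | at-head _ e = ⊥-elim (ℚ.<-irrefl refl (ℚ.<-≤-trans (subst (_<ℚ 0ℚ) e h) 0≤1))
... | at-tail _ e _ = e
... | elsewhere _ _ e = ⊥-elim (ℚ.<-irrefl refl (subst (_<ℚ 0ℚ) e h))

-- Linear combinations

module _ {n : ℕ} where

  wsum : (vs : List (Vec′ n)) → (Fin (length vs) → ℚ) → (Vec′ n → ℚ) → ℚ
  wsum [] c g = 0ℚ
  wsum (v ∷ vs) c g = c zero *ℚ g v +ℚ wsum vs (c ∘ suc) g

  lincomb≡wsum : ∀ vs c k → lincomb vs c k ≡ wsum vs c (λ v → v k)
  lincomb≡wsum [] c k = refl
  lincomb≡wsum (v ∷ vs) c k = cong (c zero *ℚ v k +ℚ_) (lincomb≡wsum vs (c ∘ suc) k)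

  wsum-+ : ∀ vs c g h → wsum vs c (λ v → g v +ℚ h v) ≡ wsum vs c g +ℚ wsum vs c h
  wsum-+ [] c g h = refl
  wsum-+ (v ∷ vs) c g h = trans (cong (c zero *ℚ (g v +ℚ h v) +ℚ_) (wsum-+ vs (c ∘ suc) g h))
    (solve 5 (λ q a b x y → q :* (a :+ b) :+ (x :+ y) := (q :* a :+ x) :+ (q :* b :+ y)) refl (c zero) (g v) (h v) (wsum vs (c ∘ suc) g) (wsum vs (c ∘ suc) h))

  wsum-* : ∀ vs c q g → wsum vs c (λ v → q *ℚ g v) ≡ q *ℚ wsum vs c g
  wsum-* [] c q g = sym (ℚ.*-zeroʳ q)
  wsum-* (v ∷ vs) c q g = trans (cong (c zero *ℚ (q *ℚ g v) +ℚ_) (wsum-* vs (c ∘ suc) q g))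
    (solve 4 (λ c q a x → c :* (q :* a) :+ q :* x := q :* (c :* a :+ x)) refl (c zero) q (g v) (wsum vs (c ∘ suc) g))

  wsum-const : ∀ vs c q → wsum vs c (λ _ → q) ≡ q *ℚ sumC (length vs) c
  wsum-const [] c q = sym (ℚ.*-zeroʳ q)
  wsum-const (v ∷ vs) c q = trans (cong (c zero *ℚ q +ℚ_) (wsum-const vs (c ∘ suc) q))
    (solve 3 (λ c q x → c :* q :+ q :* x := q :* (c :+ x)) refl (c zero) q (sumC (length vs) (c ∘ suc)))

  wsum-cong : ∀ vs c {g h} → (∀ v → g v ≡ h v) → wsum vs c g ≡ wsum vs c h
  wsum-cong [] c e = refl
  wsum-cong (v ∷ vs) c e = cong₂ _+ℚ_ (cong (c zero *ℚ_) (e v)) (wsum-cong vs (c ∘ suc) e)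

  wsum-nonneg : ∀ vs c {g} → (∀ t → 0ℚ ≤ℚ c t) → (∀ {v} → v ∈ vs → 0ℚ ≤ℚ g v) → 0ℚ ≤ℚ wsum vs c g
  wsum-nonneg [] c _ _ = ℚ.≤-refl
  wsum-nonneg (v ∷ vs) c c≥0 g≥0 =
    ℚ.+-mono-≤ (*-nonneg (c≥0 zero) (g≥0 (here refl))) (wsum-nonneg vs (c ∘ suc) (c≥0 ∘ suc) (g≥0 ∘ there))

  -- Complementary slackness: a positive sum of `g` has a positive summand, whose weight is then
  -- positive, and this weight forces `f` to vanish there because the nonnegative terms for `f` sum
  -- to zero.
  wsum-support : ∀ vs c {f g} → (∀ t → 0ℚ ≤ℚ c t) → (∀ {v} → v ∈ vs → 0ℚ ≤ℚ f v) →
    wsum vs c f ≡ 0ℚ → 0ℚ <ℚ wsum vs c g → ∃ λ v → v ∈ vs × f v ≡ 0ℚ × 0ℚ <ℚ g v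
  wsum-support [] c _ _ _ h = ⊥-elim (ℚ.<-irrefl refl h)
  wsum-support (v ∷ vs) c {f} {g} c≥0 f≥0 e h
    with +-zero (*-nonneg (c≥0 zero) (f≥0 (here refl))) (wsum-nonneg vs (c ∘ suc) (c≥0 ∘ suc) (f≥0 ∘ there)) e
       | 0ℚ ℚ.<? c zero *ℚ g v
  ... | e₁ , e₂ | yes pos = v , here refl , fv≡0 , *-pos⁻ʳ (c≥0 zero) pos
    where
    c>0 : 0ℚ <ℚ c zero
    c>0 = ℚ.≰⇒> λ c≤0 → ℚ.<-irrefl refl (subst (0ℚ <ℚ_)
      (trans (cong (_*ℚ g v) (ℚ.≤-antisym c≤0 (c≥0 zero))) (ℚ.*-zeroˡ (g v))) pos)
    fv≡0 : f v ≡ 0ℚ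
    fv≡0 = ℚ.≤-antisym (ℚ.≮⇒≥ λ f>0 → ℚ.<-irrefl refl (subst (0ℚ <ℚ_) e₁ (*-pos c>0 f>0))) (f≥0 (here refl))
  ... | e₁ , e₂ | no npos =
    let (w , w∈ , p) = wsum-support vs (c ∘ suc) {f} {g} (c≥0 ∘ suc) (f≥0 ∘ there) e₂
          (ℚ.≰⇒> λ le → ℚ.<-irrefl refl (ℚ.<-≤-trans h (ℚ.+-mono-≤ (ℚ.≮⇒≥ npos) le)))
    in w , there w∈ , p

  -- Linear forms as lists of terms: they can be concatenated, and linearity is an induction instead
  -- of a hypothesis to carry along.
  Functional : Set
  Functional = List (ℚ × Fin (suc n))

  ⟦_⟧ : Functional → Vec′ n → ℚ
  ⟦ [] ⟧ v = 0ℚ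
  ⟦ (q , k) ∷ L ⟧ v = q *ℚ v k +ℚ ⟦ L ⟧ v

  wsum-functional : ∀ L vs c {x} → (∀ k → lincomb vs c k ≡ x k) → wsum vs c ⟦ L ⟧ ≡ ⟦ L ⟧ x
  wsum-functional [] vs c e = trans (wsum-const vs c 0ℚ) (ℚ.*-zeroˡ (sumC (length vs) c))
  wsum-functional ((q , k) ∷ L) vs c e = trans (wsum-+ vs c (λ v → q *ℚ v k) ⟦ L ⟧)
    (cong₂ _+ℚ_ (trans (wsum-* vs c q (λ v → v k)) (cong (q *ℚ_) (trans (sym (lincomb≡wsum vs c k)) (e k))))
      (wsum-functional L vs c e))

  ⟦⟧-++ : ∀ L L′ x → ⟦ L ++ L′ ⟧ x ≡ ⟦ L ⟧ x +ℚ ⟦ L′ ⟧ x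
  ⟦⟧-++ [] L′ x = sym (ℚ.+-identityˡ _)
  ⟦⟧-++ ((q , k) ∷ L) L′ x = trans (cong (q *ℚ x k +ℚ_) (⟦⟧-++ L L′ x)) (sym (ℚ.+-assoc (q *ℚ x k) (⟦ L ⟧ x) (⟦ L′ ⟧ x)))

  ⟦⟧-+* : ∀ L x q → ⟦ L ⟧ (λ k → x k +ℚ q *ℚ x k) ≡ ⟦ L ⟧ x +ℚ q *ℚ ⟦ L ⟧ x
  ⟦⟧-+* [] x q = sym (trans (ℚ.+-identityˡ _) (ℚ.*-zeroʳ q))
  ⟦⟧-+* ((p , k) ∷ L) x q = trans (cong (p *ℚ (x k +ℚ q *ℚ x k) +ℚ_) (⟦⟧-+* L x q))
    (solve 4 (λ p a q b → p :* (a :+ q :* a) :+ (b :+ q :* b) := (p :* a :+ b) :+ q :* (p :* a :+ b)) refl p (x k) q (⟦ L ⟧ x))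

  -- The predicate `N` on coefficients treats cones and spans at once, and the total weight `s` is
  -- kept so that masses can be added and scaled. `Cone` with weight one is `InConv`.
  Comb : (ℚ → Set) → List (Vec′ n) → ℚ → Vec′ n → Set
  Comb N vs s x = Σ (Fin (length vs) → ℚ) λ c →
    (∀ t → N (c t)) × sumC (length vs) c ≡ s × (∀ k → lincomb vs c k ≡ x k)

  Cone Span : List (Vec′ n) → ℚ → Vec′ n → Set
  Cone = Comb (0ℚ ≤ℚ_)
  Span = Comb (λ _ → ⊤)

  comb-cong : ∀ (N : ℚ → Set) {vs s s′ x y} → Comb N vs s x → s ≡ s′ → (∀ k → x k ≡ y k) → Comb N vs s′ y
  comb-cong _ (c , N , e , f) refl h = c , N , e , λ k → trans (f k) (h k)

  lincomb-+ : ∀ (vs : List (Vec′ n)) c c′ k → lincomb vs (λ t → c t +ℚ c′ t) k ≡ lincomb vs c k +ℚ lincomb vs c′ k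
  lincomb-+ [] c c′ k = refl
  lincomb-+ (v ∷ vs) c c′ k = trans (cong ((c zero +ℚ c′ zero) *ℚ v k +ℚ_) (lincomb-+ vs (c ∘ suc) (c′ ∘ suc) k))
    (solve 5 (λ a b v x y → (a :+ b) :* v :+ (x :+ y) := (a :* v :+ x) :+ (b :* v :+ y)) refl (c zero) (c′ zero) (v k) (lincomb vs (c ∘ suc) k) (lincomb vs (c′ ∘ suc) k))

  lincomb-* : ∀ (vs : List (Vec′ n)) q c k → lincomb vs (λ t → q *ℚ c t) k ≡ q *ℚ lincomb vs c k
  lincomb-* [] q c k = sym (ℚ.*-zeroʳ q)
  lincomb-* (v ∷ vs) q c k = trans (cong (q *ℚ c zero *ℚ v k +ℚ_) (lincomb-* vs q (c ∘ suc) k))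
    (solve 4 (λ q a v x → q :* a :* v :+ q :* x := q :* (a :* v :+ x)) refl q (c zero) (v k) (lincomb vs (c ∘ suc) k))

  comb-+ : ∀ (N : ℚ → Set) {vs s s′ x y} → (∀ {p q} → N p → N q → N (p +ℚ q)) →
    Comb N vs s x → Comb N vs s′ y → Comb N vs (s +ℚ s′) (λ k → x k +ℚ y k)
  comb-+ N₀ {vs} add (c , N , e , f) (c′ , N′ , e′ , f′) =
    (λ t → c t +ℚ c′ t) , (λ t → add (N t) (N′ t)) ,
    trans (sumC-+ (length vs) c c′) (cong₂ _+ℚ_ e e′) ,
    λ k → trans (lincomb-+ vs c c′ k) (cong₂ _+ℚ_ (f k) (f′ k))

  comb-* : ∀ (N N′ : ℚ → Set) {vs s x} q → (∀ {p} → N p → N′ (q *ℚ p)) → Comb N vs s x → Comb N′ vs (q *ℚ s) (λ k → q *ℚ x k)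
  comb-* N₀ N₁ {vs} q scale (c , N , e , f) =
    (λ t → q *ℚ c t) , (λ t → scale (N t)) ,
    trans (sumC-* (length vs) q c) (cong (q *ℚ_) e) ,
    λ k → trans (lincomb-* vs q c k) (cong (q *ℚ_) (f k))

  lincomb-0 : ∀ (vs : List (Vec′ n)) k → lincomb vs (λ _ → 0ℚ) k ≡ 0ℚ
  lincomb-0 [] k = refl
  lincomb-0 (v ∷ vs) k = cong₂ _+ℚ_ (ℚ.*-zeroˡ (v k)) (lincomb-0 vs k)

  comb-0 : ∀ (N : ℚ → Set) vs → N 0ℚ → Comb N vs 0ℚ zeroV
  comb-0 N vs N0 = (λ _ → 0ℚ) , (λ _ → N0) , sumC-0 (length vs) , lincomb-0 vs

  comb-generator : ∀ (N : ℚ → Set) {vs v} → N 0ℚ → N 1ℚ → v ∈ vs → Comb N vs 1ℚ v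
  comb-generator N {v ∷ vs} N0 N1 (here refl) = c , Nc ,
    trans (cong (1ℚ +ℚ_) (sumC-0 (length vs))) (ℚ.+-identityʳ 1ℚ) ,
    λ k → trans (cong (1ℚ *ℚ v k +ℚ_) (lincomb-0 vs k)) (trans (ℚ.+-identityʳ _) (ℚ.*-identityˡ _))
    where
    c : Fin (suc (length vs)) → ℚ
    c zero = 1ℚ
    c (suc t) = 0ℚ
    Nc : ∀ t → N (c t)
    Nc zero = N1
    Nc (suc t) = N0
  comb-generator N {v ∷ vs} N0 N1 (there m) = c , Nc ,
    trans (ℚ.+-identityˡ _) (proj₁ (proj₂ (proj₂ rest))) ,
    λ k → trans (cong (_+ℚ lincomb vs (proj₁ rest) k) (ℚ.*-zeroˡ (v k)))
      (trans (ℚ.+-identityˡ _) (proj₂ (proj₂ (proj₂ rest)) k))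
    where
    rest = comb-generator N {vs} N0 N1 m
    c : Fin (suc (length vs)) → ℚ
    c zero = 0ℚ
    c (suc t) = proj₁ rest t
    Nc : ∀ t → N (c t)
    Nc zero = N0
    Nc (suc t) = proj₁ (proj₂ rest) t

  comb-sum : ∀ (N : ℚ → Set) {vs} m {s : Fin m → ℚ} {x : Fin m → Vec′ n} → N 0ℚ → (∀ {p q} → N p → N q → N (p +ℚ q)) →
    (∀ t → Comb N vs (s t) (x t)) → Comb N vs (sumC m s) (λ k → sumC m (λ t → x t k))
  comb-sum N {vs} zero N0 add h = comb-0 N vs N0
  comb-sum N {vs} (suc m) N0 add h = comb-+ N {vs} add (h zero) (comb-sum N {vs} m N0 add (h ∘ suc))

  cone-+ : ∀ {vs s s′ x y} → Cone vs s x → Cone vs s′ y → Cone vs (s +ℚ s′) (λ k → x k +ℚ y k)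
  cone-+ {vs} = comb-+ (0ℚ ≤ℚ_) {vs} ℚ.+-mono-≤

  cone-* : ∀ {vs s x} q → 0ℚ ≤ℚ q → Cone vs s x → Cone vs (q *ℚ s) (λ k → q *ℚ x k)
  cone-* {vs} q q≥0 = comb-* (0ℚ ≤ℚ_) (0ℚ ≤ℚ_) {vs = vs} q (*-nonneg q≥0)

  cone-generator : ∀ {vs v} → v ∈ vs → Cone vs 1ℚ v
  cone-generator = comb-generator (0ℚ ≤ℚ_) ℚ.≤-refl 0≤1

  cone-cong : ∀ {vs s s′ x y} → Cone vs s x → s ≡ s′ → (∀ k → x k ≡ y k) → Cone vs s′ y
  cone-cong {vs} = comb-cong (0ℚ ≤ℚ_) {vs}

-- The geometry of the root polytope

½<1 : ½ <ℚ 1ℚ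
½<1 = ℚ.*<* (ℤ.+<+ (s≤s (s≤s z≤n)))

0≤½ : 0ℚ ≤ℚ ½
0≤½ = ℚ.nonNegative⁻¹ ½

module _ {n : ℕ} where

  _≟ₚ_ : (a b : Pt n) → Dec (a ≡ b)
  _≟ₚ_ = ≡-dec Fin._≟_ Fin._≟_

  pairOf : Pt n → Pt n → List (Pt n)
  pairOf a b = select (λ c → Dec.does (c ≟ₚ a) ∨ Dec.does (c ≟ₚ b)) (arrows n)

  ∈-pairOf⁻ : ∀ a b {c} → c ∈ pairOf a b → c ≡ a ⊎ c ≡ b
  ∈-pairOf⁻ a b {c} m with c ≟ₚ a | c ≟ₚ b | proj₂ (∈-filter⁻ (λ c → (Dec.does (c ≟ₚ a) ∨ Dec.does (c ≟ₚ b)) ≟ᵇ true) {xs = arrows n} m)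
  ... | yes p | _ | _ = inj₁ p
  ... | no _ | yes q | _ = inj₂ q

  ∈-pairOf⁺ˡ : ∀ a b → IsArrow a → a ∈ pairOf a b
  ∈-pairOf⁺ˡ a b h = ∈-filter⁺ (λ c → (Dec.does (c ≟ₚ a) ∨ Dec.does (c ≟ₚ b)) ≟ᵇ true) (∈-arrows⁺ n h) (holds (a ≟ₚ a))
    where
    holds : (d : Dec (a ≡ a)) → (Dec.does d ∨ Dec.does (a ≟ₚ b)) ≡ true
    holds (yes _) = refl
    holds (no ne) = ⊥-elim (ne refl)

  ∈-pairOf⁺ʳ : ∀ a b → IsArrow b → b ∈ pairOf a b
  ∈-pairOf⁺ʳ a b h = ∈-filter⁺ (λ c → (Dec.does (c ≟ₚ a) ∨ Dec.does (c ≟ₚ b)) ≟ᵇ true) (∈-arrows⁺ n h) (holds (b ≟ₚ b))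
    where
    holds : (d : Dec (b ≡ b)) → (Dec.does (b ≟ₚ a) ∨ Dec.does d) ≡ true
    holds (yes _) = ∨-zeroʳ _
    holds (no ne) = ⊥-elim (ne refl)

  pair-face : ∀ {E : Graph n} {a b} → Symmetric E → E a b ≡ true → Face E (pairOf a b)
  pair-face {E} {a} {b} sy e = select∈sublists _ (arrows n) ,
    isFace⇐ (Unique.filter⁺ _ (arrows-unique n)) λ m q ne → adj (∈-pairOf⁻ a b m) (∈-pairOf⁻ a b q) ne
    where
    adj : ∀ {c d} → c ≡ a ⊎ c ≡ b → d ≡ a ⊎ d ≡ b → c ≢ d → E c d ≡ true
    adj (inj₁ refl) (inj₁ refl) ne = ⊥-elim (ne refl)
    adj (inj₁ refl) (inj₂ refl) ne = e
    adj (inj₂ refl) (inj₁ refl) ne = trans (sy b a) e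
    adj (inj₂ refl) (inj₂ refl) ne = ⊥-elim (ne refl)

  midpoint : Pt n → Pt n → Vec′ n
  midpoint a b k = ½ *ℚ vecOf a k +ℚ ½ *ℚ vecOf b k

  midpoint∈conv : ∀ {S a b} → a ∈ S → b ∈ S → InConv (map vecOf S) (midpoint a b)
  midpoint∈conv {S} m q = cone-+ {vs = vs} (cone-* {vs = vs} ½ 0≤½ (cone-generator (∈-map⁺ vecOf m)))
    (cone-* {vs = vs} ½ 0≤½ (cone-generator (∈-map⁺ vecOf q)))
    where vs = map vecOf S

  -- As the weights sum to one, the slack at `x` is the weighted mean of the slacks at the vectors.
  slack : ∀ L M vs (c : Fin (length vs) → ℚ) {x : Vec′ n} → sumC (length vs) c ≡ 1ℚ → (∀ k → lincomb vs c k ≡ x k) →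
    wsum vs c (λ v → M - ⟦ L ⟧ v) ≡ M - ⟦ L ⟧ x
  slack L M vs c {x} e f = begin
    wsum vs c (λ v → M - ⟦ L ⟧ v)
      ≡⟨ wsum-cong vs c (λ v → solve 2 (λ M l → M :- l := M :+ con -1ℚ :* l) refl M (⟦ L ⟧ v)) ⟩
    wsum vs c (λ v → M +ℚ -1ℚ *ℚ ⟦ L ⟧ v)
      ≡⟨ wsum-+ vs c (λ _ → M) (λ v → -1ℚ *ℚ ⟦ L ⟧ v) ⟩
    wsum vs c (λ _ → M) +ℚ wsum vs c (λ v → -1ℚ *ℚ ⟦ L ⟧ v)
      ≡⟨ cong₂ _+ℚ_ (trans (wsum-const vs c M) (cong (M *ℚ_) e))
           (trans (wsum-* vs c -1ℚ ⟦ L ⟧) (cong (-1ℚ *ℚ_) (wsum-functional L vs c f))) ⟩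
    M *ℚ 1ℚ +ℚ -1ℚ *ℚ ⟦ L ⟧ x
      ≡⟨ solve 2 (λ M l → M :* con 1ℚ :+ con -1ℚ :* l := M :- l) refl M (⟦ L ⟧ x) ⟩
    M - ⟦ L ⟧ x ∎
    where open ≡-Reasoning

  Bounds : Functional → ℚ → Set
  Bounds L M = ∀ {a : Pt n} → IsArrow a → ⟦ L ⟧ (vecOf a) ≤ℚ M

  bounds-slack : ∀ {L M} → Bounds L M → ∀ S → (∀ {a} → a ∈ S → IsArrow a) →
    ∀ {v} → v ∈ map vecOf S → 0ℚ ≤ℚ M - ⟦ L ⟧ v
  bounds-slack b S arr m with ∈-map⁻ vecOf m
  ... | a , a∈ , refl = p≤q⇒0≤q-p (b (arr a∈))

  bounds-InP : ∀ {L M y} → Bounds L M → InP n y → ⟦ L ⟧ y ≤ℚ M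
  bounds-InP {L} {M} b (c , c≥0 , e , f) = 0≤q-p⇒p≤q (subst (0ℚ ≤ℚ_) (slack L M (map vecOf (arrows n)) c e f)
    (wsum-nonneg (map vecOf (arrows n)) c c≥0 (bounds-slack {L} {M} b (arrows n) (∈-arrows⁻ n))))

  coordinate-bounds : ∀ k → Bounds ((1ℚ , k) ∷ []) 1ℚ × Bounds ((-1ℚ , k) ∷ []) 1ℚ
  coordinate-bounds k =
    (λ {(i , j)} _ → subst (_≤ℚ 1ℚ) (solve 1 (λ q → q := con 1ℚ :* q :+ con 0ℚ) refl (vecOf (i , j) k)) (vecOf≤1 i j k)) ,
    (λ {(i , j)} _ → subst (_≤ℚ 1ℚ) (solve 1 (λ q → :- q := con -1ℚ :* q :+ con 0ℚ) refl (vecOf (i , j) k))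
      (ℚ.neg-antimono-≤ (vecOf≥-1 i j k)))

  ∣coordinate∣≤1 : ∀ {x} → InP n x → ∀ k → ∣ x k ∣ ≤ℚ 1ℚ
  ∣coordinate∣≤1 {x} x∈ k with ℚ.∣p∣≡p∨∣p∣≡-p (x k)
  ... | inj₁ e = subst (_≤ℚ 1ℚ) (trans (solve 1 (λ q → con 1ℚ :* q :+ con 0ℚ := q) refl (x k)) (sym e))
    (bounds-InP {(1ℚ , k) ∷ []} (proj₁ (coordinate-bounds k)) x∈)
  ... | inj₂ e = subst (_≤ℚ 1ℚ) (trans (solve 1 (λ q → con -1ℚ :* q :+ con 0ℚ := :- q) refl (x k)) (sym e))
    (bounds-InP {(-1ℚ , k) ∷ []} (proj₂ (coordinate-bounds k)) x∈)

arrowsV : ∀ n → List (Vec′ n)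
arrowsV n = map vecOf (arrows n)

cone-arrow : ∀ {n} {a : Pt n} → IsArrow a → Cone (arrowsV n) 1ℚ (vecOf a)
cone-arrow {n} h = cone-generator (∈-map⁺ vecOf (∈-arrows⁺ n h))

-- The origin is the midpoint of two opposite arrows. It fills up missing mass, so that a cone point
-- of mass below one belongs to the polytope.
zero-cone : ∀ n → Cone (arrowsV (suc n)) 1ℚ zeroV
zero-cone n = cone-cong {vs = vs} (midpoint∈conv (∈-arrows⁺ (suc n) h) (∈-arrows⁺ (suc n) (h ∘ sym))) refl λ k →
  trans (cong₂ (λ p q → ½ *ℚ p +ℚ ½ *ℚ q) (vecOf≡δ h k) (vecOf≡δ (h ∘ sym) k))
    (solve 2 (λ p q → con ½ :* (p :- q) :+ con ½ :* (q :- p) := con 0ℚ) refl (δ v₁ k) (δ v₀ k))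
  where
  vs = arrowsV (suc n)
  v₀ v₁ : Fin (suc (suc n))
  v₀ = zero
  v₁ = suc zero
  h : v₀ ≢ v₁
  h ()

-- A point where some functional attains its maximum over the polytope leaves the polytope
-- when it is scaled up.
maximizer∈Bd : ∀ {n} L M {x} → 0ℚ <ℚ M → Bounds {suc n} L M → ⟦ L ⟧ x ≡ M → InP (suc n) x → InBd (suc n) x
maximizer∈Bd {n} L M {x} M>0 b Lx x∈ = x∈ , λ ε ε>0 → moved ε ε>0
  where
  vs = arrowsV (suc n)
  moved : ∀ ε → 0ℚ <ℚ ε → Σ (Vec′ (suc n)) λ y →
    InAff vs y × (∀ k → ∣ y k - x k ∣ <ℚ ε) × ¬ InP (suc n) y
  moved ε ε>0 = y , (proj₁ aff , proj₂ (proj₂ aff)) , close , outside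
    where
    -- Coordinates in the polytope are at most one in absolute value, so scaling by `1ℚ +ℚ η` moves
    -- each of them by at most `η`, which is below `ε`.
    η = ½ *ℚ ε
    η>0 : 0ℚ <ℚ η
    η>0 = *-pos (ℚ.positive⁻¹ ½) ε>0
    y : Vec′ (suc n)
    y k = x k +ℚ η *ℚ x k
    span : ∀ {s z} q → Cone vs s z → Span vs (q *ℚ s) (λ k → q *ℚ z k)
    span q = comb-* (0ℚ ≤ℚ_) (λ _ → ⊤) {vs} q (λ _ → tt)
    _⊕_ : ∀ {s s′ z z′} → Span vs s z → Span vs s′ z′ → Span vs (s +ℚ s′) (λ k → z k +ℚ z′ k)
    _⊕_ = comb-+ (λ _ → ⊤) {vs} (λ _ _ → tt)
    -- A negative multiple of the origin brings the weight of the scaled point back to one.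
    aff : Span vs 1ℚ y
    aff = comb-cong (λ _ → ⊤) {vs} (span (1ℚ +ℚ η) x∈ ⊕ span (-ℚ η) (zero-cone n))
      (solve 1 (λ η → (con 1ℚ :+ η) :* con 1ℚ :+ (:- η) :* con 1ℚ := con 1ℚ) refl η)
      λ k → solve 2 (λ η x → (con 1ℚ :+ η) :* x :+ (:- η) :* con 0ℚ := x :+ η :* x) refl η (x k)
    η<ε : η <ℚ ε
    η<ε = subst (η <ℚ_) (ℚ.*-identityˡ ε) (ℚ.*-monoˡ-<-pos ε {{ℚ.positive ε>0}} ½<1)
    close : ∀ k → ∣ y k - x k ∣ <ℚ ε
    close k = ℚ.≤-<-trans (subst₂ _≤ℚ_
      (trans (cong (_*ℚ ∣ x k ∣) (sym (ℚ.0≤p⇒∣p∣≡p (ℚ.<⇒≤ η>0)))) (trans (sym (ℚ.∣p*q∣≡∣p∣*∣q∣ η (x k)))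
        (cong ∣_∣ (solve 2 (λ η x → η :* x := (x :+ η :* x) :- x) refl η (x k)))))
      (ℚ.*-identityʳ η)
      (ℚ.*-monoˡ-≤-nonNeg η {{ℚ.nonNegative (ℚ.<⇒≤ η>0)}} (∣coordinate∣≤1 x∈ k))) η<ε
    outside : ¬ InP (suc n) y
    outside y∈ = ℚ.<-irrefl refl (ℚ.<-≤-trans
      (subst₂ _<ℚ_ (ℚ.+-identityʳ M) (sym (trans (⟦⟧-+* L x η) (cong (λ z → z +ℚ η *ℚ z) Lx)))
        (ℚ.+-monoʳ-< M (*-pos η>0 M>0)))
      (bounds-InP {suc n} {L} {M} b y∈))

-- Repeated halving of `η` stands in for division by `m`.
uniform-bound : ∀ m {η} → 0ℚ <ℚ η → ∃ λ ε → 0ℚ <ℚ ε × (∀ (f : Fin m → ℚ) → (∀ t → f t ≤ℚ ε) → sumC m f ≤ℚ η)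
uniform-bound zero {η} η>0 = η , η>0 , λ f _ → ℚ.<⇒≤ η>0
uniform-bound (suc m) {η} η>0 with uniform-bound m (*-pos (ℚ.positive⁻¹ ½) η>0)
... | ε , ε>0 , h with ℚ.≤-total ε (½ *ℚ η)
...   | inj₁ ε≤ = ε , ε>0 , λ f f≤ → subst (sumC (suc m) f ≤ℚ_)
  (solve 1 (λ η → con ½ :* η :+ con ½ :* η := η) refl η)
  (ℚ.+-mono-≤ (ℚ.≤-trans (f≤ zero) ε≤) (h (f ∘ suc) (f≤ ∘ suc)))
...   | inj₂ ≤ε = ½ *ℚ η , *-pos (ℚ.positive⁻¹ ½) η>0 , λ f f≤ → subst (sumC (suc m) f ≤ℚ_)
  (solve 1 (λ η → con ½ :* η :+ con ½ :* η := η) refl η)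
  (ℚ.+-mono-≤ (f≤ zero) (h (f ∘ suc) (λ t → ℚ.≤-trans (f≤ (suc t)) ≤ε)))

sumC-vecOf : ∀ {n} {a : Pt n} → IsArrow a → sumC (suc n) (vecOf a) ≡ 0ℚ
sumC-vecOf {n} {i , j} ne = begin
  sumC (suc n) (vecOf (i , j))
    ≡⟨ sumC-cong (suc n) (λ k → trans (vecOf≡δ ne k) (solve 2 (λ p q → p :- q := p :+ con -1ℚ :* q) refl (δ j k) (δ i k))) ⟩
  sumC (suc n) (λ k → δ j k +ℚ -1ℚ *ℚ δ i k)
    ≡⟨ sumC-+ (suc n) (δ j) (λ k → -1ℚ *ℚ δ i k) ⟩
  sumC (suc n) (δ j) +ℚ sumC (suc n) (λ k → -1ℚ *ℚ δ i k)
    ≡⟨ cong₂ _+ℚ_ (sumC-δ-total j) (trans (sumC-* (suc n) -1ℚ (δ i)) (cong (-1ℚ *ℚ_) (sumC-δ-total i))) ⟩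
  1ℚ +ℚ -1ℚ *ℚ 1ℚ
    ≡⟨⟩
  0ℚ ∎
  where open ≡-Reasoning

sumC-lincomb : ∀ {n} (vs : List (Vec′ n)) c → (∀ {v} → v ∈ vs → sumC (suc n) v ≡ 0ℚ) → sumC (suc n) (lincomb vs c) ≡ 0ℚ
sumC-lincomb {n} [] c h = sumC-0 (suc n)
sumC-lincomb {n} (v ∷ vs) c h = begin
  sumC (suc n) (lincomb (v ∷ vs) c)
    ≡⟨ sumC-+ (suc n) (λ k → c zero *ℚ v k) (lincomb vs (c ∘ suc)) ⟩
  sumC (suc n) (λ k → c zero *ℚ v k) +ℚ sumC (suc n) (lincomb vs (c ∘ suc))
    ≡⟨ cong₂ _+ℚ_ (trans (sumC-* (suc n) (c zero) v) (cong (c zero *ℚ_) (h (here refl)))) (sumC-lincomb vs (c ∘ suc) (h ∘ there)) ⟩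
  c zero *ℚ 0ℚ +ℚ 0ℚ
    ≡⟨ trans (ℚ.+-identityʳ _) (ℚ.*-zeroʳ (c zero)) ⟩
  0ℚ ∎
  where open ≡-Reasoning

arrows-total : ∀ {n} {v : Vec′ n} → v ∈ arrowsV n → sumC (suc n) v ≡ 0ℚ
arrows-total {n} m with ∈-map⁻ vecOf m
... | a , a∈ , refl = sumC-vecOf (∈-arrows⁻ n a∈)

-- A point of mass at most ½ in the cone over the polytope can be moved in every direction
-- e_k - e_0 without leaving the polytope.
deep∉Bd : ∀ {n s x} → s ≤ℚ ½ → Cone (arrowsV (suc n)) s x → sumC (suc (suc n)) x ≡ 0ℚ → ¬ InBd (suc n) x
deep∉Bd {n} {s} {x} s≤½ cx x0 (_ , near) with uniform-bound (suc n) (ℚ.positive⁻¹ ½)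
... | ε , ε>0 , small with near ε ε>0
...   | y , (c , e , f) , close , y∉ = y∉ (cone-cong {vs = vs} total mass point)
  where
  vs = arrowsV (suc n)
  d : Fin (suc (suc n)) → ℚ
  d k = y k - x k
  -- The sign of the displacement decides whether the arrow into or out of endpoint `suc v` is used,
  -- so its cost is the absolute value.
  move : ∀ v → Cone vs ∣ d (suc v) ∣ (λ k → d (suc v) *ℚ (δ (suc v) k - δ zero k))
  move v with ℚ.∣p∣≡p∨∣p∣≡-p (d (suc v))
  ... | inj₁ eq = cone-cong {vs = vs} (cone-* {vs = vs} ∣ d (suc v) ∣ (ℚ.0≤∣p∣ _) (cone-arrow {a = zero , suc v} (λ ())))
    (ℚ.*-identityʳ _) λ k → cong₂ _*ℚ_ eq (vecOf≡δ (λ ()) k)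
  ... | inj₂ eq = cone-cong {vs = vs} (cone-* {vs = vs} ∣ d (suc v) ∣ (ℚ.0≤∣p∣ _) (cone-arrow {a = suc v , zero} (λ ())))
    (ℚ.*-identityʳ _) λ k → trans (cong₂ _*ℚ_ eq (vecOf≡δ (λ ()) k))
      (solve 3 (λ d p q → (:- d) :* (q :- p) := d :* (p :- q)) refl (d (suc v)) (δ (suc v) k) (δ zero k))
  μ = sumC (suc n) (λ v → ∣ d (suc v) ∣)
  moves : Cone vs μ (λ k → sumC (suc n) (λ v → d (suc v) *ℚ (δ (suc v) k - δ zero k)))
  moves = comb-sum (0ℚ ≤ℚ_) {vs} (suc n) ℚ.≤-refl ℚ.+-mono-≤ move
  μ≤½ : μ ≤ℚ ½
  μ≤½ = small (λ v → ∣ d (suc v) ∣) λ v → ℚ.<⇒≤ (close (suc v))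
  rest = 1ℚ - (s +ℚ μ)
  rest≥0 : 0ℚ ≤ℚ rest
  rest≥0 = p≤q⇒0≤q-p (ℚ.+-mono-≤ s≤½ μ≤½)
  total : Cone vs ((s +ℚ μ) +ℚ rest *ℚ 1ℚ)
    (λ k → (x k +ℚ sumC (suc n) (λ v → d (suc v) *ℚ (δ (suc v) k - δ zero k))) +ℚ rest *ℚ zeroV {suc n} k)
  total = cone-+ {vs = vs} (cone-+ {vs = vs} cx moves) (cone-* {vs = vs} rest rest≥0 (zero-cone n))
  mass : (s +ℚ μ) +ℚ rest *ℚ 1ℚ ≡ 1ℚ
  mass = solve 1 (λ t → t :+ (con 1ℚ :- t) :* con 1ℚ := con 1ℚ) refl (s +ℚ μ)
  y0 : sumC (suc (suc n)) y ≡ 0ℚ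
  y0 = trans (sumC-cong (suc (suc n)) (λ k → sym (f k))) (sumC-lincomb vs c arrows-total)
  shift : ∀ k → sumC (suc n) (λ v → d (suc v) *ℚ (δ (suc v) k - δ zero k)) ≡ d k
  shift (suc w) = trans (sumC-cong (suc n) λ v → cong (d (suc v) *ℚ_) (ℚ.+-identityʳ (δ v w))) (sumC-δ (d ∘ suc) w)
  -- Coordinate `zero` is not steered by a move of its own; it comes out right because the
  -- coordinates of `x` and of `y` both sum to zero.
  shift zero = begin
    sumC (suc n) (λ v → d (suc v) *ℚ -1ℚ)
      ≡⟨ sumC-cong (suc n) (λ v → ℚ.*-comm (d (suc v)) -1ℚ) ⟩
    sumC (suc n) (λ v → -1ℚ *ℚ d (suc v))
      ≡⟨ sumC-* (suc n) -1ℚ (d ∘ suc) ⟩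
    -1ℚ *ℚ D
      ≡⟨ solve 2 (λ p q → con -1ℚ :* q := p :- (p :+ q)) refl (d zero) D ⟩
    d zero - sumC (suc (suc n)) d
      ≡⟨ cong (λ z → d zero - z) d0 ⟩
    d zero - 0ℚ
      ≡⟨ ℚ.+-identityʳ (d zero) ⟩
    d zero ∎
    where
    open ≡-Reasoning
    D = sumC (suc n) (d ∘ suc)
    d0 : sumC (suc (suc n)) d ≡ 0ℚ
    d0 = trans (sumC-cong (suc (suc n)) λ k → solve 2 (λ p q → p :- q := p :+ con -1ℚ :* q) refl (y k) (x k))
      (trans (sumC-+ (suc (suc n)) y (λ k → -1ℚ *ℚ x k))
        (cong₂ _+ℚ_ y0 (trans (sumC-* (suc (suc n)) -1ℚ x) (cong (-1ℚ *ℚ_) x0))))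
  point : ∀ k → (x k +ℚ sumC (suc n) (λ v → d (suc v) *ℚ (δ (suc v) k - δ zero k))) +ℚ rest *ℚ zeroV {suc n} k ≡ y k
  point k = trans (cong (λ z → (x k +ℚ z) +ℚ rest *ℚ 0ℚ) (shift k))
    (solve 3 (λ x y r → (x :+ (y :- x)) :+ r :* con 0ℚ := y) refl (x k) (y k) rest)

comb-total : ∀ (N : ℚ → Set) {n s} {x : Vec′ n} → Comb N (arrowsV n) s x → sumC (suc n) x ≡ 0ℚ
comb-total N {n} (c , _ , _ , f) = trans (sumC-cong (suc n) (λ k → sym (f k))) (sumC-lincomb (arrowsV n) c arrows-total)

closed-≤ : ∀ p q {_ : True (p ℚ.≤? q)} → p ≤ℚ q
closed-≤ p q {w} = toWitness w

-- Linear forms exposing faces of the polytope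

2ℚ : ℚ
2ℚ = 1ℚ +ℚ 1ℚ

maximum-sum : ∀ {p q} → p ≤ℚ 1ℚ → q ≤ℚ 1ℚ → p +ℚ q ≡ 2ℚ → p ≡ 1ℚ × q ≡ 1ℚ
maximum-sum {p} {q} p≤ q≤ e = sym (p-q≡0⇒p≡q 1ℚ p (proj₁ both)) , sym (p-q≡0⇒p≡q 1ℚ q (proj₂ both))
  where
  slack-sum : (1ℚ - p) +ℚ (1ℚ - q) ≡ 0ℚ
  slack-sum = trans (solve 3 (λ u p q → (u :- p) :+ (u :- q) := (u :+ u) :- (p :+ q)) refl 1ℚ p q)
    (trans (cong (λ z → 2ℚ - z) e) (ℚ.+-inverseʳ 2ℚ))
  both : 1ℚ - p ≡ 0ℚ × 1ℚ - q ≡ 0ℚ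
  both = +-zero (p≤q⇒0≤q-p p≤) (p≤q⇒0≤q-p q≤) slack-sum

module _ {n : ℕ} where

  heads tails : Fin (suc n) → Fin (suc n) → Functional {n}
  heads h h′ = (1ℚ , h) ∷ (1ℚ , h′) ∷ []
  tails t t′ = (-1ℚ , t) ∷ (-1ℚ , t′) ∷ []

  private
    value : ℚ → ℚ → ℚ → ℚ → ℚ
    value p x q y = p *ℚ x +ℚ (q *ℚ y +ℚ 0ℚ)

  -- An arrow has coordinate one only at its head. Together with `tails-bound`, the form
  -- `heads h h′ ++ tails t t′` is at most two, with equality only for arrows from `t` or `t′` to
  -- `h` or `h′`.
  heads-bound : ∀ {h h′} → h ≢ h′ → (a : Pt n) →
    ⟦ heads h h′ ⟧ (vecOf a) ≤ℚ 1ℚ × (⟦ heads h h′ ⟧ (vecOf a) ≡ 1ℚ → head a ≡ h ⊎ head a ≡ h′)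
  heads-bound {h} {h′} ne (i , j) with vecOf-view i j h | vecOf-view i j h′
  ... | at-head p _ | at-head q _ = ⊥-elim (ne (trans p (sym q)))
  ... | at-head p e | at-tail _ _ e′ rewrite e | e′ = closed-≤ (value 1ℚ 1ℚ 1ℚ -1ℚ) 1ℚ , λ _ → inj₁ (sym p)
  ... | at-head p e | elsewhere _ _ e′ rewrite e | e′ = closed-≤ (value 1ℚ 1ℚ 1ℚ 0ℚ) 1ℚ , λ _ → inj₁ (sym p)
  ... | at-tail _ _ e | at-head q e′ rewrite e | e′ = closed-≤ (value 1ℚ -1ℚ 1ℚ 1ℚ) 1ℚ , λ _ → inj₂ (sym q)
  ... | elsewhere _ _ e | at-head q e′ rewrite e | e′ = closed-≤ (value 1ℚ 0ℚ 1ℚ 1ℚ) 1ℚ , λ _ → inj₂ (sym q)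
  ... | at-tail _ _ e | at-tail _ _ e′ rewrite e | e′ = closed-≤ (value 1ℚ -1ℚ 1ℚ -1ℚ) 1ℚ , λ ()
  ... | at-tail _ _ e | elsewhere _ _ e′ rewrite e | e′ = closed-≤ (value 1ℚ -1ℚ 1ℚ 0ℚ) 1ℚ , λ ()
  ... | elsewhere _ _ e | at-tail _ _ e′ rewrite e | e′ = closed-≤ (value 1ℚ 0ℚ 1ℚ -1ℚ) 1ℚ , λ ()
  ... | elsewhere _ _ e | elsewhere _ _ e′ rewrite e | e′ = closed-≤ (value 1ℚ 0ℚ 1ℚ 0ℚ) 1ℚ , λ ()

  tails-bound : ∀ {t t′} → t ≢ t′ → (a : Pt n) →
    ⟦ tails t t′ ⟧ (vecOf a) ≤ℚ 1ℚ × (⟦ tails t t′ ⟧ (vecOf a) ≡ 1ℚ → tail a ≡ t ⊎ tail a ≡ t′)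
  tails-bound {t} {t′} ne (i , j) with vecOf-view i j t | vecOf-view i j t′
  ... | at-tail _ p _ | at-tail _ q _ = ⊥-elim (ne (trans p (sym q)))
  ... | at-tail _ p e | at-head _ e′ rewrite e | e′ = closed-≤ (value -1ℚ -1ℚ -1ℚ 1ℚ) 1ℚ , λ _ → inj₁ (sym p)
  ... | at-tail _ p e | elsewhere _ _ e′ rewrite e | e′ = closed-≤ (value -1ℚ -1ℚ -1ℚ 0ℚ) 1ℚ , λ _ → inj₁ (sym p)
  ... | at-head _ e | at-tail _ q e′ rewrite e | e′ = closed-≤ (value -1ℚ 1ℚ -1ℚ -1ℚ) 1ℚ , λ _ → inj₂ (sym q)
  ... | elsewhere _ _ e | at-tail _ q e′ rewrite e | e′ = closed-≤ (value -1ℚ 0ℚ -1ℚ -1ℚ) 1ℚ , λ _ → inj₂ (sym q)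
  ... | at-head _ e | at-head _ e′ rewrite e | e′ = closed-≤ (value -1ℚ 1ℚ -1ℚ 1ℚ) 1ℚ , λ ()
  ... | at-head _ e | elsewhere _ _ e′ rewrite e | e′ = closed-≤ (value -1ℚ 1ℚ -1ℚ 0ℚ) 1ℚ , λ ()
  ... | elsewhere _ _ e | at-head _ e′ rewrite e | e′ = closed-≤ (value -1ℚ 0ℚ -1ℚ 1ℚ) 1ℚ , λ ()
  ... | elsewhere _ _ e | elsewhere _ _ e′ rewrite e | e′ = closed-≤ (value -1ℚ 0ℚ -1ℚ 0ℚ) 1ℚ , λ ()

  head-maximal : ∀ {h} (a : Pt n) → ⟦ (1ℚ , h) ∷ [] ⟧ (vecOf a) ≡ 1ℚ → head a ≡ h
  head-maximal {h} (i , j) e with vecOf-view i j h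
  ... | at-head p _ = sym p
  ... | at-tail _ _ e′ rewrite e′ with () ← e
  ... | elsewhere _ _ e′ rewrite e′ with () ← e

  tail-maximal : ∀ {t} (a : Pt n) → ⟦ (-1ℚ , t) ∷ [] ⟧ (vecOf a) ≡ 1ℚ → tail a ≡ t
  tail-maximal {t} (i , j) e with vecOf-view i j t
  ... | at-tail _ p _ = sym p
  ... | at-head _ e′ rewrite e′ with () ← e
  ... | elsewhere _ _ e′ rewrite e′ with () ← e

  -- The hypothesis excludes the only cancellation, `j` being the tail of the other arrow.
  midpoint-head>0 : ∀ {i j i′ j′ : Fin (suc n)} → j ≢ i′ → 0ℚ <ℚ ⟦ (1ℚ , j) ∷ [] ⟧ (midpoint (i , j) (i′ , j′))
  midpoint-head>0 {i} {j} {i′} {j′} ne rewrite vecOf-head {i = i} {j} with vecOf-view i′ j′ j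
  ... | at-head _ e rewrite e = ℚ.positive⁻¹ _
  ... | at-tail _ p _ = ⊥-elim (ne p)
  ... | elsewhere _ _ e rewrite e = ℚ.positive⁻¹ _

  midpoint-tail<0 : ∀ {i j i′ j′ : Fin (suc n)} → i ≢ j → i ≢ j′ → 0ℚ <ℚ ⟦ (-1ℚ , i) ∷ [] ⟧ (midpoint (i , j) (i′ , j′))
  midpoint-tail<0 {i} {j} {i′} {j′} ne ne′ rewrite vecOf-tail {i = i} {j} ne with vecOf-view i′ j′ i
  ... | at-tail _ _ e rewrite e = ℚ.positive⁻¹ _
  ... | at-head p _ = ⊥-elim (ne′ p)
  ... | elsewhere _ _ e rewrite e = ℚ.positive⁻¹ _

  midpoint-comm : ∀ (a b : Pt n) k → midpoint a b k ≡ midpoint b a k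
  midpoint-comm a b k = ℚ.+-comm (½ *ℚ vecOf a k) (½ *ℚ vecOf b k)

  functional-head : ∀ {h} (a : Pt n) → 0ℚ <ℚ ⟦ (1ℚ , h) ∷ [] ⟧ (vecOf a) → head a ≡ h
  functional-head {h} (i , j) p = sym (vecOf>0 {i = i} {j} {h} (subst (0ℚ <ℚ_)
    (solve 1 (λ q → con 1ℚ :* q :+ con 0ℚ := q) refl (vecOf (i , j) h)) p))

  functional-tail : ∀ {t} (a : Pt n) → 0ℚ <ℚ ⟦ (-1ℚ , t) ∷ [] ⟧ (vecOf a) → tail a ≡ t
  functional-tail {t} (i , j) p = sym (vecOf<0 {i = i} {j} {t} (subst (_<ℚ 0ℚ)
    (solve 1 (λ q → :- (con -1ℚ :* q :+ con 0ℚ) := q) refl (vecOf (i , j) t)) (ℚ.neg-antimono-< p)))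

arrow-∈ : ∀ {n} {S : List (Pt n)} {a t h} → a ∈ S → tail a ≡ t → head a ≡ h → (t , h) ∈ S
arrow-∈ m refl refl = m

-- Edges and non-edges forced by the triangulation

module FlagRules {n : ℕ} (E : Graph (suc n)) (sy : Symmetric E) (tri : Triangulates E) where

  face⊆Bd : ∀ S → Face E S → ∀ x → InConv (map vecOf S) x → InBd (suc n) x
  face⊆Bd = proj₁ (proj₂ tri)

  -- The midpoint is half of the arrow `(i , k)`, or the origin if `i ≡ k`. Either has mass at most
  -- one half, so `deep∉Bd` keeps it off the boundary, where every face must lie.
  touching-nonedge : ∀ {i j k} → i ≢ j → j ≢ k → E (i , j) (j , k) ≡ false
  touching-nonedge {i} {j} {k} i≢j j≢k with E (i , j) (j , k) in e
  ... | false = refl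
  ... | true = ⊥-elim (absurd (i Fin.≟ k))
    where
    a b : Pt (suc n)
    a = i , j
    b = j , k
    mid∈Bd : InBd (suc n) (midpoint a b)
    mid∈Bd = face⊆Bd (pairOf a b) (pair-face sy e) (midpoint a b) (midpoint∈conv {S = pairOf a b} (∈-pairOf⁺ˡ a b i≢j) (∈-pairOf⁺ʳ a b j≢k))
    mid≡ : ∀ t → midpoint a b t ≡ ½ *ℚ (δ k t - δ i t)
    mid≡ t = trans (cong₂ (λ p q → ½ *ℚ p +ℚ ½ *ℚ q) (vecOf≡δ i≢j t) (vecOf≡δ j≢k t))
      (solve 4 (λ u p q r → u :* (q :- p) :+ u :* (r :- q) := u :* (r :- p)) refl ½ (δ i t) (δ j t) (δ k t))
    vs = arrowsV (suc n)
    absurd : Dec (i ≡ k) → ⊥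
    absurd (yes refl) = deep∉Bd 0≤½ cone (comb-total (0ℚ ≤ℚ_) cone) mid∈Bd
      where
      cone : Cone vs 0ℚ (midpoint a b)
      cone = cone-cong {vs = vs} (comb-0 (0ℚ ≤ℚ_) vs ℚ.≤-refl) refl λ t → sym (trans (mid≡ t)
        (solve 2 (λ u p → u :* (p :- p) := con 0ℚ) refl ½ (δ i t)))
    absurd (no i≢k) = deep∉Bd ℚ.≤-refl cone (comb-total (0ℚ ≤ℚ_) cone) mid∈Bd
      where
      cone : Cone vs ½ (midpoint a b)
      cone = cone-cong {vs = vs} (cone-* {vs = vs} ½ 0≤½ (cone-arrow {a = i , k} i≢k)) refl
        λ t → trans (cong (½ *ℚ_) (vecOf≡δ i≢k t)) (sym (mid≡ t))

  face-arrows : ∀ {S} → Face E S → ∀ {a} → a ∈ S → IsArrow a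
  face-arrows (S∈ , _) m = ∈-arrows⁻ (suc n) (∈-sublists⇒⊆ S∈ m)

  face-edge : ∀ {S a b} → Face E S → a ∈ S → b ∈ S → a ≢ b → E a b ≡ true
  face-edge (_ , f) = isFace⇒ sy f

  -- Only arrows on which `L` is maximal can carry weight at `x`. With a coordinate or its negative
  -- as `L′`, this finds an arrow of `S` with a prescribed head or tail.
  support : ∀ L M L′ {S x} → Face E S → InConv (map vecOf S) x → Bounds L M → ⟦ L ⟧ x ≡ M → 0ℚ <ℚ ⟦ L′ ⟧ x →
    ∃ λ a → a ∈ S × ⟦ L ⟧ (vecOf a) ≡ M × 0ℚ <ℚ ⟦ L′ ⟧ (vecOf a)
  support L M L′ {S} {x} face (c , c≥0 , e , f) b Lx L′x = pick (wsum-support vs c {λ v → M - ⟦ L ⟧ v} {⟦ L′ ⟧} c≥0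
      (bounds-slack {L = L} {M} b S (face-arrows face)) no-slack positive)
    where
    vs = map vecOf S
    no-slack : wsum vs c (λ v → M - ⟦ L ⟧ v) ≡ 0ℚ
    no-slack = trans (slack L M vs c e f) (trans (cong (λ z → M - z) Lx) (ℚ.+-inverseʳ M))
    positive : 0ℚ <ℚ wsum vs c ⟦ L′ ⟧
    positive = subst (0ℚ <ℚ_) (sym (wsum-functional L′ vs c f)) L′x
    pick : (∃ λ v → v ∈ vs × M - ⟦ L ⟧ v ≡ 0ℚ × 0ℚ <ℚ ⟦ L′ ⟧ v) →
      ∃ λ a → a ∈ S × ⟦ L ⟧ (vecOf a) ≡ M × 0ℚ <ℚ ⟦ L′ ⟧ (vecOf a)
    pick (v , v∈ , p , q) with ∈-map⁻ vecOf v∈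
    ... | a , a∈ , refl = a , a∈ , sym (p-q≡0⇒p≡q M (⟦ L ⟧ (vecOf a)) p) , q

  cover : ∀ L M {a b} → 0ℚ <ℚ M → Bounds L M → IsArrow a → IsArrow b → ⟦ L ⟧ (midpoint a b) ≡ M →
    ∃ λ S → Face E S × InConv (map vecOf S) (midpoint a b)
  cover L M {a₁} {b₁} M>0 b ha hb e = proj₁ (proj₂ (proj₂ tri)) (midpoint a₁ b₁) (maximizer∈Bd L M M>0 b e
    (midpoint∈conv {S = arrows (suc n)} (∈-arrows⁺ (suc n) ha) (∈-arrows⁺ (suc n) hb)))

  -- A face covering the midpoint has weight only on arrows with tail `i`; since the coordinates at
  -- `j` and `k` are positive, both arrows occur in it.
  shared-tail : ∀ {i j k} → i ≢ j → i ≢ k → j ≢ k → E (i , j) (i , k) ≡ true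
  shared-tail {i} {j} {k} i≢j i≢k j≢k = face-edge face (arrow-∈ a∈ ta ha) (arrow-∈ b∈ tb hb) λ { refl → j≢k refl }
    where
    L = (-1ℚ , i) ∷ []
    bound = proj₂ (coordinate-bounds i)
    value : ⟦ L ⟧ (midpoint (i , j) (i , k)) ≡ 1ℚ
    value = cong₂ (λ p q → -1ℚ *ℚ (½ *ℚ p +ℚ ½ *ℚ q) +ℚ 0ℚ) (vecOf-tail i≢j) (vecOf-tail i≢k)
    covering = cover L 1ℚ (ℚ.positive⁻¹ 1ℚ) bound i≢j i≢k value
    S = proj₁ covering
    face = proj₁ (proj₂ covering)
    inS = proj₂ (proj₂ covering)
    first = support L 1ℚ ((1ℚ , j) ∷ []) face inS bound value (midpoint-head>0 {i = i} (≢-sym i≢j))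
    second = support L 1ℚ ((1ℚ , k) ∷ []) face inS bound value
      (subst (0ℚ <ℚ_) (cong (λ z → 1ℚ *ℚ z +ℚ 0ℚ) (midpoint-comm (i , k) (i , j) k)) (midpoint-head>0 {i = i} (≢-sym i≢k)))
    a∈ = proj₁ (proj₂ first)
    b∈ = proj₁ (proj₂ second)
    ta = tail-maximal (proj₁ first) (proj₁ (proj₂ (proj₂ first)))
    tb = tail-maximal (proj₁ second) (proj₁ (proj₂ (proj₂ second)))
    ha = functional-head (proj₁ first) (proj₂ (proj₂ (proj₂ first)))
    hb = functional-head (proj₁ second) (proj₂ (proj₂ (proj₂ second)))

  shared-head : ∀ {i j k} → i ≢ k → j ≢ k → i ≢ j → E (i , k) (j , k) ≡ true
  shared-head {i} {j} {k} i≢k j≢k i≢j = face-edge face (arrow-∈ a∈ ta ha) (arrow-∈ b∈ tb hb) λ { refl → i≢j refl }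
    where
    L = (1ℚ , k) ∷ []
    bound = proj₁ (coordinate-bounds k)
    value : ⟦ L ⟧ (midpoint (i , k) (j , k)) ≡ 1ℚ
    value = cong₂ (λ p q → 1ℚ *ℚ (½ *ℚ p +ℚ ½ *ℚ q) +ℚ 0ℚ) (vecOf-head {i = i} {k}) (vecOf-head {i = j} {k})
    covering = cover L 1ℚ (ℚ.positive⁻¹ 1ℚ) bound i≢k j≢k value
    S = proj₁ covering
    face = proj₁ (proj₂ covering)
    inS = proj₂ (proj₂ covering)
    first = support L 1ℚ ((-1ℚ , i) ∷ []) face inS bound value (midpoint-tail<0 i≢k i≢k)
    second = support L 1ℚ ((-1ℚ , j) ∷ []) face inS bound value
      (subst (0ℚ <ℚ_) (cong (λ z → -1ℚ *ℚ z +ℚ 0ℚ) (midpoint-comm (j , k) (i , k) j)) (midpoint-tail<0 j≢k j≢k))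
    a∈ = proj₁ (proj₂ first)
    b∈ = proj₁ (proj₂ second)
    ha = head-maximal (proj₁ first) (proj₁ (proj₂ (proj₂ first)))
    hb = head-maximal (proj₁ second) (proj₁ (proj₂ (proj₂ second)))
    ta = functional-tail (proj₁ first) (proj₂ (proj₂ (proj₂ first)))
    tb = functional-tail (proj₁ second) (proj₂ (proj₂ (proj₂ second)))

  -- Two edges with the same midpoint would meet in the hull of their common vertices. There are
  -- none, and the empty combination has weight zero instead of one.
  disjoint-nonedge : ∀ {a b a′ b′} → IsArrow a → IsArrow b → IsArrow a′ → IsArrow b′ →
    (∀ k → midpoint a b k ≡ midpoint a′ b′ k) → a ≢ a′ → a ≢ b′ → b ≢ a′ → b ≢ b′ →
    E a b ≡ true → E a′ b′ ≡ true → ⊥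
  disjoint-nonedge {a} {b} {a′} {b′} ha hb ha′ hb′ mid≡ n₁ n₂ n₃ n₄ e e′ =
    empty (pairOf a b ∩L pairOf a′ b′) none meet
    where
    common : InConv (map vecOf (pairOf a′ b′)) (midpoint a b)
    common = cone-cong {vs = map vecOf (pairOf a′ b′)}
      (midpoint∈conv {S = pairOf a′ b′} (∈-pairOf⁺ˡ a′ b′ ha′) (∈-pairOf⁺ʳ a′ b′ hb′)) refl (λ k → sym (mid≡ k))
    meet : InConv (map vecOf (pairOf a b ∩L pairOf a′ b′)) (midpoint a b)
    meet = proj₂ (proj₂ (proj₂ tri)) (pairOf a b) (pairOf a′ b′) (pair-face {a = a} {b} sy e) (pair-face {a = a′} {b′} sy e′) (midpoint a b)
      (midpoint∈conv {S = pairOf a b} (∈-pairOf⁺ˡ a b ha) (∈-pairOf⁺ʳ a b hb)) common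
    none : ∀ {c} → c ∈ pairOf a b ∩L pairOf a′ b′ → ⊥
    none m with ∈-filter⁻ (λ c → DM._∈?_ _≟ₚ_ c (pairOf a′ b′)) {xs = pairOf a b} m
    ... | p , q with ∈-pairOf⁻ a b p | ∈-pairOf⁻ a′ b′ q
    ...   | inj₁ refl | inj₁ r = n₁ r
    ...   | inj₁ refl | inj₂ r = n₂ r
    ...   | inj₂ refl | inj₁ r = n₃ r
    ...   | inj₂ refl | inj₂ r = n₄ r
    empty : ∀ S → (∀ {c} → c ∈ S → ⊥) → InConv (map vecOf S) (midpoint a b) → ⊥
    empty [] _ (_ , _ , () , _)
    empty (_ ∷ _) nothing _ = nothing (here refl)

  module _ {t t′ h h′ : Fin (suc (suc n))} (t≢t′ : t ≢ t′) (h≢h′ : h ≢ h′)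
           (th : t ≢ h) (th′ : t ≢ h′) (t′h : t′ ≢ h) (t′h′ : t′ ≢ h′) where

    private
      a b : Pt (suc n)
      a = t , h
      b = t′ , h′

      L : Functional {suc n}
      L = heads h h′ ++ tails t t′

      L≡ : ∀ x → ⟦ L ⟧ x ≡ ⟦ heads h h′ ⟧ x +ℚ ⟦ tails t t′ ⟧ x
      L≡ = ⟦⟧-++ (heads h h′) (tails t t′)

      bound : Bounds L 2ℚ
      bound {c} _ = subst (_≤ℚ 2ℚ) (sym (L≡ (vecOf c)))
        (ℚ.+-mono-≤ (proj₁ (heads-bound h≢h′ c)) (proj₁ (tails-bound t≢t′ c)))

      half : ∀ k {p q} → vecOf a k ≡ p → vecOf b k ≡ q → midpoint a b k ≡ ½ *ℚ p +ℚ ½ *ℚ q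
      half k = cong₂ (λ p q → ½ *ℚ p +ℚ ½ *ℚ q)

      value : ⟦ L ⟧ (midpoint a b) ≡ 2ℚ
      value = cong₂ _+ℚ_ (cong (1ℚ *ℚ_) (half h (vecOf-head {i = t} {h}) (vecOf-elsewhere (≢-sym t′h) h≢h′)))
        (cong₂ _+ℚ_ (cong (1ℚ *ℚ_) (half h′ (vecOf-elsewhere (≢-sym th′) (≢-sym h≢h′)) (vecOf-head {i = t′} {h′})))
        (cong₂ _+ℚ_ (cong (-1ℚ *ℚ_) (half t (vecOf-tail th) (vecOf-elsewhere t≢t′ th′)))
        (cong (λ z → -1ℚ *ℚ z +ℚ 0ℚ) (half t′ (vecOf-elsewhere (≢-sym t≢t′) t′h) (vecOf-tail t′h′)))))

      Ends : Pt (suc n) → Set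
      Ends c = (head c ≡ h ⊎ head c ≡ h′) × (tail c ≡ t ⊎ tail c ≡ t′)

      ends : ∀ c → ⟦ L ⟧ (vecOf c) ≡ 2ℚ → Ends c
      ends c m = proj₂ (heads-bound h≢h′ c) (proj₁ both) , proj₂ (tails-bound t≢t′ c) (proj₂ both)
        where
        both : ⟦ heads h h′ ⟧ (vecOf c) ≡ 1ℚ × ⟦ tails t t′ ⟧ (vecOf c) ≡ 1ℚ
        both = maximum-sum (proj₁ (heads-bound h≢h′ c)) (proj₁ (tails-bound t≢t′ c)) (trans (sym (L≡ (vecOf c))) m)

    module _ {S : List (Pt (suc n))} (face : Face E S) (inS : InConv (map vecOf S) (midpoint a b)) where

      private
        find-arrow : ∀ L′ → 0ℚ <ℚ ⟦ L′ ⟧ (midpoint a b) → ∃ λ c → c ∈ S × Ends c × 0ℚ <ℚ ⟦ L′ ⟧ (vecOf c)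
        find-arrow L′ pos = refine (support L 2ℚ L′ {S} {midpoint a b} face inS bound value pos)
          where
          refine : (∃ λ c → c ∈ S × ⟦ L ⟧ (vecOf c) ≡ 2ℚ × 0ℚ <ℚ ⟦ L′ ⟧ (vecOf c)) →
            ∃ λ c → c ∈ S × Ends c × 0ℚ <ℚ ⟦ L′ ⟧ (vecOf c)
          refine (c , c∈ , m , p) = c , c∈ , ends c m , p

        at-head-of : ∀ k → 0ℚ <ℚ ⟦ (1ℚ , k) ∷ [] ⟧ (midpoint a b) → (t , k) ∈ S ⊎ (t′ , k) ∈ S
        at-head-of k pos = refine (find-arrow ((1ℚ , k) ∷ []) pos)
          where
          refine : (∃ λ c → c ∈ S × Ends c × 0ℚ <ℚ ⟦ (1ℚ , k) ∷ [] ⟧ (vecOf c)) → (t , k) ∈ S ⊎ (t′ , k) ∈ S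
          refine (c , c∈ , (_ , inj₁ e) , p) = inj₁ (arrow-∈ c∈ e (functional-head c p))
          refine (c , c∈ , (_ , inj₂ e) , p) = inj₂ (arrow-∈ c∈ e (functional-head c p))

        at-tail-of : ∀ k → 0ℚ <ℚ ⟦ (-1ℚ , k) ∷ [] ⟧ (midpoint a b) → (k , h) ∈ S ⊎ (k , h′) ∈ S
        at-tail-of k pos = refine (find-arrow ((-1ℚ , k) ∷ []) pos)
          where
          refine : (∃ λ c → c ∈ S × Ends c × 0ℚ <ℚ ⟦ (-1ℚ , k) ∷ [] ⟧ (vecOf c)) → (k , h) ∈ S ⊎ (k , h′) ∈ S
          refine (c , c∈ , (inj₁ e , _) , p) = inj₁ (arrow-∈ c∈ (functional-tail c p) e)
          refine (c , c∈ , (inj₂ e , _) , p) = inj₂ (arrow-∈ c∈ (functional-tail c p) e)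

        -- Cells of a two by two grid that meet both rows and both columns contain one of the two
        -- diagonals.
        combine : {A B C D : Set} → A ⊎ C → D ⊎ B → A ⊎ D → C ⊎ B → (A × B) ⊎ (D × C)
        combine (inj₁ p) (inj₂ q) _ _ = inj₁ (p , q)
        combine (inj₂ p) (inj₁ q) _ _ = inj₂ (q , p)
        combine (inj₁ p) (inj₁ q) _ (inj₁ r) = inj₂ (q , r)
        combine (inj₁ p) (inj₁ q) _ (inj₂ r) = inj₁ (p , r)
        combine (inj₂ p) (inj₂ q) (inj₁ r) _ = inj₁ (r , q)
        combine (inj₂ p) (inj₂ q) (inj₂ r) _ = inj₂ (r , p)

      -- The midpoint has the same positive coordinate h, h′ and negative coordinates t, t′ in any
      -- representation, so every one of these endpoints is used.
      matching : ((t , h) ∈ S × (t′ , h′) ∈ S) ⊎ ((t , h′) ∈ S × (t′ , h) ∈ S)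
      matching = combine
        (at-head-of h (midpoint-head>0 {i = t} {h} {t′} {h′} (≢-sym t′h)))
        (at-head-of h′ (subst (0ℚ <ℚ_) (cong (λ z → 1ℚ *ℚ z +ℚ 0ℚ) (midpoint-comm b a h′)) (midpoint-head>0 {i = t′} {h′} {t} {h} (≢-sym th′))))
        (at-tail-of t (midpoint-tail<0 {i = t} {h} {t′} {h′} th th′))
        (at-tail-of t′ (subst (0ℚ <ℚ_) (cong (λ z → -1ℚ *ℚ z +ℚ 0ℚ) (midpoint-comm b a t′)) (midpoint-tail<0 {i = t′} {h′} {t} {h} t′h′ t′h)))

    some-edge : E (t , h) (t′ , h′) ≡ true ⊎ E (t , h′) (t′ , h) ≡ true
    some-edge = edge (proj₁ (proj₂ covering)) (matching (proj₁ (proj₂ covering)) (proj₂ (proj₂ covering)))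
      where
      covering = cover L 2ℚ {a} {b} (ℚ.positive⁻¹ 2ℚ) bound th t′h′ value
      edge : ∀ {S} → Face E S → ((t , h) ∈ S × (t′ , h′) ∈ S) ⊎ ((t , h′) ∈ S × (t′ , h) ∈ S) →
        E (t , h) (t′ , h′) ≡ true ⊎ E (t , h′) (t′ , h) ≡ true
      edge face (inj₁ (p , q)) = inj₁ (face-edge face p q λ e → t≢t′ (cong tail e))
      edge face (inj₂ (p , q)) = inj₂ (face-edge face p q λ e → t≢t′ (cong tail e))

    not-both : E (t , h) (t′ , h′) ≡ true → E (t , h′) (t′ , h) ≡ true → ⊥
    not-both = disjoint-nonedge th t′h′ th′ t′h
      (λ k → trans (cong₂ (λ p q → ½ *ℚ p +ℚ ½ *ℚ q) (vecOf≡δ th k) (vecOf≡δ t′h′ k))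
        (trans (solve 5 (λ u a b c d → u :* (a :- b) :+ u :* (c :- d) := u :* (c :- b) :+ u :* (a :- d)) refl
            ½ (δ h k) (δ t k) (δ h′ k) (δ t′ k))
          (sym (cong₂ (λ p q → ½ *ℚ p +ℚ ½ *ℚ q) (vecOf≡δ th′ k) (vecOf≡δ t′h k)))))
      (h≢h′ ∘ cong head) (t≢t′ ∘ cong tail) (t≢t′ ∘ sym ∘ cong tail) (h≢h′ ∘ sym ∘ cong head)

    flip : E (t , h) (t′ , h′) ≡ not (E (t , h′) (t′ , h))
    flip = exactly-one (E (t , h) (t′ , h′)) (E (t , h′) (t′ , h)) some-edge not-both
      where
      exactly-one : ∀ x y → x ≡ true ⊎ y ≡ true → (x ≡ true → y ≡ true → ⊥) → x ≡ not y
      exactly-one true true _ f = ⊥-elim (f refl refl)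
      exactly-one true false _ _ = refl
      exactly-one false true _ _ = refl
      exactly-one false false (inj₁ ()) _
      exactly-one false false (inj₂ ()) _

-- Adjacency in terms of lower and upper ends

-- This is the interface between geometry and counting. The rules determine `E` on all pairs of
-- distinct arrows: `exchange` passes from each listed pattern on four endpoints to the
-- complementary matching.
record Rules {n : ℕ} (E : Graph n) (α β : Bool) : Set where
  field
    symmetric : Symmetric E
    touching : ∀ {i j k} → i ≢ j → j ≢ k → E (i , j) (j , k) ≡ false
    sharedTail : ∀ {i j k} → i ≢ j → i ≢ k → j ≢ k → E (i , j) (i , k) ≡ true
    sharedHead : ∀ {i j k} → i ≢ k → j ≢ k → i ≢ j → E (i , k) (j , k) ≡ true
    exchange : ∀ {t t′ h h′} → t ≢ t′ → h ≢ h′ → t ≢ h → t ≢ h′ → t′ ≢ h → t′ ≢ h′ →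
      E (t , h) (t′ , h′) ≡ not (E (t , h′) (t′ , h))
    revlex : RevlexClass E
    nestForward : ∀ {p₁ p₂ p₃ p₄} → toℕ p₁ < toℕ p₂ → toℕ p₂ < toℕ p₃ → toℕ p₃ < toℕ p₄ → E (p₁ , p₄) (p₂ , p₃) ≡ α
    nestBackward : ∀ {p₁ p₂ p₃ p₄} → toℕ p₁ < toℕ p₂ → toℕ p₂ < toℕ p₃ → toℕ p₃ < toℕ p₄ → E (p₄ , p₁) (p₃ , p₂) ≡ β

reversed : ∀ {n} → Graph n → Graph n
reversed E a b = E (swap a) (swap b)

-- Reversal exchanges tails with heads, hence `THTH` with `HTHT` and `THHT` with `HTTH`, and the
-- roles of `α` and `β`. Statements about forward arrows thereby apply to backward ones.
reversed-rules : ∀ {n α β} {E : Graph n} → Rules E α β → Rules (reversed E) β α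
reversed-rules {E = E} r = record
  { symmetric = λ a b → symmetric (swap a) (swap b)
  ; touching = λ i≢j j≢k → trans (symmetric _ _) (touching (≢-sym j≢k) (≢-sym i≢j))
  ; sharedTail = λ i≢j i≢k → sharedHead (≢-sym i≢j) (≢-sym i≢k)
  ; sharedHead = λ i≢k j≢k → sharedTail (≢-sym i≢k) (≢-sym j≢k)
  ; exchange = λ tt hh th th′ t′h t′h′ →
      trans (exchange hh tt (≢-sym th) (≢-sym t′h) (≢-sym th′) (≢-sym t′h′)) (cong not (symmetric _ _))
  ; revlex = λ p₁ p₂ p₃ p₄ l₁ l₂ l₃ → let (a , b , c , d) = revlex p₁ p₂ p₃ p₄ l₁ l₂ l₃ in b , a , d , c
  ; nestForward = nestBackward
  ; nestBackward = nestForward }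
  where open Rules r

toℕ-<⇒≢ : ∀ {n} {i j : Fin n} → toℕ i < toℕ j → i ≢ j
toℕ-<⇒≢ l refl = <-irrefl refl l

Forward : ∀ {n} → Pt n → Set
Forward a = toℕ (tail a) < toℕ (head a)

not-true : ∀ {x y} → x ≡ not y → y ≡ true → x ≡ true → ⊥
not-true refl refl ()

module Compatibility {n α β} {E : Graph n} (r : Rules E α β) where
  open Rules r

  -- If `a` started behind the end of `b`, the other matching would be the nesting pair of type
  -- `THTH`, which is an edge; if it started at that end, the arrows would touch.
  forward-lo<hi : ∀ {a b} → Forward a → Forward b → E a b ≡ true → toℕ (tail a) < toℕ (head b)
  forward-lo<hi {x , y} {x′ , y′} x<y x′<y′ e with <-cmp (toℕ x) (toℕ y′)
  ... | tri< l _ _ = l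
  ... | tri≈ _ eq _ with refl ← Fin.toℕ-injective eq
    with () ← trans (sym e) (trans (symmetric _ _) (touching (toℕ-<⇒≢ x′<y′) (toℕ-<⇒≢ x<y)))
  ... | tri> _ _ y′<x = ⊥-elim (not-true
    (exchange (≢-sym (toℕ-<⇒≢ (<-trans x′<y′ y′<x))) (≢-sym (toℕ-<⇒≢ (<-trans y′<x x<y))) (toℕ-<⇒≢ x<y)
      (≢-sym (toℕ-<⇒≢ y′<x)) (toℕ-<⇒≢ (<-trans x′<y′ (<-trans y′<x x<y))) (toℕ-<⇒≢ x′<y′))
    (trans (symmetric _ _) (proj₁ (revlex x′ y′ x y x′<y′ y′<x x<y))) e)

  -- Both arrows start before either ends, so unless they share a head they form a `TTHH` pair, for
  -- which `α` chooses between nesting and crossing.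
  forward-chain : ∀ {a b} → Forward a → Forward b → E a b ≡ true → toℕ (tail a) < toℕ (tail b) →
    ¬ Before α (toℕ (head b)) (toℕ (head a))
  forward-chain {x , y} {x′ , y′} x<y x′<y′ e x<x′ = by α refl
    where
    x′<y : toℕ x′ < toℕ y
    x′<y = forward-lo<hi x′<y′ x<y (trans (symmetric _ _) e)
    by : ∀ γ → α ≡ γ → ¬ Before γ (toℕ y′) (toℕ y)
    by true α≡ y<y′ = not-true
      (exchange (toℕ-<⇒≢ x<x′) (toℕ-<⇒≢ y<y′) (toℕ-<⇒≢ x<y) (toℕ-<⇒≢ (<-trans x<y y<y′)) (toℕ-<⇒≢ x′<y) (toℕ-<⇒≢ x′<y′))
      (trans (nestForward x<x′ x′<y y<y′) α≡) e
    by false α≡ y′<y with () ← trans (sym e) (trans (nestForward x<x′ x′<y′ y′<y) α≡)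

  forward-edge-< : ∀ {a b} → Forward a → Forward b → toℕ (tail b) < toℕ (head a) → toℕ (tail a) < toℕ (tail b) →
    ¬ Before α (toℕ (head b)) (toℕ (head a)) → E a b ≡ true
  forward-edge-< {x , y} {x′ , y′} x<y x′<y′ x′<y x<x′ nb with <-cmp (toℕ y) (toℕ y′)
  ... | tri≈ _ eq _ with refl ← Fin.toℕ-injective eq = sharedHead (toℕ-<⇒≢ x<y) (toℕ-<⇒≢ x′<y′) (toℕ-<⇒≢ x<x′)
  ... | tri< y<y′ _ _ = trans
    (exchange (toℕ-<⇒≢ x<x′) (toℕ-<⇒≢ y<y′) (toℕ-<⇒≢ x<y) (toℕ-<⇒≢ (<-trans x<y y<y′)) (toℕ-<⇒≢ x′<y) (toℕ-<⇒≢ x′<y′))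
    (trans (cong not (nestForward x<x′ x′<y y<y′)) (crossed α nb))
    where
    crossed : ∀ γ → ¬ Before γ (toℕ y′) (toℕ y) → not γ ≡ true
    crossed true nb = ⊥-elim (nb y<y′)
    crossed false _ = refl
  ... | tri> _ _ y′<y = trans (nestForward x<x′ x′<y′ y′<y) (nested α nb)
    where
    nested : ∀ γ → ¬ Before γ (toℕ y′) (toℕ y) → γ ≡ true
    nested true _ = refl
    nested false nb = ⊥-elim (nb y′<y)

  forward-edge : ∀ {a b} → a ≢ b → Forward a → Forward b → toℕ (tail a) < toℕ (head b) → toℕ (tail b) < toℕ (head a) →
    (toℕ (tail a) < toℕ (tail b) → ¬ Before α (toℕ (head b)) (toℕ (head a))) →
    (toℕ (tail b) < toℕ (tail a) → ¬ Before α (toℕ (head a)) (toℕ (head b))) → E a b ≡ true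
  forward-edge {x , y} {x′ , y′} a≢b x<y x′<y′ x<y′ x′<y ab ba with <-cmp (toℕ x) (toℕ x′)
  ... | tri< x<x′ _ _ = forward-edge-< x<y x′<y′ x′<y x<x′ (ab x<x′)
  ... | tri≈ _ eq _ with refl ← Fin.toℕ-injective eq = sharedTail (toℕ-<⇒≢ x<y) (toℕ-<⇒≢ x′<y′) λ { refl → a≢b refl }
  ... | tri> _ _ x′<x = trans (symmetric _ _) (forward-edge-< x′<y′ x<y x<y′ x′<x (ba x′<x))

  -- For `a` forward and `b` backward, this says that their intervals overlap and that no endpoint
  -- is both a tail and a head.
  Crossing : Pt n → Pt n → Set
  Crossing a b = toℕ (tail a) ≤ toℕ (tail b) × toℕ (head b) ≤ toℕ (head a) × tail a ≢ head b × head a ≢ tail b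

  -- Disjoint intervals would form the matching complementary to a crossing pair of type `HTTH` or
  -- `THHT`, which is an edge.
  opposite-crossing : ∀ {a b} → Forward a → Forward (swap b) → E a b ≡ true → Crossing a b
  opposite-crossing {t , h} {t′ , h′} t<h h′<t′ e = ≮⇒≥ t′≮t , ≮⇒≥ h≮h′ , t≢h′ , h≢t′
    where
    t≢h′ : t ≢ h′
    t≢h′ refl with () ← trans (sym e) (trans (symmetric _ _) (touching (≢-sym (toℕ-<⇒≢ h′<t′)) (toℕ-<⇒≢ t<h)))
    h≢t′ : h ≢ t′
    h≢t′ refl with () ← trans (sym e) (touching (toℕ-<⇒≢ t<h) (≢-sym (toℕ-<⇒≢ h′<t′)))
    t′≮t : ¬ toℕ t′ < toℕ t
    t′≮t l = not-true
      (exchange (≢-sym (toℕ-<⇒≢ l)) (≢-sym (toℕ-<⇒≢ (<-trans h′<t′ (<-trans l t<h)))) (toℕ-<⇒≢ t<h) t≢h′ (≢-sym h≢t′)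
        (≢-sym (toℕ-<⇒≢ h′<t′)))
      (proj₂ (proj₂ (proj₂ (revlex h′ t′ t h h′<t′ l t<h)))) e
    h≮h′ : ¬ toℕ h < toℕ h′
    h≮h′ l = not-true
      (exchange (toℕ-<⇒≢ (<-trans t<h (<-trans l h′<t′))) (toℕ-<⇒≢ l) (toℕ-<⇒≢ t<h) t≢h′ (≢-sym h≢t′)
        (≢-sym (toℕ-<⇒≢ h′<t′)))
      (proj₁ (proj₂ (proj₂ (revlex t h h′ t′ t<h l h′<t′)))) e

  -- Apart from a common tail or head, the four ways in which the intervals can overlap are exactly
  -- the four patterns of the revlex rule.
  opposite-edge : ∀ {a b} → Forward a → Forward (swap b) → Crossing a b → E a b ≡ true
  opposite-edge {t , h} {t′ , h′} t<h h′<t′ (t≤t′ , h′≤h , t≢h′ , h≢t′)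
    with m≤n⇒m<n∨m≡n t≤t′ | m≤n⇒m<n∨m≡n h′≤h
  ... | inj₂ eq | _ with refl ← Fin.toℕ-injective eq =
    sharedTail (toℕ-<⇒≢ t<h) t≢h′ (≢-sym (toℕ-<⇒≢ (<-trans h′<t′ t<h)))
  ... | inj₁ t<t′ | inj₂ eq with refl ← Fin.toℕ-injective eq =
    sharedHead t≢h′ (≢-sym h≢t′) (toℕ-<⇒≢ t<t′)
  opposite-edge {t , h} {t′ , h′} t<h h′<t′ (t≤t′ , h′≤h , t≢h′ , h≢t′) | inj₁ t<t′ | inj₁ h′<h
    with <-cmp (toℕ t) (toℕ h′) | <-cmp (toℕ h) (toℕ t′)
  ... | tri≈ _ eq _ | _ = ⊥-elim (t≢h′ (Fin.toℕ-injective eq))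
  ... | tri< _ _ _ | tri≈ _ eq _ = ⊥-elim (h≢t′ (Fin.toℕ-injective eq))
  ... | tri> _ _ _ | tri≈ _ eq _ = ⊥-elim (h≢t′ (Fin.toℕ-injective eq))
  ... | tri< t<h′ _ _ | tri< h<t′ _ _ = proj₁ (proj₂ (proj₂ (revlex t h′ h t′ t<h′ h′<h h<t′)))
  ... | tri< t<h′ _ _ | tri> _ _ t′<h = proj₁ (revlex t h′ t′ h t<h′ h′<t′ t′<h)
  ... | tri> _ _ h′<t | tri< h<t′ _ _ = trans (symmetric _ _) (proj₁ (proj₂ (revlex h′ t h t′ h′<t t<h h<t′)))
  ... | tri> _ _ h′<t | tri> _ _ t′<h = trans (symmetric _ _) (proj₂ (proj₂ (proj₂ (revlex h′ t t′ h h′<t t<t′ t′<h))))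

-- Faces as pairs of lists of lower and upper ends

ends : ∀ {n} → Pt n → Pair
ends a = toℕ (tail a) , toℕ (head a)

ends-injective : ∀ {n} {a b : Pt n} → ends a ≡ ends b → a ≡ b
ends-injective e = cong₂ _,_ (Fin.toℕ-injective (cong lo e)) (Fin.toℕ-injective (cong hi e))

forward?-true : ∀ {n} (a : Pt n) → forward? a ≡ true → Forward a
forward?-true a e = <ᵇ⇒< _ _ (Equivalence.from T-≡ e)

true-forward? : ∀ {n} (a : Pt n) → Forward a → forward? a ≡ true
true-forward? a l = Equivalence.to T-≡ (<⇒<ᵇ l)

-- A backward arrow is recorded through its reversal, so that both halves of a face consist of pairs
-- with `lo` below `hi`.
forwards backwards : ∀ {n} → List (Pt n) → List Pair
forwards S = map ends (select forward? S)
backwards S = forwards (map swap S)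

countB-map : ∀ {A B : Set} (f : A → B) (p : B → Bool) xs → countB p (map f xs) ≡ countB (p ∘ f) xs
countB-map f p [] = refl
countB-map f p (x ∷ xs) = cong (_ +_) (countB-map f p xs)

module _ {n : ℕ} where

  ∈-forwards⁺ : ∀ {S : List (Pt n)} {a} → a ∈ S → Forward a → ends a ∈ forwards S
  ∈-forwards⁺ {a = a} m l = ∈-map⁺ ends (∈-filter⁺ (λ x → forward? x ≟ᵇ true) m (true-forward? a l))

  ∈-forwards⁻ : ∀ {S : List (Pt n)} {p} → p ∈ forwards S → ∃ λ a → a ∈ S × Forward a × p ≡ ends a
  ∈-forwards⁻ {S} m with ∈-map⁻ ends m
  ... | a , q , e with ∈-filter⁻ (λ x → forward? x ≟ᵇ true) {xs = S} q
  ...   | a∈ , f = a , a∈ , forward?-true a f , e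

  ∈-backwards⁺ : ∀ {S : List (Pt n)} {a} → a ∈ S → Forward (swap a) → ends (swap a) ∈ backwards S
  ∈-backwards⁺ m = ∈-forwards⁺ (∈-map⁺ swap m)

  ∈-backwards⁻ : ∀ {S : List (Pt n)} {p} → p ∈ backwards S → ∃ λ a → a ∈ S × Forward (swap a) × p ≡ ends (swap a)
  ∈-backwards⁻ {S} m with ∈-forwards⁻ {map swap S} m
  ... | b , q , l , e with ∈-map⁻ swap q
  ...   | a , a∈ , refl = a , a∈ , l , e

  length-forwards : ∀ (S : List (Pt n)) → length (forwards S) ≡ countB forward? S
  length-forwards S = trans (length-map ends (select forward? S)) (sym (countB≡length-filter forward? S))

  length-backwards : ∀ (S : List (Pt n)) → length (backwards S) ≡ countB backward? S
  length-backwards S = trans (length-forwards (map swap S)) (countB-map swap forward? S)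

  forwards-unique : ∀ {S : List (Pt n)} → Unique S → Unique (forwards S)
  forwards-unique u = Unique.map⁺ ends-injective (Unique.filter⁺ (λ x → forward? x ≟ᵇ true) u)

  backwards-unique : ∀ {S : List (Pt n)} → Unique S → Unique (backwards S)
  backwards-unique u = forwards-unique (Unique.map⁺ (cong swap) u)

  forwards-bounded : ∀ (S : List (Pt n)) → Bounded n (forwards S)
  forwards-bounded S m with ∈-forwards⁻ {S} m
  ... | a , _ , _ , refl = ≤-pred (Fin.toℕ<n (head a))

  backwards-bounded : ∀ (S : List (Pt n)) → Bounded n (backwards S)
  backwards-bounded S = forwards-bounded (map swap S)

  direction : ∀ (a : Pt n) → IsArrow a → Forward a ⊎ Forward (swap a)
  direction a ne with <-cmp (toℕ (tail a)) (toℕ (head a))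
  ... | tri< l _ _ = inj₁ l
  ... | tri≈ _ e _ = ⊥-elim (ne (Fin.toℕ-injective e))
  ... | tri> _ _ l = inj₂ l

record Clique (α β : Bool) (n : ℕ) (P Q : List Pair) : Set where
  field
    unique₁ : Unique P
    unique₂ : Unique Q
    compatible₁ : Compatible α P
    compatible₂ : Compatible β Q
    cross : CrossCompatible P Q
    bounded₁ : Bounded n P
    bounded₂ : Bounded n Q

Cliquewise : ∀ {n} → Graph n → List (Pt n) → Set
Cliquewise E S = ∀ {a b} → a ∈ S → b ∈ S → a ≢ b → E a b ≡ true

face-compatible : ∀ {n α β} {E : Graph n} → Rules E α β → ∀ {S} → Cliquewise E S → Compatible α (forwards S)
face-compatible {α = α} {E = E} r {S} edge = record { lo<hi = lo<hi ; chain = chain }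
  where
  open Compatibility r
  lo<hi : ∀ {p q} → p ∈ forwards S → q ∈ forwards S → lo p < hi q
  lo<hi m k with ∈-forwards⁻ {S = S} m | ∈-forwards⁻ {S = S} k
  ... | a , a∈ , fa , refl | b , b∈ , fb , refl with ends a ≟ᵖ ends b
  ...   | yes e = subst (λ z → toℕ (tail a) < z) (cong hi e) fa
  ...   | no ne = forward-lo<hi fa fb (edge a∈ b∈ (ne ∘ cong ends))
  chain : Chain α (forwards S)
  chain m k l with ∈-forwards⁻ {S = S} m | ∈-forwards⁻ {S = S} k
  ... | a , a∈ , fa , refl | b , b∈ , fb , refl =
    forward-chain fa fb (edge a∈ b∈ λ { refl → <-irrefl refl l }) l

reversed-cliquewise : ∀ {n} {E : Graph n} {S} → Cliquewise E S → Cliquewise (reversed E) (map swap S)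
reversed-cliquewise edge m k ne with ∈-map⁻ swap m | ∈-map⁻ swap k
... | a , a∈ , refl | b , b∈ , refl = edge a∈ b∈ (ne ∘ cong swap)

selected : ∀ {n} → List Pair → List Pair → Pt n → Bool
selected P Q a = Dec.does (DM._∈?_ _≟ᵖ_ (ends a) P) ∨ Dec.does (DM._∈?_ _≟ᵖ_ (ends (swap a)) Q)

-- Formed by filtering `arrows n`, so that the result is literally one of the listed sublists.
arrowSet : (n : ℕ) → List Pair → List Pair → List (Pt n)
arrowSet n P Q = select (selected P Q) (arrows n)

selected⁻ : ∀ {n} P Q (a : Pt n) → selected P Q a ≡ true → ends a ∈ P ⊎ ends (swap a) ∈ Q
selected⁻ P Q a e with DM._∈?_ _≟ᵖ_ (ends a) P | DM._∈?_ _≟ᵖ_ (ends (swap a)) Q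
... | yes m | _ = inj₁ m
... | no _ | yes m = inj₂ m

selected⁺ˡ : ∀ {n} P Q (a : Pt n) → ends a ∈ P → selected P Q a ≡ true
selected⁺ˡ P Q a m with DM._∈?_ _≟ᵖ_ (ends a) P
... | yes _ = refl
... | no ne = ⊥-elim (ne m)

selected⁺ʳ : ∀ {n} P Q (a : Pt n) → ends (swap a) ∈ Q → selected P Q a ≡ true
selected⁺ʳ P Q a m with DM._∈?_ _≟ᵖ_ (ends (swap a)) Q
... | yes _ = ∨-zeroʳ _
... | no ne = ⊥-elim (ne m)

∈-arrowSet⁻ : ∀ {n} P Q {a} → a ∈ arrowSet n P Q → IsArrow a × (ends a ∈ P ⊎ ends (swap a) ∈ Q)
∈-arrowSet⁻ {n} P Q {a} m with ∈-filter⁻ (λ x → selected P Q x ≟ᵇ true) {xs = arrows n} m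
... | a∈ , e = ∈-arrows⁻ n a∈ , selected⁻ P Q a e

∈-arrowSet⁺ : ∀ {n} P Q {a} → IsArrow a → selected P Q a ≡ true → a ∈ arrowSet n P Q
∈-arrowSet⁺ {n} P Q ne e = ∈-filter⁺ (λ x → selected P Q x ≟ᵇ true) (∈-arrows⁺ n ne) e

toArrow : ∀ {n} {p : Pair} → lo p < hi p → hi p ≤ n → ∃ λ (a : Pt n) → Forward a × p ≡ ends a
toArrow {n} {x , y} x<y y≤n = (fromℕ< x≤ , fromℕ< (s≤s y≤n)) ,
  subst₂ _<_ (sym (Fin.toℕ-fromℕ< x≤)) (sym (Fin.toℕ-fromℕ< (s≤s y≤n))) x<y ,
  cong₂ _,_ (sym (Fin.toℕ-fromℕ< x≤)) (sym (Fin.toℕ-fromℕ< (s≤s y≤n)))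
  where
  x≤ : x < suc n
  x≤ = <-trans x<y (s≤s y≤n)

arrowSet-unique : ∀ n P Q → Unique (arrowSet n P Q)
arrowSet-unique n P Q = Unique.filter⁺ (λ x → selected P Q x ≟ᵇ true) (arrows-unique n)

unique-⇔⇒length≡ : ∀ {A : Set} {xs ys : List A} → Unique xs → Unique ys →
  (∀ {x} → x ∈ xs → x ∈ ys) → (∀ {x} → x ∈ ys → x ∈ xs) → length xs ≡ length ys
unique-⇔⇒length≡ u v f g = ≤-antisym (unique-⊆⇒length≤ u f) (unique-⊆⇒length≤ v g)

isFacet : ∀ {n} → Graph n → ℕ → ℕ → List (Pt n) → Bool
isFacet E i j S = isFace E S ∧ (countB forward? S ≡ᵇ i) ∧ (countB backward? S ≡ᵇ j)

≡ᵇ-true : ∀ {m n} → (m ≡ᵇ n) ≡ true → m ≡ n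
≡ᵇ-true {m} {n} e = ≡ᵇ⇒≡ m n (Equivalence.from T-≡ e)

true-≡ᵇ : ∀ {m n} → m ≡ n → (m ≡ᵇ n) ≡ true
true-≡ᵇ {m} {n} e = Equivalence.to T-≡ (≡⇒≡ᵇ m n e)

module _ {n α β P Q} (c : Clique α β n P Q) where
  open Clique c

  forwards-arrowSet⊆ : forwards (arrowSet n P Q) ⊆ₚ P
  forwards-arrowSet⊆ m with ∈-forwards⁻ {S = arrowSet n P Q} m
  ... | a , a∈ , fa , refl with ∈-arrowSet⁻ P Q a∈
  ...   | _ , inj₁ q = q
  ...   | _ , inj₂ q = ⊥-elim (<-asym fa (Compatible.lo<hi compatible₂ q q))

  forwards-arrowSet⊇ : P ⊆ₚ forwards (arrowSet n P Q)
  forwards-arrowSet⊇ {p} m with toArrow (Compatible.lo<hi compatible₁ m m) (bounded₁ m)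
  ... | a , fa , refl = ∈-forwards⁺ (∈-arrowSet⁺ P Q (toℕ-<⇒≢ fa) (selected⁺ˡ P Q a m)) fa

  backwards-arrowSet⊆ : backwards (arrowSet n P Q) ⊆ₚ Q
  backwards-arrowSet⊆ m with ∈-backwards⁻ {S = arrowSet n P Q} m
  ... | a , a∈ , fa , refl with ∈-arrowSet⁻ P Q a∈
  ...   | _ , inj₁ q = ⊥-elim (<-asym fa (Compatible.lo<hi compatible₁ q q))
  ...   | _ , inj₂ q = q

  backwards-arrowSet⊇ : Q ⊆ₚ backwards (arrowSet n P Q)
  backwards-arrowSet⊇ {p} m with toArrow (Compatible.lo<hi compatible₂ m m) (bounded₂ m)
  ... | a , fa , refl = ∈-backwards⁺ (∈-arrowSet⁺ P Q (≢-sym (toℕ-<⇒≢ fa)) (selected⁺ʳ P Q (swap a) m)) fa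

  arrowSet-forwards : countB forward? (arrowSet n P Q) ≡ length P
  arrowSet-forwards = trans (sym (length-forwards (arrowSet n P Q)))
    (unique-⇔⇒length≡ (forwards-unique (arrowSet-unique n P Q)) unique₁ forwards-arrowSet⊆ forwards-arrowSet⊇)

  arrowSet-backwards : countB backward? (arrowSet n P Q) ≡ length Q
  arrowSet-backwards = trans (sym (length-backwards (arrowSet n P Q)))
    (unique-⇔⇒length≡ (backwards-unique (arrowSet-unique n P Q)) unique₂ backwards-arrowSet⊆ backwards-arrowSet⊇)

  arrowSet-edges : ∀ {E : Graph n} → Rules E α β → Cliquewise E (arrowSet n P Q)
  arrowSet-edges {E} r {a} {b} m k ne = by (proj₂ (∈-arrowSet⁻ P Q m)) (proj₂ (∈-arrowSet⁻ P Q k))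
    where
    module C = Compatibility r
    module C° = Compatibility (reversed-rules r)
    crossing : ∀ {a b} → ends a ∈ P → ends (swap b) ∈ Q → E a b ≡ true
    crossing p q with cross p q
    ... | l₁ , l₂ , n₁ , n₂ = C.opposite-edge (Compatible.lo<hi compatible₁ p p) (Compatible.lo<hi compatible₂ q q)
      (l₁ , l₂ , n₁ ∘ cong toℕ , n₂ ∘ cong toℕ)
    by : ends a ∈ P ⊎ ends (swap a) ∈ Q → ends b ∈ P ⊎ ends (swap b) ∈ Q → E a b ≡ true
    by (inj₁ p) (inj₁ q) = C.forward-edge ne (lo<hi p p) (lo<hi q q) (lo<hi p q) (lo<hi q p) (chain p q) (chain q p)
      where open Compatible compatible₁
    by (inj₂ p) (inj₂ q) = C°.forward-edge (ne ∘ cong swap) (lo<hi p p) (lo<hi q q) (lo<hi p q) (lo<hi q p) (chain p q) (chain q p)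
      where open Compatible compatible₂
    by (inj₁ p) (inj₂ q) = crossing p q
    by (inj₂ p) (inj₁ q) = trans (Rules.symmetric r a b) (crossing q p)

  arrowSet-facet : ∀ {E : Graph n} → Rules E α β → ∀ {i j} → length P ≡ i → length Q ≡ j →
    isFacet E i j (arrowSet n P Q) ≡ true
  arrowSet-facet r e f = cong₂ _∧_ (isFace⇐ (arrowSet-unique n P Q) (arrowSet-edges r))
    (cong₂ _∧_ (true-≡ᵇ (trans arrowSet-forwards e)) (true-≡ᵇ (trans arrowSet-backwards f)))

record FacetData {n} (α β : Bool) (i j : ℕ) (S : List (Pt n)) : Set where
  field
    clique : Clique α β n (forwards S) (backwards S)
    count₁ : length (forwards S) ≡ i
    count₂ : length (backwards S) ≡ j

facet-data : ∀ {n α β} {E : Graph n} → Rules E α β → ∀ {i j S} → S ∈ sublists (arrows n) →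
  isFacet E i j S ≡ true → FacetData α β i j S
facet-data {n} {α} {β} {E} r {i} {j} {S} S∈ e = record
  { clique = record
    { unique₁ = forwards-unique uS
    ; unique₂ = backwards-unique uS
    ; compatible₁ = face-compatible r edge
    ; compatible₂ = face-compatible (reversed-rules r) (reversed-cliquewise edge)
    ; cross = crosses
    ; bounded₁ = forwards-bounded S
    ; bounded₂ = backwards-bounded S }
  ; count₁ = trans (length-forwards S) (≡ᵇ-true (proj₁ counts))
  ; count₂ = trans (length-backwards S) (≡ᵇ-true (proj₂ counts)) }
  where
  uS : Unique S
  uS = ∈-sublists⇒unique (arrows-unique n) S∈
  edge : Cliquewise E S
  edge = isFace⇒ (Rules.symmetric r) (proj₁ (∧-true e))
  counts : (countB forward? S ≡ᵇ i) ≡ true × (countB backward? S ≡ᵇ j) ≡ true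
  counts = ∧-true (proj₂ (∧-true {isFace E S} e))
  crosses : CrossCompatible (forwards S) (backwards S)
  crosses m k with ∈-forwards⁻ {S = S} m | ∈-backwards⁻ {S = S} k
  ... | a , a∈ , fa , refl | b , b∈ , fb , refl
    with Compatibility.opposite-crossing r fa fb (edge a∈ b∈ λ { refl → <-asym fa fb })
  ...   | l₁ , l₂ , n₁ , n₂ = l₁ , l₂ , n₁ ∘ Fin.toℕ-injective , n₂ ∘ Fin.toℕ-injective

≡arrowSet : ∀ {n S P Q} → S ∈ sublists (arrows n) →
  forwards S ⊆ₚ P → P ⊆ₚ forwards S → backwards S ⊆ₚ Q → Q ⊆ₚ backwards S → S ≡ arrowSet n P Q
≡arrowSet {n} {S} {P} {Q} S∈ f f′ b b′ = sublist≡select (selected P Q) (arrows-unique n) S∈ to from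
  where
  to : ∀ {a} → a ∈ S → selected P Q a ≡ true
  to {a} m with direction a (∈-arrows⁻ n (∈-sublists⇒⊆ S∈ m))
  ... | inj₁ l = selected⁺ˡ P Q a (f (∈-forwards⁺ m l))
  ... | inj₂ l = selected⁺ʳ P Q a (b (∈-backwards⁺ m l))
  from : ∀ {a} → a ∈ arrows n → selected P Q a ≡ true → a ∈ S
  from {a} _ e with selected⁻ P Q a e
  ... | inj₁ p with ∈-forwards⁻ {S = S} (f′ p)
  ...   | a′ , a′∈ , _ , eq = subst (_∈ S) (sym (ends-injective eq)) a′∈
  from {a} _ e | inj₂ q with ∈-backwards⁻ {S = S} (b′ q)
  ...   | a′ , a′∈ , _ , eq = subst (_∈ S) (sym (cong swap (ends-injective eq))) a′∈

module _ {n α β} {E : Graph n} (r : Rules E α β) where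

  -- Transfers the count from faces to any enumeration by codes: all conditions are on lists of
  -- pairs up to mutual inclusion, with no reference to `E`. The mixed count and the two pure counts
  -- are instances.
  count-facets : ∀ {B : Set} {i j} (codes : List B) (P Q : B → List Pair) → Unique codes →
    (∀ {x} → x ∈ codes → Clique α β n (P x) (Q x)) →
    (∀ {x} → x ∈ codes → length (P x) ≡ i × length (Q x) ≡ j) →
    (∀ {x y} → x ∈ codes → y ∈ codes → P x ⊆ₚ P y → P y ⊆ₚ P x → Q x ⊆ₚ Q y → Q y ⊆ₚ Q x → x ≡ y) →
    (∀ {F G} → Clique α β n F G → length F ≡ i → length G ≡ j →
      ∃ λ x → x ∈ codes × (F ⊆ₚ P x × P x ⊆ₚ F) × (G ⊆ₚ Q x × Q x ⊆ₚ G)) →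
    fvec E i j ≡ length codes
  count-facets {i = i} {j} codes P Q uniq clique sizes inj onto =
    countB-bijection {p = isFacet E i j} (λ x → arrowSet n (P x) (Q x)) (sublists-unique (arrows-unique n)) uniq
      (λ m k e → inj m k
        (λ q → forwards-arrowSet⊆ (clique k) (subst (λ S → _ ∈ forwards S) e (forwards-arrowSet⊇ (clique m) q)))
        (λ q → forwards-arrowSet⊆ (clique m) (subst (λ S → _ ∈ forwards S) (sym e) (forwards-arrowSet⊇ (clique k) q)))
        (λ q → backwards-arrowSet⊆ (clique k) (subst (λ S → _ ∈ backwards S) e (backwards-arrowSet⊇ (clique m) q)))
        (λ q → backwards-arrowSet⊆ (clique m) (subst (λ S → _ ∈ backwards S) (sym e) (backwards-arrowSet⊇ (clique k) q))))
      (λ {x} m → select∈sublists (selected (P x) (Q x)) (arrows n) ,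
        arrowSet-facet (clique m) r (proj₁ (sizes m)) (proj₂ (sizes m)))
      λ S∈ e → let open FacetData (facet-data r S∈ e) renaming (clique to c)
                   (x , x∈ , (f , f′) , (b , b′)) = onto c count₁ count₂
               in x , x∈ , ≡arrowSet S∈ f f′ b b′

-- Counting

module _ {A : Set} where

  four : A → A → A → A → Fin 4 → A
  four a b c d zero = a
  four a b c d (suc zero) = b
  four a b c d (suc (suc zero)) = c
  four a b c d (suc (suc (suc zero))) = d

Increasing : ∀ {n} → (Fin 4 → Fin (suc n)) → Set
Increasing p = ∀ {s t} → toℕ s < toℕ t → toℕ (p s) < toℕ (p t)

four-increasing : ∀ {n} {a b c d : Fin (suc n)} → toℕ a < toℕ b → toℕ b < toℕ c → toℕ c < toℕ d →
  Increasing (four a b c d)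
four-increasing ab bc cd {zero} {zero} ()
four-increasing ab bc cd {zero} {suc zero} _ = ab
four-increasing ab bc cd {zero} {suc (suc zero)} _ = <-trans ab bc
four-increasing ab bc cd {zero} {suc (suc (suc zero))} _ = <-trans ab (<-trans bc cd)
four-increasing ab bc cd {suc zero} {suc zero} (s≤s ())
four-increasing ab bc cd {suc zero} {suc (suc zero)} _ = bc
four-increasing ab bc cd {suc zero} {suc (suc (suc zero))} _ = <-trans bc cd
four-increasing ab bc cd {suc (suc zero)} {suc zero} (s≤s ())
four-increasing ab bc cd {suc (suc zero)} {suc (suc zero)} (s≤s (s≤s ()))
four-increasing ab bc cd {suc (suc zero)} {suc (suc (suc zero))} _ = cd
four-increasing ab bc cd {suc (suc (suc zero))} {suc zero} (s≤s ())
four-increasing ab bc cd {suc (suc (suc zero))} {suc (suc zero)} (s≤s (s≤s ()))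
four-increasing ab bc cd {suc (suc (suc zero))} {suc (suc (suc zero))} (s≤s (s≤s (s≤s ())))

increasing-reflects : ∀ {n} {p : Fin 4 → Fin (suc n)} → Increasing p → ∀ {s t} → toℕ (p s) < toℕ (p t) → toℕ s < toℕ t
increasing-reflects inc {s} {t} l with <-cmp (toℕ s) (toℕ t)
... | tri< l′ _ _ = l′
... | tri≈ _ e _ with refl ← Fin.toℕ-injective e = ⊥-elim (<-irrefl refl l)
... | tri> _ _ l′ = ⊥-elim (<-asym l (inc l′))

module _ {n : ℕ} {E : Graph n} (uni : Uniform E) where

  -- `σ` tells which of four increasing points each entry of `quad` is, so two pairs with the same
  -- `σ` have the same order type.
  same-edge : ∀ {p q : Fin 4 → Fin (suc n)} (σ : Fin 4 → Fin 4) {a b a′ b′} → Increasing p → Increasing q →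
    IsArrow a → IsArrow b → IsArrow a′ → IsArrow b′ →
    (∀ s → quad a b s ≡ p (σ s)) → (∀ s → quad a′ b′ s ≡ q (σ s)) → E a b ≡ E a′ b′
  same-edge {p} {q} σ ip iq ha hb ha′ hb′ e e′ = uni _ _ _ _ ha hb ha′ hb′ λ s t → mk⇔
    (λ l → subst₂ _<_ (cong toℕ (sym (e′ s))) (cong toℕ (sym (e′ t)))
      (iq (increasing-reflects {p = p} ip (subst₂ _<_ (cong toℕ (e s)) (cong toℕ (e t)) l))))
    (λ l → subst₂ _<_ (cong toℕ (sym (e s))) (cong toℕ (sym (e t)))
      (ip (increasing-reflects {p = q} iq (subst₂ _<_ (cong toℕ (e′ s)) (cong toℕ (e′ t)) l))))

  module _ {p₁ p₂ p₃ p₄ q₁ q₂ q₃ q₄ : Fin (suc n)}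
           (p₁₂ : toℕ p₁ < toℕ p₂) (p₂₃ : toℕ p₂ < toℕ p₃) (p₃₄ : toℕ p₃ < toℕ p₄)
           (q₁₂ : toℕ q₁ < toℕ q₂) (q₂₃ : toℕ q₂ < toℕ q₃) (q₃₄ : toℕ q₃ < toℕ q₄) where

    private
      p = four p₁ p₂ p₃ p₄
      q = four q₁ q₂ q₃ q₄
      p₁₄ = toℕ-<⇒≢ (<-trans p₁₂ (<-trans p₂₃ p₃₄))
      q₁₄ = toℕ-<⇒≢ (<-trans q₁₂ (<-trans q₂₃ q₃₄))

    forward-nests : E (p₁ , p₄) (p₂ , p₃) ≡ E (q₁ , q₄) (q₂ , q₃)
    forward-nests = same-edge {p} {q} (four zero (suc zero) (suc (suc (suc zero))) (suc (suc zero)))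
      (four-increasing p₁₂ p₂₃ p₃₄) (four-increasing q₁₂ q₂₃ q₃₄)
      p₁₄ (toℕ-<⇒≢ p₂₃) q₁₄ (toℕ-<⇒≢ q₂₃)
      (λ { zero → refl ; (suc zero) → refl ; (suc (suc zero)) → refl ; (suc (suc (suc zero))) → refl })
      (λ { zero → refl ; (suc zero) → refl ; (suc (suc zero)) → refl ; (suc (suc (suc zero))) → refl })

    backward-nests : E (p₄ , p₁) (p₃ , p₂) ≡ E (q₄ , q₁) (q₃ , q₂)
    backward-nests = same-edge {p} {q} (four (suc (suc (suc zero))) (suc (suc zero)) zero (suc zero))
      (four-increasing p₁₂ p₂₃ p₃₄) (four-increasing q₁₂ q₂₃ q₃₄)
      (≢-sym p₁₄) (≢-sym (toℕ-<⇒≢ p₂₃)) (≢-sym q₁₄) (≢-sym (toℕ-<⇒≢ q₂₃))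
      (λ { zero → refl ; (suc zero) → refl ; (suc (suc zero)) → refl ; (suc (suc (suc zero))) → refl })
      (λ { zero → refl ; (suc zero) → refl ; (suc (suc zero)) → refl ; (suc (suc (suc zero))) → refl })

NestRules : ∀ {n} → Graph n → Bool → Bool → Set
NestRules E α β = ∀ {p₁ p₂ p₃ p₄} → toℕ p₁ < toℕ p₂ → toℕ p₂ < toℕ p₃ → toℕ p₃ < toℕ p₄ →
  E (p₁ , p₄) (p₂ , p₃) ≡ α × E (p₄ , p₁) (p₃ , p₂) ≡ β

four-points : ∀ {n} {p₁ p₂ p₃ p₄ : Fin (suc n)} → toℕ p₁ < toℕ p₂ → toℕ p₂ < toℕ p₃ → toℕ p₃ < toℕ p₄ → 3 ≤ n
four-points {p₄ = p₄} l₁ l₂ l₃ = ≤-trans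
  (≤-trans (s≤s (≤-trans (s≤s (≤-trans (s≤s z≤n) l₁)) l₂)) l₃) (≤-pred (Fin.toℕ<n p₄))

-- Uniformity lets the two values be read off at the four smallest endpoints. With fewer than four
-- endpoints the rules are vacuous and the value `true` is arbitrary.
nest-rules : ∀ {n} {E : Graph n} → Uniform E → ∃₂ λ α β → NestRules E α β
nest-rules {suc (suc (suc n))} {E} uni =
  E (v₀ , v₃) (v₁ , v₂) , E (v₃ , v₀) (v₂ , v₁) , λ l₁ l₂ l₃ →
    forward-nests uni l₁ l₂ l₃ 0<1 1<2 2<3 , backward-nests uni l₁ l₂ l₃ 0<1 1<2 2<3
  where
  v₀ v₁ v₂ v₃ : Fin (suc (suc (suc (suc n))))
  v₀ = zero
  v₁ = suc zero
  v₂ = suc (suc zero)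
  v₃ = suc (suc (suc zero))
  0<1 : toℕ v₀ < toℕ v₁
  0<1 = s≤s z≤n
  1<2 : toℕ v₁ < toℕ v₂
  1<2 = s≤s (s≤s z≤n)
  2<3 : toℕ v₂ < toℕ v₃
  2<3 = s≤s (s≤s (s≤s z≤n))
nest-rules {zero} _ = true , true , λ l₁ l₂ l₃ → ⊥-elim (absurd (four-points l₁ l₂ l₃))
  where
  absurd : ¬ 3 ≤ 0
  absurd ()
nest-rules {suc zero} _ = true , true , λ l₁ l₂ l₃ → ⊥-elim (absurd (four-points l₁ l₂ l₃))
  where
  absurd : ¬ 3 ≤ 1
  absurd (s≤s ())
nest-rules {suc (suc zero)} _ = true , true , λ l₁ l₂ l₃ → ⊥-elim (absurd (four-points l₁ l₂ l₃))
  where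
  absurd : ¬ 3 ≤ 2
  absurd (s≤s (s≤s ()))

revlexUFT-rules : ∀ {n} {E : Graph (suc n)} → RevlexUFT E → ∃₂ λ α β → Rules E α β
revlexUFT-rules {n} {E} (sy , uni , tri , rev) with nest-rules uni
... | α , β , nest = α , β , record
  { symmetric = sy
  ; touching = touching-nonedge
  ; sharedTail = shared-tail
  ; sharedHead = shared-head
  ; exchange = flip
  ; revlex = rev
  ; nestForward = λ l₁ l₂ l₃ → proj₁ (nest l₁ l₂ l₃)
  ; nestBackward = λ l₁ l₂ l₃ → proj₂ (nest l₁ l₂ l₃) }
  where open FlagRules E sy tri

-- The facet numbers

some-element : ∀ {A : Set} {xs : List A} → 1 ≤ length xs → ∃ λ x → x ∈ xs
some-element {xs = x ∷ xs} _ = x , here refl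

clique-code : ∀ {n α β F G} → Clique α β n F G → 1 ≤ length F → 1 ≤ length G → length F + length G ≡ n →
  ∃ λ x → x ∈ codes (length F) (length G)
    × (F ⊆ₚ side α true (proj₁ x) (proj₁ (proj₂ x)) × side α true (proj₁ x) (proj₁ (proj₂ x)) ⊆ₚ F)
    × (G ⊆ₚ side β false (proj₁ x) (proj₂ (proj₂ x)) × side β false (proj₁ x) (proj₂ (proj₂ x)) ⊆ₚ G)
clique-code {n} {α} {β} {F} {G} c 1≤F 1≤G e = encode
  (sides-onto {α} {β} {n} {F} {G} unique₁ unique₂ compatible₁ compatible₂ cross bounded₁ bounded₂ e
    (proj₂ (some-element 1≤F)) (proj₂ (some-element 1≤G)))
  where
  open Clique c
  encode : (∃ λ φ → ∃₂ λ u v → Valid (length F) (length G) (φ , u , v)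
      × (F ⊆ₚ side α true φ u × side α true φ u ⊆ₚ F) × (G ⊆ₚ side β false φ v × side β false φ v ⊆ₚ G)) →
    ∃ λ x → x ∈ codes (length F) (length G)
      × (F ⊆ₚ side α true (proj₁ x) (proj₁ (proj₂ x)) × side α true (proj₁ x) (proj₁ (proj₂ x)) ⊆ₚ F)
      × (G ⊆ₚ side β false (proj₁ x) (proj₂ (proj₂ x)) × side β false (proj₁ x) (proj₂ (proj₂ x)) ⊆ₚ G)
  encode (φ , u , v , valid , F~ , G~) = (φ , u , v) , ∈-codes⁺ (φ , u , v) valid , F~ , G~

module _ {n α β} {E : Graph n} (r : Rules E α β) where

  -- Positivity of `k` and `m` provides the arrow on each side from which `sides-onto` starts.
  mixed-facets : ∀ k m → 1 ≤ k → 1 ≤ m → k + m ≡ n → fvec E k m ≡ length (codes k m)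
  mixed-facets k m 1≤k 1≤m k+m = count-facets r (codes k m) P Q (codes-unique k m) clique sizes inj onto
    where
    P Q : Code → List Pair
    P (φ , u , v) = side α true φ u
    Q (φ , u , v) = side β false φ v
    size : ∀ {x} → x ∈ codes k m → length (word (proj₁ x)) ≡ suc n
    size x∈ = trans (valid-length (∈-codes⁻ k m x∈)) (cong suc k+m)
    clique : ∀ {x} → x ∈ codes k m → Clique α β n (P x) (Q x)
    clique {φ , u , v} x∈ = record
      { unique₁ = side-unique α true φ u
      ; unique₂ = side-unique β false φ v
      ; compatible₁ = side-compatible α true φ u
      ; compatible₂ = side-compatible β false φ v
      ; cross = sides-crossCompatible α β φ u v
      ; bounded₁ = λ q → ≤-pred (subst (_ <_) (size x∈) (proj₂ (proj₂ (proj₂ (side-between α true φ u q)))))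
      ; bounded₂ = λ q → ≤-pred (subst (_ <_) (size x∈) (proj₂ (proj₂ (proj₂ (side-between β false φ v q))))) }
    sizes : ∀ {x} → x ∈ codes k m → length (P x) ≡ k × length (Q x) ≡ m
    sizes {φ , u , v} x∈ = trans (length-side α true φ u fit₁) size₁ , trans (length-side β false φ v fit₂) size₂
      where open Valid (∈-codes⁻ k m x∈)
    inj : ∀ {x y} → x ∈ codes k m → y ∈ codes k m → P x ⊆ₚ P y → P y ⊆ₚ P x → Q x ⊆ₚ Q y → Q y ⊆ₚ Q x → x ≡ y
    inj {φ , u , v} {φ′ , u′ , v′} x∈ y∈ = sides-injective α β {φ} {φ′} {u} {u′} {v} {v′} (trans (size x∈) (sym (size y∈)))
      (Valid.fit₁ (∈-codes⁻ k m x∈)) (Valid.fit₂ (∈-codes⁻ k m x∈))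
      (Valid.fit₁ (∈-codes⁻ k m y∈)) (Valid.fit₂ (∈-codes⁻ k m y∈))
    onto : ∀ {F G} → Clique α β n F G → length F ≡ k → length G ≡ m →
      ∃ λ x → x ∈ codes k m × (F ⊆ₚ P x × P x ⊆ₚ F) × (G ⊆ₚ Q x × Q x ⊆ₚ G)
    onto c e f = subst₂ (λ k m → ∃ λ x → x ∈ codes k m × _) e f
      (clique-code c (subst (1 ≤_) (sym e) 1≤k) (subst (1 ≤_) (sym f) 1≤m) (trans (cong₂ _+_ e f) k+m))

module _ {n : ℕ} where

  pure-bounded : ∀ α d {u} → u ∈ allWords n → Bounded (suc n) (pureSide α d u)
  pure-bounded α d {u} m q = ≤-pred (subst (_ <_)
    (trans (pureFrame-length d (cnt true u) (cnt false u)) (cong (λ z → suc (suc z)) (trans (cnt-length u) (∈-allWords⁻ n m))))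
    (proj₂ (proj₂ (proj₂ (side-between α d (pureFrame d (cnt true u) (cnt false u)) u q)))))

  pure-size : ∀ α d {u} → u ∈ allWords n → length (pureSide α d u) ≡ suc n
  pure-size α d {u} m = trans (pureSide-length α d u) (cong suc (∈-allWords⁻ n m))

  pure-onto : ∀ α d {F} → Unique F → Compatible α F → Bounded (suc n) F → length F ≡ suc n →
    ∃ λ u → u ∈ allWords n × F ⊆ₚ pureSide α d u × pureSide α d u ⊆ₚ F
  pure-onto α d {F} uF cF bF e = index (pureSide-onto α d uF cF bF e (proj₂ (some-element (subst (1 ≤_) (sym e) (s≤s z≤n)))))
    where
    index : (∃ λ u → suc (length u) ≡ suc n × F ⊆ₚ pureSide α d u × pureSide α d u ⊆ₚ F) →
      ∃ λ u → u ∈ allWords n × F ⊆ₚ pureSide α d u × pureSide α d u ⊆ₚ F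
    index (u , eu , F~) = u , subst (λ z → u ∈ allWords z) (suc-injective eu) (∈-allWords⁺ u) , F~

  same-length : ∀ {u u′} → u ∈ allWords n → u′ ∈ allWords n → length u ≡ length u′
  same-length m m′ = trans (∈-allWords⁻ n m) (sym (∈-allWords⁻ n m′))

  module _ {α β} {E : Graph (suc n)} (r : Rules E α β) where

    forward-facets : fvec E (suc n) 0 ≡ length (allWords n)
    forward-facets = count-facets r (allWords n) (pureSide α true) (λ _ → []) (allWords-unique n)
      (λ {u} m → record
        { unique₁ = side-unique α true (pureFrame true (cnt true u) (cnt false u)) u
        ; unique₂ = []
        ; compatible₁ = side-compatible α true (pureFrame true (cnt true u) (cnt false u)) u
        ; compatible₂ = record { lo<hi = λ () ; chain = λ () }
        ; cross = λ _ ()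
        ; bounded₁ = pure-bounded α true m
        ; bounded₂ = λ () })
      (λ m → pure-size α true m , refl)
      (λ {u} {u′} m m′ f f′ _ _ → pureSide-injective α true u u′ (same-length m m′) f f′)
      onto
      where
      onto : ∀ {F G} → Clique α β (suc n) F G → length F ≡ suc n → length G ≡ 0 →
        ∃ λ u → u ∈ allWords n × (F ⊆ₚ pureSide α true u × pureSide α true u ⊆ₚ F) × (G ⊆ₚ [] × [] ⊆ₚ G)
      onto {F} {[]} c e refl = extend (pure-onto α true unique₁ compatible₁ bounded₁ e)
        where
        open Clique c
        extend : (∃ λ u → u ∈ allWords n × F ⊆ₚ pureSide α true u × pureSide α true u ⊆ₚ F) →
          ∃ λ u → u ∈ allWords n × (F ⊆ₚ pureSide α true u × pureSide α true u ⊆ₚ F) × ([] ⊆ₚ [] × [] ⊆ₚ [])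
        extend (u , u∈ , F~) = u , u∈ , F~ , (λ ()) , λ ()

    backward-facets : fvec E 0 (suc n) ≡ length (allWords n)
    backward-facets = count-facets r (allWords n) (λ _ → []) (pureSide β false) (allWords-unique n)
      (λ {u} m → record
        { unique₁ = []
        ; unique₂ = side-unique β false (pureFrame false (cnt true u) (cnt false u)) u
        ; compatible₁ = record { lo<hi = λ () ; chain = λ () }
        ; compatible₂ = side-compatible β false (pureFrame false (cnt true u) (cnt false u)) u
        ; cross = λ ()
        ; bounded₁ = λ ()
        ; bounded₂ = pure-bounded β false m })
      (λ m → refl , pure-size β false m)
      (λ {u} {u′} m m′ _ _ f f′ → pureSide-injective β false u u′ (same-length m m′) f f′)
      onto
      where
      onto : ∀ {F G} → Clique α β (suc n) F G → length F ≡ 0 → length G ≡ suc n →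
        ∃ λ u → u ∈ allWords n × (F ⊆ₚ [] × [] ⊆ₚ F) × (G ⊆ₚ pureSide β false u × pureSide β false u ⊆ₚ G)
      onto {[]} {G} c refl e = extend (pure-onto β false unique₂ compatible₂ bounded₂ e)
        where
        open Clique c
        extend : (∃ λ u → u ∈ allWords n × G ⊆ₚ pureSide β false u × pureSide β false u ⊆ₚ G) →
          ∃ λ u → u ∈ allWords n × ([] ⊆ₚ [] × [] ⊆ₚ []) × (G ⊆ₚ pureSide β false u × pureSide β false u ⊆ₚ G)
        extend (u , u∈ , G~) = u , u∈ , ((λ ()) , λ ()) , G~

module _ {n α β} {E : Graph (suc n)} (r : Rules E α β) where

  facet-numbers : (∀ k → 1 ≤ k → k ≤ n → fvec E k (suc n ∸ k) ≡ formula (suc n) k)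
    × (fvec E (suc n) 0 ≡ 2 ^ n) × (fvec E 0 (suc n) ≡ 2 ^ n)
  facet-numbers = mixed , trans (forward-facets r) (length-allWords n) , trans (backward-facets r) (length-allWords n)
    where
    mixed : ∀ k → 1 ≤ k → k ≤ n → fvec E k (suc n ∸ k) ≡ formula (suc n) k
    mixed k 1≤k k≤n = trans
      (mixed-facets r k (suc n ∸ k) 1≤k (m<n⇒0<n∸m (s≤s k≤n)) (m+[n∸m]≡n (m≤n⇒m≤1+n k≤n)))
      (length-codes k (suc n ∸ k))

theorem8p7 : (n : ℕ) → 1 ≤ n → (E : Graph n) → RevlexUFT E →
    (∀ k → 1 ≤ k → k ≤ n ∸ 1 → fvec E k (n ∸ k) ≡ formula n k)
    × (fvec E n 0 ≡ 2 ^ (n ∸ 1))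
    × (fvec E 0 n ≡ 2 ^ (n ∸ 1))
theorem8p7 (suc n) _ E uft = facet-numbers (proj₂ (proj₂ (revlexUFT-rules uft)))
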